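{- Let $(K_n,P_n)_{n\ge 1}$ be a scaling with $\theta_n=(K_n,P_n)$ such that $\lim_{n\to\infty}q(\theta_n)=1$, and let $(p_n)_{n\ge1}$ be a sequence in $[0,1]$ with $p_n\sim 1-q(\theta_n)$. Then $$\frac{\mathbb{E}[T_n(\theta_n)]}{\mathbb{E}[T_n(p_n)]}\sim 1+\frac{P_n}{K_n^3}\qquad (n\to\infty).$$
   Context: Random key graph: for positive integers $K\le P$ write $\theta=(K,P)$, and let $K_1(\theta),\dots,K_n(\theta)$ be i.i.d. random subsets, each uniformly distributed over the $K$-element subsets of a fixed set of $P$ keys. The random key graph $\mathbb{K}(n;\theta)$ has vertex set $\{1,\dots,n\}$, and distinct nodes $i,j$ are adjacent iff $K_i(\theta)\cap K_j(\theta)\neq\emptyset$. $T_n(\theta)$ denotes the number of (unlabelled) triangles in $\mathbb{K}(n;\theta)$. For $p\in[0,1]$, $\mathbb{G}(n;p)$ is the Erdős–Rényi graph on $\{1,\dots,n\}$ with (independent) edge probability $p$, and $T_n(p)$ is the number of (unlabelled) triangles in $\mathbb{G}(n;p)$. Define $q(\theta)=0$ if $P<2K$ and $q(\theta)=\binom{P-K}{K}/\binom{P}{K}$ if $2K\le P$. A scaling is a pair of sequences $K,P$ of positive integers, with values denoted $K_n,P_n$ ($n=1,2,\dots$), such that $K_n\le P_n$ for all $n=2,3,\dots$. The notation $x_n\sim y_n$ means $\lim_{n\to\infty}x_n/y_n=1$. -}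

module Defs where

open import Data.Bool.Base using (Bool; true; false)
open import Data.Empty using (⊥)
open import Data.Fin.Base as Fin using (Fin)
import Data.Fin.Properties as Fin
open import Data.Fin.Subset using (Subset; inside; outside; ∣_∣; Nonempty; _∩_) renaming (⊥ to ∅)
open import Data.Fin.Subset.Properties using (nonempty?; ∩-comm; ∣⊥∣≡0)
open import Data.Integer.Base using (+_)
open import Data.List.Base
  using (List; []; _∷_; _++_; map; filter; foldr; length; allFin; cartesianProduct; cartesianProductWith)
open import Data.List.Membership.Propositional using (_∈_)
open import Data.List.Membership.Propositional.Properties
  using (∈-map⁺; ∈-++⁺ˡ; ∈-++⁺ʳ; ∈-filter⁺)
open import Data.List.Relation.Unary.Any using (here; there)
open import Data.Nat.Base as ℕ using (ℕ; zero; suc; s≤s; z≤n)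
open import Data.Nat.Combinatorics using (_C_; nCk≡n!/k![n-k]!; k![n∸k]!∣n!)
open import Data.Nat.Divisibility using (∣⇒≤)
import Data.Nat.DivMod as ℕ
import Data.Nat.Properties as ℕ
open import Data.Product.Base using (Σ-syntax; ∃-syntax; _×_; _,_)
open import Data.Rational.Base as ℚ using (ℚ; 0ℚ; 1ℚ)
import Data.Rational.Properties as ℚ
open import Data.Rational.Solver using (module +-*-Solver)
open import Data.Sum.Base using (_⊎_; inj₁; inj₂)
open import Data.Unit.Base using (⊤; tt)
open import Data.Vec.Base using (Vec; []; _∷_; lookup)
open import Function.Base using (_∘_)
open import Relation.Binary.Core using (Rel)
open import Relation.Binary.Definitions using (Decidable; Symmetric; Irreflexive)
open import Relation.Binary.PropositionalEquality
open import Level using (0ℓ)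
open import Relation.Nullary using (¬_; Dec; yes; no; contradiction)
open import Relation.Nullary.Decidable using (_×-dec_; ¬?)
import Data.Bool.Properties as Bool

abstract
  half : ∀ ε → 0ℚ ℚ.< ε → Σ[ δ ∈ ℚ ] 0ℚ ℚ.< δ × δ ℚ.+ δ ≡ ε
  half ε 0<ε = ℚ.½ ℚ.* ε , pos , eq
    where
    pos : 0ℚ ℚ.< ℚ.½ ℚ.* ε
    pos = subst (ℚ._< ℚ.½ ℚ.* ε) (ℚ.*-zeroʳ ℚ.½) (ℚ.*-monoʳ-<-pos ℚ.½ 0<ε)
    eq : ℚ.½ ℚ.* ε ℚ.+ ℚ.½ ℚ.* ε ≡ ε
    eq = trans (sym (ℚ.*-distribʳ-+ ε ℚ.½ ℚ.½)) (ℚ.*-identityˡ ε)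

SettlesWithin : ℚ → (ℕ → ℚ) → Set
SettlesWithin ε x = ∃[ N ] (∀ m n → N ℕ.≤ m → N ℕ.≤ n → ℚ.∣ x m ℚ.- x n ∣ ℚ.< ε)

IsCauchy : (ℕ → ℚ) → Set
IsCauchy x = ∀ ε → 0ℚ ℚ.< ε → SettlesWithin ε x

-- Cauchy sequences of rationals; equality of reals is _≃ᵣ_ below.
record ℝ : Set where
  constructor mkℝ
  field
    approx : ℕ → ℚ
    cauchy : IsCauchy approx

open ℝ public

infix 4 _≃ᵣ_ _<ᵣ_ _≤ᵣ_ _#ᵣ_

_≃ᵣ_ : ℝ → ℝ → Set
x ≃ᵣ y = ∀ ε → 0ℚ ℚ.< ε →
  ∃[ N ] (∀ n → N ℕ.≤ n → ℚ.∣ approx x n ℚ.- approx y n ∣ ℚ.< ε)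

_<ᵣ_ : ℝ → ℝ → Set
x <ᵣ y = Σ[ ε ∈ ℚ ] 0ℚ ℚ.< ε ×
  ∃[ N ] (∀ n → N ℕ.≤ n → approx x n ℚ.+ ε ℚ.≤ approx y n)

_≤ᵣ_ : ℝ → ℝ → Set
x ≤ᵣ y = ¬ (y <ᵣ x)

-- Apartness, the constructive form of "x and y are different".
_#ᵣ_ : ℝ → ℝ → Set
x #ᵣ y = x <ᵣ y ⊎ y <ᵣ x

abstract
  const-cauchy : ∀ q → IsCauchy (λ _ → q)
  const-cauchy q ε 0<ε = 0 , λ _ _ _ _ →
    subst (ℚ._< ε) (sym (cong ℚ.∣_∣ (ℚ.+-inverseʳ q))) 0<ε

ofℚ : ℚ → ℝ
ofℚ q = mkℝ (λ _ → q) (const-cauchy q)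

ofℕ : ℕ → ℝ
ofℕ n = ofℚ (+ n ℚ./ 1)

0ᵣ 1ᵣ : ℝ
0ᵣ = ofℚ 0ℚ
1ᵣ = ofℚ 1ℚ

abstract
  +-cauchy : ∀ {x y} → IsCauchy x → IsCauchy y → IsCauchy (λ n → x n ℚ.+ y n)
  +-cauchy {x} {y} cx cy ε 0<ε
    with half ε 0<ε
  ... | δ , 0<δ , δ+δ≡ε with cx δ 0<δ | cy δ 0<δ
  ... | M , hM | N , hN = M ℕ.⊔ N , λ m n lm ln →
    let open ℚ.≤-Reasoning
        hx = hM m n (ℕ.m⊔n≤o⇒m≤o M N lm) (ℕ.m⊔n≤o⇒m≤o M N ln)
        hy = hN m n (ℕ.m⊔n≤o⇒n≤o M N lm) (ℕ.m⊔n≤o⇒n≤o M N ln)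
        open +-*-Solver
    in begin-strict
      ℚ.∣ (x m ℚ.+ y m) ℚ.- (x n ℚ.+ y n) ∣
        ≡⟨ cong ℚ.∣_∣ (solve 4 (λ a b c d → (a :+ b) :- (c :+ d) := (a :- c) :+ (b :- d))
                         refl (x m) (y m) (x n) (y n)) ⟩
      ℚ.∣ (x m ℚ.- x n) ℚ.+ (y m ℚ.- y n) ∣
        ≤⟨ ℚ.∣p+q∣≤∣p∣+∣q∣ (x m ℚ.- x n) (y m ℚ.- y n) ⟩
      ℚ.∣ x m ℚ.- x n ∣ ℚ.+ ℚ.∣ y m ℚ.- y n ∣
        <⟨ ℚ.+-mono-< hx hy ⟩
      δ ℚ.+ δ ≡⟨ δ+δ≡ε ⟩
      ε ∎

  neg-cauchy : ∀ {x} → IsCauchy x → IsCauchy (λ n → ℚ.- x n)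
  neg-cauchy {x} cx ε 0<ε with cx ε 0<ε
  ... | N , hN = N , λ m n lm ln →
    let open +-*-Solver in
    subst (ℚ._< ε)
      (sym (trans (cong ℚ.∣_∣ (solve 2 (λ a b → (:- a) :- (:- b) := :- (a :- b)) refl (x m) (x n)))
                  (ℚ.∣-p∣≡∣p∣ (x m ℚ.- x n))))
      (hN m n lm ln)

  ∣∣-lipschitz : ∀ a b → ℚ.∣ ℚ.∣ a ∣ ℚ.- ℚ.∣ b ∣ ∣ ℚ.≤ ℚ.∣ a ℚ.- b ∣
  ∣∣-lipschitz a b with ℚ.∣p∣≡p∨∣p∣≡-p (ℚ.∣ a ∣ ℚ.- ℚ.∣ b ∣)
  ... | inj₁ e = subst (ℚ._≤ ℚ.∣ a ℚ.- b ∣) (sym e) (one a b)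
    where
    one : ∀ a b → ℚ.∣ a ∣ ℚ.- ℚ.∣ b ∣ ℚ.≤ ℚ.∣ a ℚ.- b ∣
    one a b = begin
      ℚ.∣ a ∣ ℚ.- ℚ.∣ b ∣
        ≡⟨ cong (λ t → ℚ.∣ t ∣ ℚ.- ℚ.∣ b ∣) (solve 2 (λ a b → a := (a :- b) :+ b) refl a b) ⟩
      ℚ.∣ (a ℚ.- b) ℚ.+ b ∣ ℚ.- ℚ.∣ b ∣
        ≤⟨ ℚ.+-monoˡ-≤ (ℚ.- ℚ.∣ b ∣) (ℚ.∣p+q∣≤∣p∣+∣q∣ (a ℚ.- b) b) ⟩
      (ℚ.∣ a ℚ.- b ∣ ℚ.+ ℚ.∣ b ∣) ℚ.- ℚ.∣ b ∣
        ≡⟨ solve 2 (λ u v → (u :+ v) :- v := u) refl ℚ.∣ a ℚ.- b ∣ ℚ.∣ b ∣ ⟩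
      ℚ.∣ a ℚ.- b ∣ ∎
      where open ℚ.≤-Reasoning
            open +-*-Solver
  ... | inj₂ e = begin
      ℚ.∣ ℚ.∣ a ∣ ℚ.- ℚ.∣ b ∣ ∣ ≡⟨ e ⟩
      ℚ.- (ℚ.∣ a ∣ ℚ.- ℚ.∣ b ∣) ≡⟨ solve 2 (λ u v → :- (u :- v) := v :- u) refl ℚ.∣ a ∣ ℚ.∣ b ∣ ⟩
      ℚ.∣ b ∣ ℚ.- ℚ.∣ a ∣
        ≡⟨ cong (λ t → ℚ.∣ t ∣ ℚ.- ℚ.∣ a ∣) (solve 2 (λ a b → b := (b :- a) :+ a) refl a b) ⟩
      ℚ.∣ (b ℚ.- a) ℚ.+ a ∣ ℚ.- ℚ.∣ a ∣
        ≤⟨ ℚ.+-monoˡ-≤ (ℚ.- ℚ.∣ a ∣) (ℚ.∣p+q∣≤∣p∣+∣q∣ (b ℚ.- a) a) ⟩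
      (ℚ.∣ b ℚ.- a ∣ ℚ.+ ℚ.∣ a ∣) ℚ.- ℚ.∣ a ∣
        ≡⟨ solve 2 (λ u v → (u :+ v) :- v := u) refl ℚ.∣ b ℚ.- a ∣ ℚ.∣ a ∣ ⟩
      ℚ.∣ b ℚ.- a ∣
        ≡⟨ cong ℚ.∣_∣ (solve 2 (λ a b → b :- a := :- (a :- b)) refl a b) ⟩
      ℚ.∣ ℚ.- (a ℚ.- b) ∣ ≡⟨ ℚ.∣-p∣≡∣p∣ (a ℚ.- b) ⟩
      ℚ.∣ a ℚ.- b ∣ ∎
      where open ℚ.≤-Reasoning
            open +-*-Solver

  abs-cauchy : ∀ {x} → IsCauchy x → IsCauchy (λ n → ℚ.∣ x n ∣)
  abs-cauchy {x} cx ε 0<ε with cx ε 0<ε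
  ... | N , hN = N , λ m n lm ln → ℚ.≤-<-trans (∣∣-lipschitz (x m) (x n)) (hN m n lm ln)

  bounded : ∀ {x} → IsCauchy x → Σ[ B ∈ ℚ ] 0ℚ ℚ.< B × ∃[ N ] (∀ n → N ℕ.≤ n → ℚ.∣ x n ∣ ℚ.≤ B)
  bounded {x} cx with cx 1ℚ (ℚ.positive⁻¹ 1ℚ)
  ... | N , hN = 1ℚ ℚ.+ ℚ.∣ x N ∣ , ℚ.+-mono-<-≤ (ℚ.positive⁻¹ 1ℚ) (ℚ.0≤∣p∣ (x N)) , N , λ n l →
    let open ℚ.≤-Reasoning
        open +-*-Solver
    in begin
      ℚ.∣ x n ∣ ≡⟨ cong ℚ.∣_∣ (solve 2 (λ a b → a := (a :- b) :+ b) refl (x n) (x N)) ⟩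
      ℚ.∣ (x n ℚ.- x N) ℚ.+ x N ∣ ≤⟨ ℚ.∣p+q∣≤∣p∣+∣q∣ (x n ℚ.- x N) (x N) ⟩
      ℚ.∣ x n ℚ.- x N ∣ ℚ.+ ℚ.∣ x N ∣ ≤⟨ ℚ.+-monoˡ-≤ ℚ.∣ x N ∣ (ℚ.<⇒≤ (hN n N l ℕ.≤-refl)) ⟩
      1ℚ ℚ.+ ℚ.∣ x N ∣ ∎

  *-mono-∣∣ : ∀ {a b c d} → 0ℚ ℚ.≤ a → 0ℚ ℚ.≤ d → a ℚ.≤ b → c ℚ.≤ d → a ℚ.* c ℚ.≤ b ℚ.* d
  *-mono-∣∣ {a} {b} {c} {d} 0≤a 0≤d a≤b c≤d = ℚ.≤-trans
    (ℚ.*-monoˡ-≤-nonNeg a {{ℚ.nonNegative 0≤a}} c≤d)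
    (ℚ.*-monoʳ-≤-nonNeg d {{ℚ.nonNegative 0≤d}} a≤b)

  ratio : ∀ ε S → 0ℚ ℚ.< ε → 0ℚ ℚ.< S → Σ[ δ ∈ ℚ ] 0ℚ ℚ.< δ × δ ℚ.* S ≡ ε
  ratio ε S 0<ε 0<S = ε ℚ.* i , pos , eq
    where
    i : ℚ
    i = (ℚ.1/ S) {{ℚ.>-nonZero 0<S}}
    i>0 : ℚ.Positive i
    i>0 = ℚ.1/pos⇒pos S {{ℚ.positive 0<S}}
    pos : 0ℚ ℚ.< ε ℚ.* i
    pos = subst (ℚ._< ε ℚ.* i) (ℚ.*-zeroˡ i) (ℚ.*-monoˡ-<-pos i {{i>0}} 0<ε)
    eq : ε ℚ.* i ℚ.* S ≡ ε
    eq = trans (ℚ.*-assoc ε i S)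
      (trans (cong (ε ℚ.*_) (ℚ.*-inverseˡ S {{ℚ.>-nonZero 0<S}})) (ℚ.*-identityʳ ε))

  *-estimate : ∀ a b c d A B → ℚ.∣ a ∣ ℚ.≤ A → ℚ.∣ d ∣ ℚ.≤ B →
    ℚ.∣ a ℚ.* b ℚ.- c ℚ.* d ∣ ℚ.≤ A ℚ.* ℚ.∣ b ℚ.- d ∣ ℚ.+ ℚ.∣ a ℚ.- c ∣ ℚ.* B
  *-estimate a b c d A B ha hd = begin
    ℚ.∣ a ℚ.* b ℚ.- c ℚ.* d ∣
      ≡⟨ cong ℚ.∣_∣ (solve 4 (λ a b c d → a :* b :- c :* d := a :* (b :- d) :+ (a :- c) :* d)
                       refl a b c d) ⟩
    ℚ.∣ a ℚ.* (b ℚ.- d) ℚ.+ (a ℚ.- c) ℚ.* d ∣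
      ≤⟨ ℚ.∣p+q∣≤∣p∣+∣q∣ (a ℚ.* (b ℚ.- d)) ((a ℚ.- c) ℚ.* d) ⟩
    ℚ.∣ a ℚ.* (b ℚ.- d) ∣ ℚ.+ ℚ.∣ (a ℚ.- c) ℚ.* d ∣
      ≡⟨ cong₂ ℚ._+_ (ℚ.∣p*q∣≡∣p∣*∣q∣ a (b ℚ.- d)) (ℚ.∣p*q∣≡∣p∣*∣q∣ (a ℚ.- c) d) ⟩
    ℚ.∣ a ∣ ℚ.* ℚ.∣ b ℚ.- d ∣ ℚ.+ ℚ.∣ a ℚ.- c ∣ ℚ.* ℚ.∣ d ∣
      ≤⟨ ℚ.+-mono-≤
           (ℚ.*-monoʳ-≤-nonNeg ℚ.∣ b ℚ.- d ∣ {{ℚ.∣-∣-nonNeg (b ℚ.- d)}} ha)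
           (ℚ.*-monoˡ-≤-nonNeg ℚ.∣ a ℚ.- c ∣ {{ℚ.∣-∣-nonNeg (a ℚ.- c)}} hd) ⟩
    A ℚ.* ℚ.∣ b ℚ.- d ∣ ℚ.+ ℚ.∣ a ℚ.- c ∣ ℚ.* B ∎
    where open ℚ.≤-Reasoning
          open +-*-Solver

  *-cauchy : ∀ {x y} → IsCauchy x → IsCauchy y → IsCauchy (λ n → x n ℚ.* y n)
  *-cauchy {x} {y} cx cy ε 0<ε = step (bounded {x} cx) (bounded {y} cy)
    where
    module _ (A : ℚ) (0<A : 0ℚ ℚ.< A) (NA : ℕ) (hA : ∀ n → NA ℕ.≤ n → ℚ.∣ x n ∣ ℚ.≤ A)
             (B : ℚ) (0<B : 0ℚ ℚ.< B) (NB : ℕ) (hB : ∀ n → NB ℕ.≤ n → ℚ.∣ y n ∣ ℚ.≤ B)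
             (δ : ℚ) (δS≡ε : δ ℚ.* (A ℚ.+ B) ≡ ε)
             (M : ℕ) (hM : ∀ m n → M ℕ.≤ m → M ℕ.≤ n → ℚ.∣ x m ℚ.- x n ∣ ℚ.< δ)
             (N : ℕ) (hN : ∀ m n → N ℕ.≤ m → N ℕ.≤ n → ℚ.∣ y m ℚ.- y n ∣ ℚ.< δ) where
      A*δ+δ*B : A ℚ.* δ ℚ.+ δ ℚ.* B ≡ ε
      A*δ+δ*B = trans (cong (ℚ._+ δ ℚ.* B) (ℚ.*-comm A δ))
        (trans (sym (ℚ.*-distribˡ-+ δ A B)) δS≡ε)

      bound : ∀ m n → NA ℕ.≤ m → NB ℕ.≤ n → M ℕ.≤ m → M ℕ.≤ n → N ℕ.≤ m → N ℕ.≤ n →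
        ℚ.∣ x m ℚ.* y m ℚ.- x n ℚ.* y n ∣ ℚ.< ε
      bound m n NA≤m NB≤n M≤m M≤n N≤m N≤n = ℚ.≤-<-trans
        (*-estimate (x m) (y m) (x n) (y n) A B (hA m NA≤m) (hB n NB≤n))
        (subst (A ℚ.* ℚ.∣ y m ℚ.- y n ∣ ℚ.+ ℚ.∣ x m ℚ.- x n ∣ ℚ.* B ℚ.<_) A*δ+δ*B
          (ℚ.+-mono-< (ℚ.*-monoʳ-<-pos A {{ℚ.positive 0<A}} (hN m n N≤m N≤n))
                      (ℚ.*-monoˡ-<-pos B {{ℚ.positive 0<B}} (hM m n M≤m M≤n))))

      finish : SettlesWithin ε (λ n → x n ℚ.* y n)
      finish = (NA ℕ.⊔ NB) ℕ.⊔ (M ℕ.⊔ N) , λ m n lm ln → bound m n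
        (ℕ.m⊔n≤o⇒m≤o NA NB (ab lm)) (ℕ.m⊔n≤o⇒n≤o NA NB (ab ln))
        (ℕ.m⊔n≤o⇒m≤o M N (mn lm)) (ℕ.m⊔n≤o⇒m≤o M N (mn ln))
        (ℕ.m⊔n≤o⇒n≤o M N (mn lm)) (ℕ.m⊔n≤o⇒n≤o M N (mn ln))
        where
        ab : ∀ {k} → (NA ℕ.⊔ NB) ℕ.⊔ (M ℕ.⊔ N) ℕ.≤ k → NA ℕ.⊔ NB ℕ.≤ k
        ab = ℕ.m⊔n≤o⇒m≤o (NA ℕ.⊔ NB) (M ℕ.⊔ N)
        mn : ∀ {k} → (NA ℕ.⊔ NB) ℕ.⊔ (M ℕ.⊔ N) ℕ.≤ k → M ℕ.⊔ N ℕ.≤ k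
        mn = ℕ.m⊔n≤o⇒n≤o (NA ℕ.⊔ NB) (M ℕ.⊔ N)

    step : Σ[ B ∈ ℚ ] 0ℚ ℚ.< B × ∃[ N ] (∀ n → N ℕ.≤ n → ℚ.∣ x n ∣ ℚ.≤ B) →
           Σ[ B ∈ ℚ ] 0ℚ ℚ.< B × ∃[ N ] (∀ n → N ℕ.≤ n → ℚ.∣ y n ∣ ℚ.≤ B) → SettlesWithin ε (λ n → x n ℚ.* y n)
    step (A , 0<A , NA , hA) (B , 0<B , NB , hB) =
      step₂ (ratio ε (A ℚ.+ B) 0<ε (ℚ.+-mono-< 0<A 0<B))
      where
      step₂ : Σ[ δ ∈ ℚ ] 0ℚ ℚ.< δ × δ ℚ.* (A ℚ.+ B) ≡ ε → SettlesWithin ε (λ n → x n ℚ.* y n)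
      step₂ (δ , 0<δ , δS≡ε) =
        let (M , hM) = cx δ 0<δ
            (N , hN) = cy δ 0<δ
        in finish A 0<A NA hA B 0<B NB hB δ δS≡ε M hM N hN

infix  8 -ᵣ_
infixl 7 _*ᵣ_
infixl 6 _+ᵣ_ _-ᵣ_

_+ᵣ_ : ℝ → ℝ → ℝ
x +ᵣ y = mkℝ (λ n → approx x n ℚ.+ approx y n) (+-cauchy {approx x} {approx y} (cauchy x) (cauchy y))

_*ᵣ_ : ℝ → ℝ → ℝ
x *ᵣ y = mkℝ (λ n → approx x n ℚ.* approx y n) (*-cauchy {approx x} {approx y} (cauchy x) (cauchy y))

-ᵣ_ : ℝ → ℝ
-ᵣ_ x = mkℝ (λ n → ℚ.- approx x n) (neg-cauchy {approx x} (cauchy x))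

_-ᵣ_ : ℝ → ℝ → ℝ
_-ᵣ_ x y = x +ᵣ (-ᵣ y)

∣_∣ᵣ : ℝ → ℝ
∣ x ∣ᵣ = mkℝ (λ n → ℚ.∣ approx x n ∣) (abs-cauchy {approx x} (cauchy x))

-- Total reciprocal on ℚ; a real apart from 0 has nonzero approximations
-- from some index on, so the value at 0 does not matter below.
recip : ℚ → ℚ
recip a with a ℚ.≟ 0ℚ
... | yes _  = 0ℚ
... | no a≢0 = (ℚ.1/ a) {{ℚ.≢-nonZero a≢0}}

abstract
  recip-inverse : ∀ a → a ≢ 0ℚ → recip a ℚ.* a ≡ 1ℚ
  recip-inverse a a≢0 with a ℚ.≟ 0ℚ
  ... | yes a≡0  = contradiction a≡0 a≢0
  ... | no  a≢0′ = ℚ.*-inverseˡ a {{ℚ.≢-nonZero a≢0′}}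

  away : ∀ x → x #ᵣ 0ᵣ → Σ[ δ ∈ ℚ ] 0ℚ ℚ.< δ × ∃[ N ] (∀ n → N ℕ.≤ n → δ ℚ.≤ ℚ.∣ approx x n ∣)
  away x (inj₁ (δ , 0<δ , N , h)) = δ , 0<δ , N , λ n l →
    let open ℚ.≤-Reasoning
        open +-*-Solver
        a = approx x n
        δ≤-a : δ ℚ.≤ ℚ.- a
        δ≤-a = begin
          δ ≡⟨ solve 2 (λ a d → d := (:- a) :+ (a :+ d)) refl a δ ⟩
          (ℚ.- a) ℚ.+ (a ℚ.+ δ) ≤⟨ ℚ.+-monoʳ-≤ (ℚ.- a) (h n l) ⟩
          (ℚ.- a) ℚ.+ 0ℚ ≡⟨ ℚ.+-identityʳ (ℚ.- a) ⟩
          ℚ.- a ∎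
    in begin
      δ ≤⟨ δ≤-a ⟩
      ℚ.- a ≡⟨ ℚ.0≤p⇒∣p∣≡p (ℚ.≤-trans (ℚ.<⇒≤ 0<δ) δ≤-a) ⟨
      ℚ.∣ ℚ.- a ∣ ≡⟨ ℚ.∣-p∣≡∣p∣ a ⟩
      ℚ.∣ a ∣ ∎
  away x (inj₂ (δ , 0<δ , N , h)) = δ , 0<δ , N , λ n l →
    let a = approx x n
        δ≤a = subst (ℚ._≤ a) (ℚ.+-identityˡ δ) (h n l)
    in subst (δ ℚ.≤_) (sym (ℚ.0≤p⇒∣p∣≡p (ℚ.≤-trans (ℚ.<⇒≤ 0<δ) δ≤a))) δ≤a

  away-≢0 : ∀ {a δ} → 0ℚ ℚ.< δ → δ ℚ.≤ ℚ.∣ a ∣ → a ≢ 0ℚ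
  away-≢0 0<δ δ≤∣a∣ refl = ℚ.<-irrefl refl (ℚ.<-≤-trans 0<δ δ≤∣a∣)

  recip-estimate : ∀ a b δ → 0ℚ ℚ.< δ → δ ℚ.≤ ℚ.∣ a ∣ → δ ℚ.≤ ℚ.∣ b ∣ →
    ℚ.∣ recip a ℚ.- recip b ∣ ℚ.* (δ ℚ.* δ) ℚ.≤ ℚ.∣ a ℚ.- b ∣
  recip-estimate a b δ 0<δ ha hb = estimate (recip a) (recip b)
    (recip-inverse a (away-≢0 0<δ ha)) (recip-inverse b (away-≢0 0<δ hb))
    where
    estimate : ∀ u v → u ℚ.* a ≡ 1ℚ → v ℚ.* b ≡ 1ℚ → ℚ.∣ u ℚ.- v ∣ ℚ.* (δ ℚ.* δ) ℚ.≤ ℚ.∣ a ℚ.- b ∣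
    estimate u v ua vb = begin
      ℚ.∣ u ℚ.- v ∣ ℚ.* (δ ℚ.* δ)
        ≤⟨ ℚ.*-monoˡ-≤-nonNeg ℚ.∣ u ℚ.- v ∣ {{ℚ.∣-∣-nonNeg (u ℚ.- v)}}
             (*-mono-∣∣ (ℚ.<⇒≤ 0<δ) (ℚ.0≤∣p∣ b) ha hb) ⟩
      ℚ.∣ u ℚ.- v ∣ ℚ.* (ℚ.∣ a ∣ ℚ.* ℚ.∣ b ∣)
        ≡⟨ cong (ℚ.∣ u ℚ.- v ∣ ℚ.*_) (ℚ.∣p*q∣≡∣p∣*∣q∣ a b) ⟨
      ℚ.∣ u ℚ.- v ∣ ℚ.* ℚ.∣ a ℚ.* b ∣
        ≡⟨ ℚ.∣p*q∣≡∣p∣*∣q∣ (u ℚ.- v) (a ℚ.* b) ⟨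
      ℚ.∣ (u ℚ.- v) ℚ.* (a ℚ.* b) ∣
        ≡⟨ cong ℚ.∣_∣ (solve 4 (λ u v a b → (u :- v) :* (a :* b) := (u :* a) :* b :- (v :* b) :* a)
                         refl u v a b) ⟩
      ℚ.∣ (u ℚ.* a) ℚ.* b ℚ.- (v ℚ.* b) ℚ.* a ∣
        ≡⟨ cong₂ (λ s t → ℚ.∣ s ℚ.* b ℚ.- t ℚ.* a ∣) ua vb ⟩
      ℚ.∣ 1ℚ ℚ.* b ℚ.- 1ℚ ℚ.* a ∣
        ≡⟨ cong₂ (λ s t → ℚ.∣ s ℚ.- t ∣) (ℚ.*-identityˡ b) (ℚ.*-identityˡ a) ⟩
      ℚ.∣ b ℚ.- a ∣
        ≡⟨ cong ℚ.∣_∣ (solve 2 (λ a b → b :- a := :- (a :- b)) refl a b) ⟩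
      ℚ.∣ ℚ.- (a ℚ.- b) ∣
        ≡⟨ ℚ.∣-p∣≡∣p∣ (a ℚ.- b) ⟩
      ℚ.∣ a ℚ.- b ∣ ∎
      where open ℚ.≤-Reasoning
            open +-*-Solver

  *-pos : ∀ a b → 0ℚ ℚ.< a → 0ℚ ℚ.< b → 0ℚ ℚ.< a ℚ.* b
  *-pos a b 0<a 0<b = subst (ℚ._< a ℚ.* b) (ℚ.*-zeroˡ b) (ℚ.*-monoˡ-<-pos b {{ℚ.positive 0<b}} 0<a)

  recip-cauchy : ∀ x → x #ᵣ 0ᵣ → IsCauchy (λ n → recip (approx x n))
  recip-cauchy x x#0 ε 0<ε = step (away x x#0)
    where
    step : Σ[ δ ∈ ℚ ] 0ℚ ℚ.< δ × ∃[ N ] (∀ n → N ℕ.≤ n → δ ℚ.≤ ℚ.∣ approx x n ∣) → SettlesWithin ε (λ n → recip (approx x n))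
    step (δ , 0<δ , M , hM) = step₂ (*-pos δ δ 0<δ 0<δ)
      where
      step₂ : 0ℚ ℚ.< δ ℚ.* δ → SettlesWithin ε (λ n → recip (approx x n))
      step₂ 0<δδ =
        let (N , hN) = cauchy x (ε ℚ.* (δ ℚ.* δ)) (*-pos ε (δ ℚ.* δ) 0<ε 0<δδ) in
        M ℕ.⊔ N , λ m n lm ln →
          ℚ.*-cancelʳ-<-nonNeg (δ ℚ.* δ) {{ℚ.nonNegative (ℚ.<⇒≤ 0<δδ)}}
            (ℚ.≤-<-trans
              (recip-estimate (approx x m) (approx x n) δ 0<δ
                (hM m (ℕ.m⊔n≤o⇒m≤o M N lm)) (hM n (ℕ.m⊔n≤o⇒m≤o M N ln)))
              (hN m n (ℕ.m⊔n≤o⇒n≤o M N lm) (ℕ.m⊔n≤o⇒n≤o M N ln)))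

_⁻¹ᵣ⟨_⟩ : (x : ℝ) → x #ᵣ 0ᵣ → ℝ
x ⁻¹ᵣ⟨ x#0 ⟩ = mkℝ (λ n → recip (approx x n)) (recip-cauchy x x#0)

-- Sequences, limits and asymptotic equivalence.  Quotients such as
-- E[Tₙ(θₙ)] / E[Tₙ(pₙ)] make sense only for large n (for n < 3 both
-- expectations vanish), hence sequences carry a domain of definition.

record PSeq : Set₁ where
  field
    Defined : ℕ → Set
    at      : ∀ n → Defined n → ℝ

open PSeq public

total : (ℕ → ℝ) → PSeq
total x = record { Defined = λ _ → ⊤ ; at = λ n _ → x n }

infixl 7 _⊘_
infixl 6 _⊕_
infix  4 _⟶_ _∼_

_⊕_ : PSeq → PSeq → PSeq
x ⊕ y = record
  { Defined = λ n → Defined x n × Defined y n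
  ; at      = λ n (dx , dy) → at x n dx +ᵣ at y n dy
  }

_⊘_ : PSeq → PSeq → PSeq
x ⊘ y = record
  { Defined = λ n → Defined x n × (Σ[ d ∈ Defined y n ] at y n d #ᵣ 0ᵣ)
  ; at      = λ n (dx , (dy , y#0)) → at x n dx *ᵣ (at y n dy ⁻¹ᵣ⟨ y#0 ⟩)
  }

-- In particular x ⟶ l requires x n to be defined for all large n.
_⟶_ : PSeq → ℝ → Set
x ⟶ l = ∀ ε → 0ᵣ <ᵣ ε →
  ∃[ N ] (∀ n → N ℕ.≤ n → Σ[ d ∈ Defined x n ] ∣ at x n d -ᵣ l ∣ᵣ <ᵣ ε)

_∼_ : PSeq → PSeq → Set
x ∼ y = x ⊘ y ⟶ 1ᵣ

-- Finitely supported laws, as weighted outcomes (repetitions allowed).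
Dist : Set → Set
Dist A = List (A × ℝ)

𝔼 : ∀ {A} → Dist A → (A → ℝ) → ℝ
𝔼 D X = foldr (λ (a , w) s → w *ᵣ X a +ᵣ s) 0ᵣ D

uniform : ∀ {A} (xs : List A) → .{{ℕ.NonZero (length xs)}} → Dist A
uniform xs = map (λ a → a , ofℚ (+ 1 ℚ./ length xs)) xs

bernoulli : ℝ → Dist Bool
bernoulli p = (true , p) ∷ (false , 1ᵣ -ᵣ p) ∷ []

-- Law of f A B for independent A and B.
joint : ∀ {A B C : Set} → (A → B → C) → Dist A → Dist B → Dist C
joint f = cartesianProductWith (λ (a , u) (b , v) → f a b , u *ᵣ v)

iid : ∀ {A} n → Dist A → Dist (Vec A n)
iid zero    D = ([] , 1ᵣ) ∷ []
iid (suc n) D = joint _∷_ D (iid n D)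

record SimpleGraph (n : ℕ) : Set₁ where
  field
    Adj        : Rel (Fin n) 0ℓ
    adj?       : Decidable Adj
    adj-sym    : Symmetric Adj
    adj-irrefl : Irreflexive _≡_ Adj

-- Each triangle is counted once, through its increasing labelling.
triangles : ∀ {n} → SimpleGraph n → ℕ
triangles {n} G = length (filter triangle? (cartesianProduct (allFin n) (cartesianProduct (allFin n) (allFin n))))
  where
  open SimpleGraph G
  triangle? : (t : Fin n × Fin n × Fin n) → let (i , j , k) = t in
    Dec ((i Fin.< j × j Fin.< k) × (Adj i j × Adj j k × Adj i k))
  triangle? (i , j , k) =
    (i Fin.<? j ×-dec j Fin.<? k) ×-dec (adj? i j ×-dec adj? j k ×-dec adj? i k)

allSubsets : ∀ P → List (Subset P)
allSubsets zero    = [] ∷ []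
allSubsets (suc P) = map (outside ∷_) (allSubsets P) ++ map (inside ∷_) (allSubsets P)

subsetsOfSize : ∀ K P → List (Subset P)
subsetsOfSize K P = filter (λ S → ∣ S ∣ ℕ.≟ K) (allSubsets P)

∈-allSubsets : ∀ {P} (S : Subset P) → S ∈ allSubsets P
∈-allSubsets []            = here refl
∈-allSubsets (outside ∷ S) = ∈-++⁺ˡ (∈-map⁺ (outside ∷_) (∈-allSubsets S))
∈-allSubsets {suc P} (inside  ∷ S) =
  ∈-++⁺ʳ (map (outside ∷_) (allSubsets P)) (∈-map⁺ (inside ∷_) (∈-allSubsets S))

someSubset : ∀ {K P} → K ℕ.≤ P → Σ[ S ∈ Subset P ] ∣ S ∣ ≡ K
someSubset {P = P} z≤n = ∅ , ∣⊥∣≡0 P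
someSubset (s≤s K≤P) with someSubset K≤P
... | S , eq = inside ∷ S , cong suc eq

∈⇒nonZero : ∀ {A : Set} {a : A} {xs} → a ∈ xs → ℕ.NonZero (length xs)
∈⇒nonZero (here _)  = _
∈⇒nonZero (there _) = _

subsetsOfSize-nonZero : ∀ {K P} → K ℕ.≤ P → ℕ.NonZero (length (subsetsOfSize K P))
subsetsOfSize-nonZero {K} {P} K≤P with someSubset K≤P
... | S , eq = ∈⇒nonZero (∈-filter⁺ (λ S → ∣ S ∣ ℕ.≟ K) (∈-allSubsets S) eq)

keyGraph : ∀ {n P} → Vec (Subset P) n → SimpleGraph n
keyGraph rings = record
  { Adj        = λ i j → i ≢ j × Nonempty (lookup rings i ∩ lookup rings j)
  ; adj?       = λ i j → ¬? (i Fin.≟ j) ×-dec nonempty? (lookup rings i ∩ lookup rings j)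
  ; adj-sym    = λ {i} {j} (i≢j , ne) →
      i≢j ∘ sym , subst Nonempty (∩-comm (lookup rings i) (lookup rings j)) ne
  ; adj-irrefl = λ i≡j (i≢j , _) → i≢j i≡j
  }

keyRings : ∀ n K P → K ℕ.≤ P → Dist (Vec (Subset P) n)
keyRings n K P K≤P = iid n (uniform (subsetsOfSize K P) {{subsetsOfSize-nonZero K≤P}})

𝔼T-key : ∀ n K P → K ℕ.≤ P → ℝ
𝔼T-key n K P K≤P = 𝔼 (keyRings n K P K≤P) (λ rings → ofℕ (triangles (keyGraph rings)))

-- One Boolean per pair of distinct vertices: the head of v ∷ t lists the
-- pairs containing the first vertex, t the pairs among the others.
data Coins : ℕ → Set where
  []  : Coins zero
  _∷_ : ∀ {n} → Vec Bool n → Coins n → Coins (suc n)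

coins : ∀ n → ℝ → Dist (Coins n)
coins zero    p = ([] , 1ᵣ) ∷ []
coins (suc n) p = joint _∷_ (iid n (bernoulli p)) (coins n p)

Edge : ∀ {n} → Coins n → Fin n → Fin n → Set
Edge (v ∷ t) Fin.zero    Fin.zero    = ⊥
Edge (v ∷ t) Fin.zero    (Fin.suc j) = lookup v j ≡ true
Edge (v ∷ t) (Fin.suc i) Fin.zero    = lookup v i ≡ true
Edge (v ∷ t) (Fin.suc i) (Fin.suc j) = Edge t i j

edge? : ∀ {n} (t : Coins n) → Decidable (Edge t)
edge? (v ∷ t) Fin.zero    Fin.zero    = no λ ()
edge? (v ∷ t) Fin.zero    (Fin.suc j) = lookup v j Bool.≟ true
edge? (v ∷ t) (Fin.suc i) Fin.zero    = lookup v i Bool.≟ true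
edge? (v ∷ t) (Fin.suc i) (Fin.suc j) = edge? t i j

edge-sym : ∀ {n} (t : Coins n) i j → Edge t i j → Edge t j i
edge-sym (v ∷ t) Fin.zero    (Fin.suc j) e = e
edge-sym (v ∷ t) (Fin.suc i) Fin.zero    e = e
edge-sym (v ∷ t) (Fin.suc i) (Fin.suc j) e = edge-sym t i j e

edge-irrefl : ∀ {n} (t : Coins n) i → ¬ Edge t i i
edge-irrefl (v ∷ t) (Fin.suc i) e = edge-irrefl t i e

coinGraph : ∀ {n} → Coins n → SimpleGraph n
coinGraph t = record
  { Adj        = Edge t
  ; adj?       = edge? t
  ; adj-sym    = λ {i} {j} → edge-sym t i j
  ; adj-irrefl = λ { {i} refl → edge-irrefl t i }
  }

𝔼T-ER : ∀ n → ℝ → ℝ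
𝔼T-ER n p = 𝔼 (coins n p) (λ t → ofℕ (triangles (coinGraph t)))

C-nonZero : ∀ {K P} → K ℕ.≤ P → ℕ.NonZero (P C K)
C-nonZero {K} {P} K≤P = subst ℕ.NonZero (sym (nCk≡n!/k![n-k]! K≤P))
  (ℕ.>-nonZero (ℕ.m≥n⇒m/n>0 {{K ℕ.!* (P ℕ.∸ K) !≢0}}
    (∣⇒≤ {{P ℕ.!≢0}} (k![n∸k]!∣n! K≤P))))

q : ℕ → ℕ → ℚ
q K P with 2 ℕ.* K ℕ.≤? P
... | no  _    = 0ℚ
... | yes 2K≤P = (+ ((P ℕ.∸ K) C K) ℚ./ (P C K))
  {{C-nonZero (ℕ.≤-trans (ℕ.m≤m+n K (1 ℕ.* K)) 2K≤P)}}

-- The sequences are indexed by n = 1, 2, …; their values at 0 are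
-- unconstrained and play no role.
record Scaling : Set where
  field
    K P   : ℕ → ℕ
    K-pos : ∀ n → 1 ℕ.≤ n → 1 ℕ.≤ K n
    P-pos : ∀ n → 1 ℕ.≤ n → 1 ℕ.≤ P n
    K≤P   : ∀ n → 2 ℕ.≤ n → K n ℕ.≤ P n

module _ (θ : Scaling) where
  open Scaling θ

  qSeq : ℕ → ℝ
  qSeq n = ofℚ (q (K n) (P n))

  -- K₁ ≤ P₁ may fail, in which case the graph is undefined for n = 1.
  𝔼T-keySeq : PSeq
  𝔼T-keySeq = record
    { Defined = λ n → K n ℕ.≤ P n
    ; at      = λ n → 𝔼T-key n (K n) (P n)
    }

  1+P/K³ : PSeq
  1+P/K³ = total (λ _ → 1ᵣ) ⊕ total (λ n → ofℕ (P n)) ⊘ total (λ n → ofℕ (K n ℕ.^ 3))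

𝔼T-ERSeq : (ℕ → ℝ) → PSeq
𝔼T-ERSeq p = total (λ n → 𝔼T-ER n (p n))

{-# OPTIONS --safe #-}

-- Every triple of vertices is a triangle with the same probability, so both
-- expectations are the number of triples times a triangle probability: p³ for
-- 𝔾(n;p) and, by inclusion–exclusion, β = (1 - q)³ + q³ (1 - r/q²) for the key
-- graph, where r = C(P-2K,K)/C(P,K).  Put x = K²/P and b = P/K³.  The products
--   q = ∏ᵢ (1 - K/(P-i))   and   r/q² = ∏ᵢ (1 - (K/(P-K-i))²),   0 ≤ i < K,
-- give 1 - q ≈ x and 1 - r/q² ≈ K³/P² = b x³ up to factors 1 + O(x), hence
-- β ≈ (1 - q)³ (1 + b) ≈ p³ (1 + b).  All error terms are explicit, and
-- q → 1 forces x → 0 because x/(1+x) ≤ 1 - q.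

module Submission where

open import Defs
open import Data.Bool.Base using (Bool; true; false; _∧_)
import Data.Bool.Properties as Bool
open import Data.Fin.Base as Fin using (Fin)
import Data.Fin.Properties as Fin
open import Data.Fin.Subset using (Subset; inside; outside; ∣_∣; Nonempty; _∩_; _∪_; ∁) renaming (⊥ to ∅)
open import Data.Fin.Subset.Properties using (nonempty?; ∣∁p∣≡n∸∣p∣; ∣⊥∣≡0)
open import Data.Integer.Base as ℤ using (+_)
import Data.Integer.Properties as ℤ
open import Data.List.Base
  using (List; []; _∷_; _++_; map; filter; foldr; length; allFin; cartesianProduct)
open import Data.List.Membership.Propositional.Properties
  using (∈-allFin; ∈-cartesianProduct⁺; ∈-filter⁺)
open import Data.List.Relation.Unary.All as All using (All; []; _∷_)
open import Data.List.Relation.Unary.All.Properties using (all-filter)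
open import Data.Nat.Base as ℕ using (ℕ; zero; suc; s≤s; z≤n; _≤_)
open import Data.Nat.Combinatorics using (_C_; nCk+nC[k+1]≡[n+1]C[k+1])
import Data.Nat.Properties as ℕ
open import Data.Product.Base using (_×_; _,_; proj₁; proj₂; Σ-syntax)
open import Data.Rational.Base as ℚ using (ℚ; 0ℚ; 1ℚ)
import Data.Rational.Properties as ℚ
open import Data.Rational.Solver using (module +-*-Solver)
import Data.Rational.Unnormalised.Base as ℚᵘ
import Data.Rational.Unnormalised.Properties as ℚᵘ
open import Data.Sum.Base using (_⊎_; inj₁; inj₂)
open import Data.Unit.Base using (tt)
open import Data.Vec.Base using (Vec; []; _∷_; lookup; here; there)
open import Relation.Binary.PropositionalEquality hiding (J)
open import Relation.Nullary using (¬_; Dec; does; yes; no; _because_; contradiction)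
open import Relation.Nullary.Decidable using (_×-dec_; ¬?; dec-true; dec-false)
open import Relation.Unary using (Decidable)

open +-*-Solver using (solve; con; _:+_; _:*_; _:-_; :-_; _:=_)

-- Naturals and binomial coefficients in ℚ

-- The quotient `P/K³` may tend to 0, to infinity, or oscillate, so either summand of β can dominate
-- and every error has to be relative to `(1 - q)³ (1 + b)`. Separate approximations of q and r
-- cannot give this: inclusion-exclusion writes β as a signed sum of terms of order 1 that nearly
-- cancel. Hence the exact factorisation of r as q² times a product near 1, which performs the
-- cancellation algebraically and leaves two nonnegative summands, each estimated up to a factor.
-- Quotients are cleared before every estimate, so each inequality is polynomial and is certified by
-- writing the difference of its sides as a sum of products of nonnegative terms. The constants come
-- from a chain: `1 - q ≤ δ` gives `x ≤ 2δ`, the estimate of the second summand costs a relative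
-- error `16x ≤ 32δ`, and exchanging `1 - q` for p raises this to `64δ`. The standing assumption
-- `64δ ≤ 1` keeps all these errors below 1.

abstract
  -- Opaque, so that checking equations between rationals does not unfold normalised fractions.
  ι : ℕ → ℚ
  ι n = + n ℚ./ 1

  -- The bridge from the opaque `ι` back to the fractions that `ofℕ` produces in the statement.
  ofℕ-ι : ∀ n → + n ℚ./ 1 ≡ ι n
  ofℕ-ι n = refl

  -- Passing to unnormalised fractions reduces the following identities to cross-multiplication of
  -- integers.
  toℚᵘ-/ : ∀ a b .{{_ : ℕ.NonZero b}} → ℚ.toℚᵘ (+ a ℚ./ b) ℚᵘ.≃ (+ a ℚᵘ./ b)
  toℚᵘ-/ a (suc b) = ℚ.toℚᵘ-fromℚᵘ (ℚᵘ.mkℚᵘ (+ a) b)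

  ι-+ : ∀ a b → ι (a ℕ.+ b) ≡ ι a ℚ.+ ι b
  ι-+ a b = ℚ.toℚᵘ-injective (ℚᵘ.≃-trans (toℚᵘ-/ (a ℕ.+ b) 1)
    (ℚᵘ.≃-trans (ℚᵘ.*≡* (cong (ℤ._* + 1)
        (sym (cong₂ ℤ._+_ (ℤ.*-identityʳ (+ a)) (ℤ.*-identityʳ (+ b))))))
      (ℚᵘ.≃-sym (ℚᵘ.≃-trans (ℚ.toℚᵘ-homo-+ (ι a) (ι b))
        (ℚᵘ.+-cong (toℚᵘ-/ a 1) (toℚᵘ-/ b 1))))))

  ι-* : ∀ a b → ι (a ℕ.* b) ≡ ι a ℚ.* ι b
  ι-* a b = ℚ.toℚᵘ-injective (ℚᵘ.≃-trans (toℚᵘ-/ (a ℕ.* b) 1)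
    (ℚᵘ.≃-trans (ℚᵘ.*≡* (cong (ℤ._* + 1) (ℤ.pos-* a b)))
      (ℚᵘ.≃-sym (ℚᵘ.≃-trans (ℚ.toℚᵘ-homo-* (ι a) (ι b))
        (ℚᵘ.*-cong (toℚᵘ-/ a 1) (toℚᵘ-/ b 1))))))

  /*ι : ∀ a b .{{_ : ℕ.NonZero b}} → (+ a ℚ./ b) ℚ.* ι b ≡ ι a
  /*ι a b@(suc b-1) = ℚ.toℚᵘ-injective (ℚᵘ.≃-trans (ℚ.toℚᵘ-homo-* (+ a ℚ./ b) (ι b))
    (ℚᵘ.≃-trans (ℚᵘ.*-cong (toℚᵘ-/ a b) (toℚᵘ-/ b 1))
      (ℚᵘ.≃-trans (ℚᵘ.*≡* (trans (ℤ.*-identityʳ (+ a ℤ.* + b))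
          (cong (+ a ℤ.*_) (sym (cong +_ (ℕ.*-identityʳ b))))))
        (ℚᵘ.≃-sym (toℚᵘ-/ a 1)))))

  ι-0 : ι 0 ≡ 0ℚ
  ι-0 = refl

  ι-1 : ι 1 ≡ 1ℚ
  ι-1 = refl

  0≤ι : ∀ n → 0ℚ ℚ.≤ ι n
  0≤ι n = ℚ.nonNegative⁻¹ (ι n) {{ℚ.normalize-nonNeg n 1}}

  0<ι : ∀ n .{{_ : ℕ.NonZero n}} → 0ℚ ℚ.< ι n
  0<ι (suc n) = ℚ.positive⁻¹ (ι (suc n)) {{ℚ.normalize-pos (suc n) 1}}

ι-suc : ∀ n → ι (suc n) ≡ 1ℚ ℚ.+ ι n
ι-suc n = trans (ι-+ 1 n) (cong (ℚ._+ ι n) ι-1)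

ι-∸ : ∀ {m n} → n ℕ.≤ m → ι (m ℕ.∸ n) ≡ ι m ℚ.- ι n
ι-∸ {m} {n} n≤m = trans (solve 2 (λ a b → a := (a :+ b) :- b) refl (ι (m ℕ.∸ n)) (ι n))
  (cong (ℚ._- ι n) (trans (sym (ι-+ (m ℕ.∸ n) n)) (cong ι (ℕ.m∸n+n≡m n≤m))))

0≤-+ : ∀ {a b} → 0ℚ ℚ.≤ a → 0ℚ ℚ.≤ b → 0ℚ ℚ.≤ a ℚ.+ b
0≤-+ = ℚ.+-mono-≤

0≤-* : ∀ {a b} → 0ℚ ℚ.≤ a → 0ℚ ℚ.≤ b → 0ℚ ℚ.≤ a ℚ.* b
0≤-* {a} {b} 0≤a 0≤b = subst (ℚ._≤ a ℚ.* b) (ℚ.*-zeroˡ b)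
  (ℚ.*-monoʳ-≤-nonNeg b {{ℚ.nonNegative 0≤b}} 0≤a)

0≤-gap : ∀ {a b} → a ℚ.≤ b → 0ℚ ℚ.≤ b ℚ.- a
0≤-gap {a} {b} a≤b = subst (ℚ._≤ b ℚ.- a) (ℚ.+-inverseʳ a) (ℚ.+-monoˡ-≤ (ℚ.- a) a≤b)

-- The form of nearly all polynomial inequalities below: `c` is a visibly nonnegative certificate,
-- and the ring solver checks the identity.
≤-by-gap : ∀ {a b c} → 0ℚ ℚ.≤ c → b ≡ a ℚ.+ c → a ℚ.≤ b
≤-by-gap {a} {b} {c} 0≤c b≡a+c = subst₂ ℚ._≤_ (ℚ.+-identityʳ a) (sym b≡a+c) (ℚ.+-monoʳ-≤ a 0≤c)

ι-mono-≤ : ∀ {m n} → m ℕ.≤ n → ι m ℚ.≤ ι n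
ι-mono-≤ {m} {n} m≤n = ≤-by-gap (0≤ι (n ℕ.∸ m))
  (trans (cong ι (sym (ℕ.m+[n∸m]≡n m≤n))) (ι-+ m (n ℕ.∸ m)))

abstract
  binom : ℕ → ℕ → ℚ
  binom n k = ι (n C k)

  binom≡ιC : ∀ n k → binom n k ≡ ι (n C k)
  binom≡ιC n k = refl

  -- With `m = n ∸ k` this is the definition of `q` cleared of its denominator, the only form in
  -- which the estimates use it.
  /*binom : ∀ m n k .{{_ : ℕ.NonZero (n C k)}} →
    (+ (m C k) ℚ./ (n C k)) ℚ.* binom n k ≡ binom m k
  /*binom m n k = /*ι (m C k) (n C k)

  binom-0 : ∀ n → binom n 0 ≡ 1ℚ
  binom-0 n = ι-1

  binom-empty : ∀ k → binom 0 (suc k) ≡ 0ℚ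
  binom-empty k = ι-0

  binom-pascal : ∀ n k → binom (suc n) (suc k) ≡ binom n k ℚ.+ binom n (suc k)
  binom-pascal n k =
    trans (cong ι (sym (nCk+nC[k+1]≡[n+1]C[k+1] n k))) (ι-+ (n C k) (n C suc k))

-- The absorption rule, without subtraction so that k > n is covered.
binom-absorb : ∀ n k → ι (suc k) ℚ.* binom n (suc k) ℚ.+ ι k ℚ.* binom n k ≡ ι n ℚ.* binom n k
binom-absorb zero zero = begin
  ι 1 ℚ.* binom 0 1 ℚ.+ ι 0 ℚ.* binom 0 0
    ≡⟨ cong (λ t → ι 1 ℚ.* t ℚ.+ ι 0 ℚ.* binom 0 0) (binom-empty 0) ⟩
  ι 1 ℚ.* 0ℚ ℚ.+ ι 0 ℚ.* binom 0 0
    ≡⟨ solve 2 (λ a b → a :* con 0ℚ :+ b := b) refl (ι 1) (ι 0 ℚ.* binom 0 0) ⟩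
  ι 0 ℚ.* binom 0 0 ∎
  where open ≡-Reasoning
binom-absorb zero (suc k) = begin
  ι (2 ℕ.+ k) ℚ.* binom 0 (2 ℕ.+ k) ℚ.+ ι (suc k) ℚ.* binom 0 (suc k)
    ≡⟨ cong₂ (λ s t → ι (2 ℕ.+ k) ℚ.* s ℚ.+ ι (suc k) ℚ.* t) (binom-empty (suc k)) (binom-empty k) ⟩
  ι (2 ℕ.+ k) ℚ.* 0ℚ ℚ.+ ι (suc k) ℚ.* 0ℚ
    ≡⟨ solve 3 (λ a b c → a :* con 0ℚ :+ b :* con 0ℚ := c :* con 0ℚ) refl (ι (2 ℕ.+ k)) (ι (suc k)) (ι 0) ⟩
  ι 0 ℚ.* 0ℚ
    ≡⟨ cong (ι 0 ℚ.*_) (sym (binom-empty k)) ⟩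
  ι 0 ℚ.* binom 0 (suc k) ∎
  where open ≡-Reasoning
binom-absorb (suc n) zero
  rewrite binom-pascal n 0 | binom-0 (suc n) | binom-0 n | ι-suc n | ι-1 | ι-0 = begin
  1ℚ ℚ.* (1ℚ ℚ.+ binom n 1) ℚ.+ 0ℚ ℚ.* 1ℚ
    ≡⟨ solve 1 (λ a → con 1ℚ :* (con 1ℚ :+ a) :+ con 0ℚ :* con 1ℚ
                   := con 1ℚ :+ (con 1ℚ :* a :+ con 0ℚ :* con 1ℚ)) refl (binom n 1) ⟩
  1ℚ ℚ.+ (1ℚ ℚ.* binom n 1 ℚ.+ 0ℚ ℚ.* 1ℚ)
    ≡⟨ cong (1ℚ ℚ.+_) absorb₀ ⟩
  1ℚ ℚ.+ ι n ℚ.* 1ℚ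
    ≡⟨ solve 1 (λ a → con 1ℚ :+ a :* con 1ℚ := (con 1ℚ :+ a) :* con 1ℚ) refl (ι n) ⟩
  (1ℚ ℚ.+ ι n) ℚ.* 1ℚ ∎
  where
  open ≡-Reasoning
  absorb₀ : 1ℚ ℚ.* binom n 1 ℚ.+ 0ℚ ℚ.* 1ℚ ≡ ι n ℚ.* 1ℚ
  absorb₀ = subst₂ (λ s t → s ℚ.* binom n 1 ℚ.+ t ℚ.* 1ℚ ≡ ι n ℚ.* 1ℚ) ι-1 ι-0
    (subst (λ t → ι 1 ℚ.* binom n 1 ℚ.+ ι 0 ℚ.* t ≡ ι n ℚ.* t) (binom-0 n) (binom-absorb n 0))
-- Pascal's rule splits both binomials on the left; the terms regroup into the rule for `n` at
-- `suc k` and at `k`.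
binom-absorb (suc n) (suc k)
  rewrite binom-pascal n (suc k) | binom-pascal n k | ι-suc n | ι-suc (suc k) = begin
  (1ℚ ℚ.+ ι (suc k)) ℚ.* (b₁ ℚ.+ b₂) ℚ.+ ι (suc k) ℚ.* (b₀ ℚ.+ b₁)
    ≡⟨ solve 4 (λ k a b c → (con 1ℚ :+ k) :* (b :+ c) :+ k :* (a :+ b)
         := ((con 1ℚ :+ k) :* c :+ k :* b) :+ b :+ (k :* b :+ k :* a)) refl (ι (suc k)) b₀ b₁ b₂ ⟩
  ((1ℚ ℚ.+ ι (suc k)) ℚ.* b₂ ℚ.+ ι (suc k) ℚ.* b₁) ℚ.+ b₁ ℚ.+ (ι (suc k) ℚ.* b₁ ℚ.+ ι (suc k) ℚ.* b₀)
    ≡⟨ cong₂ (λ s t → s ℚ.+ b₁ ℚ.+ t) absorb₁ absorb₀ ⟩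
  ι n ℚ.* b₁ ℚ.+ b₁ ℚ.+ (ι n ℚ.* b₀ ℚ.+ b₀)
    ≡⟨ solve 3 (λ n a b → n :* b :+ b :+ (n :* a :+ a) := (con 1ℚ :+ n) :* (a :+ b)) refl (ι n) b₀ b₁ ⟩
  (1ℚ ℚ.+ ι n) ℚ.* (b₀ ℚ.+ b₁) ∎
  where
  open ≡-Reasoning
  b₀ = binom n k
  b₁ = binom n (suc k)
  b₂ = binom n (2 ℕ.+ k)
  absorb₁ : (1ℚ ℚ.+ ι (suc k)) ℚ.* b₂ ℚ.+ ι (suc k) ℚ.* b₁ ≡ ι n ℚ.* b₁
  absorb₁ = subst (λ t → t ℚ.* b₂ ℚ.+ ι (suc k) ℚ.* b₁ ≡ ι n ℚ.* b₁) (ι-suc (suc k)) (binom-absorb n (suc k))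
  absorb₀ : ι (suc k) ℚ.* b₁ ℚ.+ ι (suc k) ℚ.* b₀ ≡ ι n ℚ.* b₀ ℚ.+ b₀
  absorb₀ = begin
    ι (suc k) ℚ.* b₁ ℚ.+ ι (suc k) ℚ.* b₀
      ≡⟨ cong (λ t → ι (suc k) ℚ.* b₁ ℚ.+ t ℚ.* b₀) (ι-suc k) ⟩
    ι (suc k) ℚ.* b₁ ℚ.+ (1ℚ ℚ.+ ι k) ℚ.* b₀
      ≡⟨ solve 3 (λ x k a → x :+ (con 1ℚ :+ k) :* a := (x :+ k :* a) :+ a) refl (ι (suc k) ℚ.* b₁) (ι k) b₀ ⟩
    (ι (suc k) ℚ.* b₁ ℚ.+ ι k ℚ.* b₀) ℚ.+ b₀
      ≡⟨ cong (ℚ._+ b₀) (binom-absorb n k) ⟩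
    ι n ℚ.* b₀ ℚ.+ b₀ ∎

-- Expectations

∑ : {A : Set} → (A → ℚ) → List A → ℚ
∑ f = foldr (λ a s → f a ℚ.+ s) 0ℚ

∑-cong : {A : Set} {f g : A → ℚ} {xs : List A} → All (λ a → f a ≡ g a) xs → ∑ f xs ≡ ∑ g xs
∑-cong []       = refl
∑-cong (e ∷ es) = cong₂ ℚ._+_ e (∑-cong es)

∑-++ : {A : Set} (f : A → ℚ) (xs ys : List A) → ∑ f (xs ++ ys) ≡ ∑ f xs ℚ.+ ∑ f ys
∑-++ f []       ys = sym (ℚ.+-identityˡ (∑ f ys))
∑-++ f (x ∷ xs) ys = trans (cong (f x ℚ.+_) (∑-++ f xs ys)) (sym (ℚ.+-assoc (f x) (∑ f xs) (∑ f ys)))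

∑-map : {A B : Set} (f : B → ℚ) (g : A → B) (xs : List A) → ∑ f (map g xs) ≡ ∑ (λ a → f (g a)) xs
∑-map f g []       = refl
∑-map f g (x ∷ xs) = cong (f (g x) ℚ.+_) (∑-map f g xs)

∑-*ʳ : {A : Set} (f : A → ℚ) (c : ℚ) (xs : List A) → ∑ (λ a → f a ℚ.* c) xs ≡ ∑ f xs ℚ.* c
∑-*ʳ f c []       = sym (ℚ.*-zeroˡ c)
∑-*ʳ f c (x ∷ xs) = trans (cong (f x ℚ.* c ℚ.+_) (∑-*ʳ f c xs)) (sym (ℚ.*-distribʳ-+ c (f x) (∑ f xs)))

∑-zero : {A : Set} (xs : List A) → ∑ (λ _ → 0ℚ) xs ≡ 0ℚ
∑-zero []       = refl
∑-zero (x ∷ xs) = trans (ℚ.+-identityˡ _) (∑-zero xs)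

𝟙 : Bool → ℚ
𝟙 true  = 1ℚ
𝟙 false = 0ℚ

𝟙-∧ : ∀ a b → 𝟙 (a ∧ b) ≡ 𝟙 a ℚ.* 𝟙 b
𝟙-∧ true  b = sym (ℚ.*-identityˡ (𝟙 b))
𝟙-∧ false b = sym (ℚ.*-zeroˡ (𝟙 b))

-- This makes the ordering of `i`, `j`, `k` available inside a sum that runs over all triples.
𝟙-congʳ : {P : Set} (P? : Dec P) {x y : ℚ} → (P → x ≡ y) → 𝟙 (does P?) ℚ.* x ≡ 𝟙 (does P?) ℚ.* y
𝟙-congʳ (yes p) x≡y = cong (1ℚ ℚ.*_) (x≡y p)
𝟙-congʳ (no  _) {x} {y} _ = trans (ℚ.*-zeroˡ x) (sym (ℚ.*-zeroˡ y))

∑-filter : {A : Set} {P : A → Set} (P? : Decidable P) (f : A → ℚ) (xs : List A) →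
  ∑ f (filter P? xs) ≡ ∑ (λ a → 𝟙 (does (P? a)) ℚ.* f a) xs
∑-filter P? f [] = refl
∑-filter P? f (x ∷ xs) with P? x
... | true  because _ = cong₂ ℚ._+_ (sym (ℚ.*-identityˡ (f x))) (∑-filter P? f xs)
... | false because _ = trans (∑-filter P? f xs)
  (sym (trans (cong (ℚ._+ _) (ℚ.*-zeroˡ (f x))) (ℚ.+-identityˡ _)))

ι-length : {A : Set} (xs : List A) → ι (length xs) ≡ ∑ (λ _ → 1ℚ) xs
ι-length []       = ι-0
ι-length (x ∷ xs) = trans (ι-suc (length xs)) (cong (1ℚ ℚ.+_) (ι-length xs))

ι-length-filter : {A : Set} {P : A → Set} (P? : Decidable P) (xs : List A) →
  ι (length (filter P? xs)) ≡ ∑ (λ a → 𝟙 (does (P? a))) xs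
ι-length-filter P? xs = trans (ι-length (filter P? xs)) (trans (∑-filter P? (λ _ → 1ℚ) xs)
  (∑-cong (All.universal (λ a → ℚ.*-identityʳ (𝟙 (does (P? a)))) xs)))

-- The m-th approximant of 𝔼; all identities between expectations hold
-- at every approximant, so the real numbers enter only in the limits.
E : {A : Set} → ℕ → Dist A → (A → ℚ) → ℚ
E m D f = ∑ (λ (a , w) → approx w m ℚ.* f a) D

approx-𝔼 : {A : Set} (m : ℕ) (D : Dist A) (X : A → ℝ) → approx (𝔼 D X) m ≡ E m D (λ a → approx (X a) m)
approx-𝔼 m []            X = refl
approx-𝔼 m ((a , w) ∷ D) X = cong (approx w m ℚ.* approx (X a) m ℚ.+_) (approx-𝔼 m D X)

module _ {A : Set} (m : ℕ) where

  E-cong : (D : Dist A) {f g : A → ℚ} → (∀ a → f a ≡ g a) → E m D f ≡ E m D g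
  E-cong D f≡g = ∑-cong (All.universal (λ (a , w) → cong (approx w m ℚ.*_) (f≡g a)) D)

  E-*ʳ : (D : Dist A) (f : A → ℚ) (c : ℚ) → E m D (λ a → f a ℚ.* c) ≡ E m D f ℚ.* c
  E-*ʳ D f c = trans
    (∑-cong (All.universal (λ (a , w) → sym (ℚ.*-assoc (approx w m) (f a) c)) D))
    (∑-*ʳ (λ (a , w) → approx w m ℚ.* f a) c D)

  E-*ˡ : (D : Dist A) (c : ℚ) (f : A → ℚ) → E m D (λ a → c ℚ.* f a) ≡ c ℚ.* E m D f
  E-*ˡ D c f = trans (E-cong D (λ a → ℚ.*-comm c (f a))) (trans (E-*ʳ D f c) (ℚ.*-comm (E m D f) c))

  E-+ : (D : Dist A) (f g : A → ℚ) → E m D (λ a → f a ℚ.+ g a) ≡ E m D f ℚ.+ E m D g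
  E-+ []            f g = refl
  E-+ ((a , w) ∷ D) f g = trans (cong (approx w m ℚ.* (f a ℚ.+ g a) ℚ.+_) (E-+ D f g))
    (solve 5 (λ w x y s t → w :* (x :+ y) :+ (s :+ t) := (w :* x :+ s) :+ (w :* y :+ t)) refl
      (approx w m) (f a) (g a) (E m D f) (E m D g))

  E-zero : (D : Dist A) → E m D (λ _ → 0ℚ) ≡ 0ℚ
  E-zero D = trans (∑-cong (All.universal (λ (a , w) → ℚ.*-zeroʳ (approx w m)) D)) (∑-zero D)

  E-∑ : {T : Set} (D : Dist A) (f : T → A → ℚ) (ts : List T) →
    E m D (λ a → ∑ (λ t → f t a) ts) ≡ ∑ (λ t → E m D (f t)) ts
  E-∑ D f []       = E-zero D
  E-∑ D f (t ∷ ts) = trans (E-+ D (f t) (λ a → ∑ (λ t → f t a) ts)) (cong (E m D (f t) ℚ.+_) (E-∑ D f ts))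

  -- Total mass exactly 1 at each approximant, not only in the limit. Bernoulli weights satisfy this
  -- because both are computed from the same approximant of `p`.
  IsProbability : Dist A → Set
  IsProbability D = E m D (λ _ → 1ℚ) ≡ 1ℚ

  E-const : (D : Dist A) → IsProbability D → ∀ c → E m D (λ _ → c) ≡ c
  E-const D prob c = begin
    E m D (λ _ → c)             ≡⟨ E-cong D (λ _ → sym (ℚ.*-identityˡ c)) ⟩
    E m D (λ _ → 1ℚ ℚ.* c)      ≡⟨ E-*ʳ D (λ _ → 1ℚ) c ⟩
    E m D (λ _ → 1ℚ) ℚ.* c      ≡⟨ cong (ℚ._* c) prob ⟩
    1ℚ ℚ.* c                    ≡⟨ ℚ.*-identityˡ c ⟩
    c                           ∎
    where open ≡-Reasoning

E-swap : {A B : Set} (m : ℕ) (D : Dist A) (D′ : Dist B) (f : A → B → ℚ) →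
  E m D (λ a → E m D′ (f a)) ≡ E m D′ (λ b → E m D (λ a → f a b))
E-swap m D []             f = E-zero m D
E-swap m D ((b , w) ∷ D′) f = begin
  E m D (λ a → approx w m ℚ.* f a b ℚ.+ E m D′ (f a))
    ≡⟨ E-+ m D (λ a → approx w m ℚ.* f a b) (λ a → E m D′ (f a)) ⟩
  E m D (λ a → approx w m ℚ.* f a b) ℚ.+ E m D (λ a → E m D′ (f a))
    ≡⟨ cong₂ ℚ._+_ (E-*ˡ m D (approx w m) (λ a → f a b)) (E-swap m D D′ f) ⟩
  approx w m ℚ.* E m D (λ a → f a b) ℚ.+ E m D′ (λ b → E m D (λ a → f a b)) ∎
  where open ≡-Reasoning

E-joint : {A B C : Set} (m : ℕ) (g : A → B → C) (D : Dist A) (D′ : Dist B) (f : C → ℚ) →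
  E m (joint g D D′) f ≡ E m D (λ a → E m D′ (λ b → f (g a b)))
E-joint m g []            D′ f = refl
E-joint m g ((a , u) ∷ D) D′ f = begin
  E m (map (λ (b , v) → g a b , u *ᵣ v) D′ ++ joint g D D′) f
    ≡⟨ ∑-++ weigh (map (λ (b , v) → g a b , u *ᵣ v) D′) (joint g D D′) ⟩
  E m (map (λ (b , v) → g a b , u *ᵣ v) D′) f ℚ.+ E m (joint g D D′) f
    ≡⟨ cong₂ ℚ._+_ (trans (∑-map weigh (λ (b , v) → g a b , u *ᵣ v) D′)
         (trans (∑-cong (All.universal (λ (b , v) → trans (cong (ℚ._* f (g a b)) (ℚ.*-comm (approx u m) (approx v m)))
              (trans (ℚ.*-assoc (approx v m) (approx u m) (f (g a b)))
                (cong (approx v m ℚ.*_) (ℚ.*-comm (approx u m) (f (g a b)))))) D′))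
          (trans (E-*ʳ m D′ (λ b → f (g a b)) (approx u m)) (ℚ.*-comm _ (approx u m)))))
       (E-joint m g D D′ f) ⟩
  approx u m ℚ.* E m D′ (λ b → f (g a b)) ℚ.+ E m D (λ a → E m D′ (λ b → f (g a b))) ∎
  where
  open ≡-Reasoning
  weigh : _ × ℝ → ℚ
  weigh (c , w) = approx w m ℚ.* f c

IsProbability-joint : {A B C : Set} (m : ℕ) (g : A → B → C) (D : Dist A) (D′ : Dist B) →
  IsProbability m D → IsProbability m D′ → IsProbability m (joint g D D′)
IsProbability-joint m g D D′ prob prob′ =
  trans (E-joint m g D D′ (λ _ → 1ℚ)) (trans (E-cong m D (λ _ → prob′)) prob)

module _ {A : Set} (m : ℕ) (D : Dist A) (prob : IsProbability m D) where

  iid-prob : ∀ n → IsProbability m (iid n D)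
  iid-prob zero    = refl
  iid-prob (suc n) = IsProbability-joint m _∷_ D (iid n D) prob (iid-prob n)

  -- Coordinates that `f` does not read integrate out by `E-const`. In the versions for two and
  -- three coordinates, the increasing order lets the recursion split off the head first, so the
  -- nested expectations appear in coordinate order.
  E-iid₁ : ∀ {n} (i : Fin n) (f : A → ℚ) → E m (iid n D) (λ v → f (lookup v i)) ≡ E m D f
  E-iid₁ {suc n} Fin.zero f = trans (E-joint m _∷_ D (iid n D) _)
    (E-cong m D (λ a → E-const m (iid n D) (iid-prob n) (f a)))
  E-iid₁ {suc n} (Fin.suc i) f = trans (E-joint m _∷_ D (iid n D) _)
    (trans (E-cong m D (λ _ → E-iid₁ i f)) (E-const m D prob _))

  E-iid₂ : ∀ {n} {i j : Fin n} → i Fin.< j → (f : A → A → ℚ) →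
    E m (iid n D) (λ v → f (lookup v i) (lookup v j)) ≡ E m D (λ a → E m D (f a))
  E-iid₂ {suc n} {Fin.zero} {Fin.suc j} _ f = trans (E-joint m _∷_ D (iid n D) _)
    (E-cong m D (λ a → E-iid₁ j (f a)))
  E-iid₂ {suc n} {Fin.suc i} {Fin.suc j} (s≤s i<j) f = trans (E-joint m _∷_ D (iid n D) _)
    (trans (E-cong m D (λ _ → E-iid₂ i<j f)) (E-const m D prob _))

  E-iid₃ : ∀ {n} {i j k : Fin n} → i Fin.< j → j Fin.< k → (f : A → A → A → ℚ) →
    E m (iid n D) (λ v → f (lookup v i) (lookup v j) (lookup v k)) ≡
    E m D (λ a → E m D (λ b → E m D (f a b)))
  E-iid₃ {suc n} {Fin.zero} {Fin.suc j} {Fin.suc k} _ (s≤s j<k) f = trans (E-joint m _∷_ D (iid n D) _)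
    (E-cong m D (λ a → E-iid₂ j<k (f a)))
  E-iid₃ {suc n} {Fin.suc i} {Fin.suc j} {Fin.suc k} (s≤s i<j) (s≤s j<k) f = trans (E-joint m _∷_ D (iid n D) _)
    (trans (E-cong m D (λ _ → E-iid₃ i<j j<k f)) (E-const m D prob _))

-- Triangle counts as sums over triples

triples : ∀ n → List (Fin n × Fin n × Fin n)
triples n = cartesianProduct (allFin n) (cartesianProduct (allFin n) (allFin n))

increasing? : ∀ {n} → Decidable {A = Fin n × Fin n × Fin n} (λ (i , j , k) → i Fin.< j × j Fin.< k)
increasing? (i , j , k) = i Fin.<? j ×-dec j Fin.<? k

-- A common factor of both expectations, which cancels in their ratio once it is nonzero.
#triples : ℕ → ℕ
#triples n = length (filter increasing? (triples n))

#triples-nonZero : ∀ {n} → 3 ℕ.≤ n → ℕ.NonZero (#triples n)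
#triples-nonZero {n} (s≤s (s≤s (s≤s _))) = ∈⇒nonZero {xs = filter increasing? (triples n)}
  (∈-filter⁺ increasing? (∈-cartesianProduct⁺ (∈-allFin Fin.zero)
    (∈-cartesianProduct⁺ (∈-allFin (Fin.suc Fin.zero)) (∈-allFin (Fin.suc (Fin.suc Fin.zero)))))
  (s≤s z≤n , s≤s (s≤s z≤n)))

module _ {n : ℕ} (G : SimpleGraph n) where
  open SimpleGraph G

  isTriangle : Fin n → Fin n → Fin n → Bool
  isTriangle i j k = does (adj? i j) ∧ (does (adj? j k) ∧ does (adj? i k))

  ι-triangles : ι (triangles G) ≡
    ∑ (λ t@(i , j , k) → 𝟙 (does (increasing? t)) ℚ.* 𝟙 (isTriangle i j k)) (triples n)
  -- The underscore stands for the decision procedure local to `triangles`; its `does` unfolds to a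
  -- conjunction, so order and adjacency separate.
  ι-triangles = trans (ι-length-filter _ (triples n))
    (∑-cong (All.universal (λ t@(i , j , k) → 𝟙-∧ (does (increasing? t)) (isTriangle i j k)) (triples n)))

-- Linearity of expectation: dependence between different triples is irrelevant, and β may vary with
-- `m` but not with the triple.
E-triangles : {A : Set} {n : ℕ} (m : ℕ) (D : Dist A) (G : A → SimpleGraph n) (β : ℚ) →
  (∀ i j k → i Fin.< j → j Fin.< k → E m D (λ a → 𝟙 (isTriangle (G a) i j k)) ≡ β) →
  approx (𝔼 D (λ a → ofℕ (triangles (G a)))) m ≡ ι (#triples n) ℚ.* β
E-triangles {n = n} m D G β hβ = begin
  approx (𝔼 D (λ a → ofℕ (triangles (G a)))) m
    ≡⟨ approx-𝔼 m D (λ a → ofℕ (triangles (G a))) ⟩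
  E m D (λ a → + triangles (G a) ℚ./ 1)
    ≡⟨ E-cong m D (λ a → trans (ofℕ-ι (triangles (G a))) (ι-triangles (G a))) ⟩
  E m D (λ a → ∑ (λ t@(i , j , k) → 𝟙 (does (increasing? t)) ℚ.* 𝟙 (isTriangle (G a) i j k)) (triples n))
    ≡⟨ E-∑ m D (λ t@(i , j , k) a → 𝟙 (does (increasing? t)) ℚ.* 𝟙 (isTriangle (G a) i j k)) (triples n) ⟩
  ∑ (λ t@(i , j , k) → E m D (λ a → 𝟙 (does (increasing? t)) ℚ.* 𝟙 (isTriangle (G a) i j k))) (triples n)
    ≡⟨ ∑-cong (All.universal one (triples n)) ⟩
  ∑ (λ t → 𝟙 (does (increasing? t)) ℚ.* β) (triples n)
    ≡⟨ ∑-*ʳ (λ t → 𝟙 (does (increasing? t))) β (triples n) ⟩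
  ∑ (λ t → 𝟙 (does (increasing? t))) (triples n) ℚ.* β
    ≡⟨ cong (ℚ._* β) (sym (ι-length-filter increasing? (triples n))) ⟩
  ι (#triples n) ℚ.* β ∎
  where
  open ≡-Reasoning
  one : (t : Fin n × Fin n × Fin n) → let (i , j , k) = t in
    E m D (λ a → 𝟙 (does (increasing? t)) ℚ.* 𝟙 (isTriangle (G a) i j k)) ≡ 𝟙 (does (increasing? t)) ℚ.* β
  one t@(i , j , k) = trans (E-*ˡ m D (𝟙 (does (increasing? t))) _)
    (𝟙-congʳ (increasing? t) (λ (i<j , j<k) → hβ i j k i<j j<k))

-- Product estimates

*-cancelʳ-≡ : ∀ {a b c} → 0ℚ ℚ.< c → a ℚ.* c ≡ b ℚ.* c → a ≡ b
*-cancelʳ-≡ {a} {b} {c} 0<c ac≡bc = ℚ.≤-antisym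
  (ℚ.*-cancelʳ-≤-pos c {{ℚ.positive 0<c}} (ℚ.≤-reflexive ac≡bc))
  (ℚ.*-cancelʳ-≤-pos c {{ℚ.positive 0<c}} (ℚ.≤-reflexive (sym ac≡bc)))

≤-cancelʳ : ∀ {a b c} → 0ℚ ℚ.< c → a ℚ.* c ℚ.≤ b ℚ.* c → a ℚ.≤ b
≤-cancelʳ {c = c} 0<c = ℚ.*-cancelʳ-≤-pos c {{ℚ.positive 0<c}}

*-monoˡ : ∀ {a b} c → 0ℚ ℚ.≤ c → a ℚ.≤ b → c ℚ.* a ℚ.≤ c ℚ.* b
*-monoˡ c 0≤c = ℚ.*-monoˡ-≤-nonNeg c {{ℚ.nonNegative 0≤c}}

*-monoʳ : ∀ {a b} c → 0ℚ ℚ.≤ c → a ℚ.≤ b → a ℚ.* c ℚ.≤ b ℚ.* c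
*-monoʳ c 0≤c = ℚ.*-monoʳ-≤-nonNeg c {{ℚ.nonNegative 0≤c}}

*-mono : ∀ {a b c d} → 0ℚ ℚ.≤ a → 0ℚ ℚ.≤ c → a ℚ.≤ b → c ℚ.≤ d → a ℚ.* c ℚ.≤ b ℚ.* d
*-mono 0≤a 0≤c a≤b c≤d = *-mono-∣∣ 0≤a (ℚ.≤-trans 0≤c c≤d) a≤b c≤d

0<⇒≢0 : ∀ {a} → 0ℚ ℚ.< a → a ≢ 0ℚ
0<⇒≢0 0<a a≡0 = ℚ.<-irrefl (sym a≡0) 0<a

0≤1 : 0ℚ ℚ.≤ 1ℚ
0≤1 = ℚ.nonNegative⁻¹ 1ℚ

infixl 8 _³
_³ : ℚ → ℚ
a ³ = a ℚ.* a ℚ.* a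

³-mono : ∀ {a b} → 0ℚ ℚ.≤ a → a ℚ.≤ b → a ³ ℚ.≤ b ³
³-mono 0≤a a≤b = *-mono (0≤-* 0≤a 0≤a) 0≤a (*-mono 0≤a 0≤a a≤b a≤b) a≤b

0≤³ : ∀ {a} → 0ℚ ℚ.≤ a → 0ℚ ℚ.≤ a ³
0≤³ 0≤a = 0≤-* (0≤-* 0≤a 0≤a) 0≤a

0<³ : ∀ {a} → 0ℚ ℚ.< a → 0ℚ ℚ.< a ³
0<³ {a} 0<a = *-pos (a ℚ.* a) a (*-pos a a 0<a 0<a) 0<a

∏1- : (ℕ → ℚ) → ℕ → ℚ
∏1- s zero    = 1ℚ
∏1- s (suc k) = ∏1- s k ℚ.* (1ℚ ℚ.- s k)

module _ (s : ℕ → ℚ) where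

  ∏1-≥0 : ∀ k → (∀ i → i ℕ.< k → s i ℚ.≤ 1ℚ) → 0ℚ ℚ.≤ ∏1- s k
  ∏1-≥0 zero    h = 0≤1
  ∏1-≥0 (suc k) h = 0≤-* (∏1-≥0 k (λ i i<k → h i (ℕ.m<n⇒m<1+n i<k))) (0≤-gap (h k ℕ.≤-refl))

  ∏1-≤1 : ∀ k → (∀ i → i ℕ.< k → 0ℚ ℚ.≤ s i × s i ℚ.≤ 1ℚ) → ∏1- s k ℚ.≤ 1ℚ
  ∏1-≤1 zero    h = ℚ.≤-refl
  ∏1-≤1 (suc k) h with h k ℕ.≤-refl
  ... | 0≤s , s≤1 = *-mono (∏1-≥0 k (λ i i<k → proj₂ (h i (ℕ.m<n⇒m<1+n i<k)))) (0≤-gap s≤1)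
    (∏1-≤1 k (λ i i<k → h i (ℕ.m<n⇒m<1+n i<k)))
    (≤-by-gap 0≤s (solve 1 (λ s → con 1ℚ := (con 1ℚ :- s) :+ s) refl (s k)))

  -- Weierstrass' product inequality, a union bound, with the subtraction moved to the other side.
  ∏1-≥1-k*Y : ∀ k {Y} → (∀ i → i ℕ.< k → 0ℚ ℚ.≤ s i × s i ℚ.≤ Y × s i ℚ.≤ 1ℚ) →
    1ℚ ℚ.≤ ∏1- s k ℚ.+ ι k ℚ.* Y
  ∏1-≥1-k*Y zero {Y} h = ℚ.≤-reflexive (sym (trans (cong (λ t → 1ℚ ℚ.+ t ℚ.* Y) ι-0)
    (solve 1 (λ y → con 1ℚ :+ con 0ℚ :* y := con 1ℚ) refl Y)))
  ∏1-≥1-k*Y (suc k) {Y} h with h k ℕ.≤-refl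
  ... | 0≤s , s≤Y , s≤1 = ≤-by-gap
    (0≤-+ (0≤-gap (∏1-≥1-k*Y k (λ i i<k → h i (ℕ.m<n⇒m<1+n i<k))))
      (0≤-+ (0≤-gap s≤Y) (0≤-* 0≤s (0≤-gap (∏1-≤1 k (λ i i<k →
        let (0≤sᵢ , _ , sᵢ≤1) = h i (ℕ.m<n⇒m<1+n i<k) in 0≤sᵢ , sᵢ≤1))))))
    (trans (cong (λ t → ∏1- s (suc k) ℚ.+ t ℚ.* Y) (ι-suc k))
      (solve 4 (λ p k s y → p :* (con 1ℚ :- s) :+ (con 1ℚ :+ k) :* y
        := con 1ℚ :+ ((p :+ k :* y :- con 1ℚ) :+ ((y :- s) :+ s :* (con 1ℚ :- p)))) refl
        (∏1- s k) (ι k) (s k) Y))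

  -- A rational substitute for the exponential bound on the product. The induction rests on
  -- `(1 - y)(1 + (k+1)y) = 1 + ky - (k+1)y²`, which is at most `1 + ky`.
  ∏1-*[1+k*y]≤1 : ∀ k {y} → 0ℚ ℚ.≤ y → (∀ i → i ℕ.< k → y ℚ.≤ s i × s i ℚ.≤ 1ℚ) →
    ∏1- s k ℚ.* (1ℚ ℚ.+ ι k ℚ.* y) ℚ.≤ 1ℚ
  ∏1-*[1+k*y]≤1 zero {y} 0≤y h = ℚ.≤-reflexive (trans (cong (λ t → 1ℚ ℚ.* (1ℚ ℚ.+ t ℚ.* y)) ι-0)
    (solve 1 (λ y → con 1ℚ :* (con 1ℚ :+ con 0ℚ :* y) := con 1ℚ) refl y))
  ∏1-*[1+k*y]≤1 (suc k) {y} 0≤y h with h k ℕ.≤-refl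
  ... | y≤s , s≤1 = subst (λ t → ∏1- s (suc k) ℚ.* (1ℚ ℚ.+ t ℚ.* y) ℚ.≤ 1ℚ) (sym (ι-suc k)) (≤-by-gap
    (0≤-+ (0≤-gap (∏1-*[1+k*y]≤1 k 0≤y (λ i i<k → h i (ℕ.m<n⇒m<1+n i<k))))
      (0≤-* (∏1-≥0 k (λ i i<k → proj₂ (h i (ℕ.m<n⇒m<1+n i<k))))
        (0≤-+ (0≤-* (0≤-gap y≤s) (0≤-+ 0≤1 (0≤-+ (0≤-* (0≤ι k) 0≤y) 0≤y)))
          (0≤-* (0≤-* 0≤y 0≤y) (0≤-+ (0≤ι k) 0≤1)))))
    (solve 4 (λ p k s y → con 1ℚ
          := p :* (con 1ℚ :- s) :* (con 1ℚ :+ (con 1ℚ :+ k) :* y)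
             :+ ((con 1ℚ :- p :* (con 1ℚ :+ k :* y))
             :+ p :* ((s :- y) :* (con 1ℚ :+ (k :* y :+ y)) :+ y :* y :* (k :+ con 1ℚ)))) refl
          (∏1- s k) (ι k) (s k) y))

-- Junk value: K ÷ 0 = 0.
infixl 7 _÷_
_÷_ : ℕ → ℕ → ℚ
K ÷ N = ι K ℚ.* recip (ι N)

0<recip : ∀ {a} → 0ℚ ℚ.< a → 0ℚ ℚ.< recip a
0<recip {a} 0<a = ℚ.*-cancelʳ-<-nonNeg a {{ℚ.nonNegative (ℚ.<⇒≤ 0<a)}}
  (subst₂ ℚ._<_ (sym (ℚ.*-zeroˡ a)) (sym (recip-inverse a (0<⇒≢0 0<a))) (ℚ.positive⁻¹ 1ℚ))

module _ (K : ℕ) where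

  ÷-* : ∀ {N} → 0 ℕ.< N → K ÷ N ℚ.* ι N ≡ ι K
  ÷-* {N} 0<N = trans (ℚ.*-assoc (ι K) (recip (ι N)) (ι N))
    (trans (cong (ι K ℚ.*_) (recip-inverse (ι N) (0<⇒≢0 (0<ι N {{ℕ.>-nonZero 0<N}}))))
      (ℚ.*-identityʳ (ι K)))

  0≤÷ : ∀ {N} → 0 ℕ.< N → 0ℚ ℚ.≤ K ÷ N
  0≤÷ {N} 0<N = 0≤-* (0≤ι K) (ℚ.<⇒≤ (0<recip (0<ι N {{ℕ.>-nonZero 0<N}})))

  ÷≤1 : ∀ {N} → 0 ℕ.< N → K ℕ.≤ N → K ÷ N ℚ.≤ 1ℚ
  ÷≤1 {N} 0<N K≤N = ≤-cancelʳ (0<ι N {{ℕ.>-nonZero 0<N}})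
    (subst₂ ℚ._≤_ (sym (÷-* 0<N)) (sym (ℚ.*-identityˡ (ι N))) (ι-mono-≤ K≤N))

  ÷-anti : ∀ {M N} → 0 ℕ.< M → M ℕ.≤ N → K ÷ N ℚ.≤ K ÷ M
  ÷-anti {M} {N} 0<M M≤N = ≤-cancelʳ (0<ι M {{ℕ.>-nonZero 0<M}}) (begin
    K ÷ N ℚ.* ι M ≤⟨ *-monoˡ (K ÷ N) (0≤÷ 0<N) (ι-mono-≤ M≤N) ⟩
    K ÷ N ℚ.* ι N ≡⟨ trans (÷-* 0<N) (sym (÷-* 0<M)) ⟩
    K ÷ M ℚ.* ι M ∎)
    where
    open ℚ.≤-Reasoning
    0<N : 0 ℕ.< N
    0<N = ℕ.≤-trans 0<M M≤N

  -- When `k` keys are drawn one by one without replacement from `N`, each factor is the conditional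
  -- probability that the next one misses a fixed set of `K` keys. The induction multiplies by
  -- `suc k` so that the absorption rule applies to both binomials.
  ∏-binom : ∀ {N} k → k ℕ.≤ N → K ℕ.≤ N →
    ∏1- (λ i → K ÷ (N ℕ.∸ i)) k ℚ.* binom N k ≡ binom (N ℕ.∸ K) k
  ∏-binom {N} zero    _   K≤N = trans (ℚ.*-identityˡ (binom N 0)) (trans (binom-0 N) (sym (binom-0 (N ℕ.∸ K))))
  ∏-binom {N} (suc k) k<N K≤N = *-cancelʳ-≡ (0<ι (suc k)) (begin
    π ℚ.* (1ℚ ℚ.- s) ℚ.* c′ ℚ.* ι (suc k)
      ≡⟨ solve 5 (λ π s c c′ t → π :* (con 1ℚ :- s) :* c′ :* t := π :* (con 1ℚ :- s) :* (t :* c′)) refl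
           π s c c′ (ι (suc k)) ⟩
    π ℚ.* (1ℚ ℚ.- s) ℚ.* (ι (suc k) ℚ.* c′)
      ≡⟨ cong (π ℚ.* (1ℚ ℚ.- s) ℚ.*_) (absorb N) ⟩
    π ℚ.* (1ℚ ℚ.- s) ℚ.* ((ι N ℚ.- ι k) ℚ.* c)
      ≡⟨ solve 4 (λ π s m c → π :* (con 1ℚ :- s) :* (m :* c) := (m :- s :* m) :* (π :* c)) refl
           π s (ι N ℚ.- ι k) c ⟩
    (ι N ℚ.- ι k ℚ.- s ℚ.* (ι N ℚ.- ι k)) ℚ.* (π ℚ.* c)
      ≡⟨ cong₂ (λ a b → (ι N ℚ.- ι k ℚ.- a) ℚ.* b) s*[N-k] (∏-binom k (ℕ.<⇒≤ k<N) K≤N) ⟩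
    (ι N ℚ.- ι k ℚ.- ι K) ℚ.* d
      ≡⟨ solve 4 (λ n k K d → (n :- k :- K) :* d := ((n :- K) :- k) :* d) refl (ι N) (ι k) (ι K) d ⟩
    (ι N ℚ.- ι K ℚ.- ι k) ℚ.* d
      ≡⟨ cong (λ t → (t ℚ.- ι k) ℚ.* d) (sym (ι-∸ K≤N)) ⟩
    (ι (N ℕ.∸ K) ℚ.- ι k) ℚ.* d
      ≡⟨ sym (absorb (N ℕ.∸ K)) ⟩
    ι (suc k) ℚ.* binom (N ℕ.∸ K) (suc k)
      ≡⟨ ℚ.*-comm (ι (suc k)) (binom (N ℕ.∸ K) (suc k)) ⟩
    binom (N ℕ.∸ K) (suc k) ℚ.* ι (suc k) ∎)
    where
    open ≡-Reasoning
    π = ∏1- (λ i → K ÷ (N ℕ.∸ i)) k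
    s = K ÷ (N ℕ.∸ k)
    c = binom N k
    c′ = binom N (suc k)
    d = binom (N ℕ.∸ K) k
    -- The difference is taken in ℚ and may be negative, since `N ∸ K` can be smaller than `k`.
    absorb : ∀ n → ι (suc k) ℚ.* binom n (suc k) ≡ (ι n ℚ.- ι k) ℚ.* binom n k
    absorb n = trans (solve 3 (λ x k c → x := (x :+ k :* c) :- k :* c) refl (ι (suc k) ℚ.* binom n (suc k)) (ι k) (binom n k))
      (trans (cong (ℚ._- ι k ℚ.* binom n k) (binom-absorb n k))
        (solve 3 (λ n k c → n :* c :- k :* c := (n :- k) :* c) refl (ι n) (ι k) (binom n k)))
    s*[N-k] : s ℚ.* (ι N ℚ.- ι k) ≡ ι K
    s*[N-k] = trans (cong (s ℚ.*_) (sym (ι-∸ (ℕ.<⇒≤ k<N)))) (÷-* (ℕ.m<n⇒0<n∸m k<N))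

  -- Since (1 - K/(K+N)) (1 + K/N) = 1.
  ÷-shift : ∀ {N} → 0 ℕ.< N → 1ℚ ℚ.- K ÷ N ≡ (1ℚ ℚ.- K ÷ (K ℕ.+ N)) ℚ.* (1ℚ ℚ.- K ÷ N ℚ.* (K ÷ N))
  ÷-shift {N} 0<N = sym (begin
    (1ℚ ℚ.- s) ℚ.* (1ℚ ℚ.- s′ ℚ.* s′)
      ≡⟨ solve 2 (λ s t → (con 1ℚ :- s) :* (con 1ℚ :- t :* t) := (con 1ℚ :+ t :- s :* (con 1ℚ :+ t)) :* (con 1ℚ :- t)) refl s s′ ⟩
    (1ℚ ℚ.+ s′ ℚ.- s ℚ.* (1ℚ ℚ.+ s′)) ℚ.* (1ℚ ℚ.- s′)
      ≡⟨ cong (λ t → (1ℚ ℚ.+ s′ ℚ.- t) ℚ.* (1ℚ ℚ.- s′)) s[1+s′] ⟩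
    (1ℚ ℚ.+ s′ ℚ.- s′) ℚ.* (1ℚ ℚ.- s′)
      ≡⟨ solve 1 (λ t → (con 1ℚ :+ t :- t) :* (con 1ℚ :- t) := con 1ℚ :- t) refl s′ ⟩
    1ℚ ℚ.- s′ ∎)
    where
    open ≡-Reasoning
    s = K ÷ (K ℕ.+ N)
    s′ = K ÷ N
    s[1+s′] : s ℚ.* (1ℚ ℚ.+ s′) ≡ s′
    s[1+s′] = *-cancelʳ-≡ (0<ι N {{ℕ.>-nonZero 0<N}}) (begin
      s ℚ.* (1ℚ ℚ.+ s′) ℚ.* ι N
        ≡⟨ solve 3 (λ s t n → s :* (con 1ℚ :+ t) :* n := s :* (t :* n :+ n)) refl s s′ (ι N) ⟩
      s ℚ.* (s′ ℚ.* ι N ℚ.+ ι N)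
        ≡⟨ cong (λ t → s ℚ.* (t ℚ.+ ι N)) (÷-* 0<N) ⟩
      s ℚ.* (ι K ℚ.+ ι N)
        ≡⟨ cong (s ℚ.*_) (sym (ι-+ K N)) ⟩
      s ℚ.* ι (K ℕ.+ N)
        ≡⟨ trans (÷-* (ℕ.≤-trans 0<N (ℕ.m≤n+m N K))) (sym (÷-* 0<N)) ⟩
      s′ ℚ.* ι N ∎)

  -- This is `÷-shift` factor by factor, with `N = P - K - i` and hence `K + N = P - i`. For `k = K`
  -- the left side is r/q and the first product on the right is q, so the second product is r/q².
  ∏-shift : ∀ {P} k → K ℕ.+ k ℕ.≤ P →
    ∏1- (λ i → K ÷ (P ℕ.∸ (K ℕ.+ i))) k ≡
    ∏1- (λ i → K ÷ (P ℕ.∸ i)) k ℚ.* ∏1- (λ i → K ÷ (P ℕ.∸ (K ℕ.+ i)) ℚ.* (K ÷ (P ℕ.∸ (K ℕ.+ i)))) k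
  ∏-shift {P} zero    _     = refl
  ∏-shift {P} (suc k) K+k<P = begin
    ∏1- (λ i → K ÷ (P ℕ.∸ (K ℕ.+ i))) k ℚ.* (1ℚ ℚ.- s′)
      ≡⟨ cong₂ ℚ._*_ (∏-shift k (ℕ.<⇒≤ K+k<P′)) (trans (÷-shift 0<N) (cong (λ t → (1ℚ ℚ.- K ÷ t) ℚ.* (1ℚ ℚ.- s′ ℚ.* s′)) K+N≡P-k)) ⟩
    A ℚ.* B ℚ.* ((1ℚ ℚ.- s) ℚ.* (1ℚ ℚ.- s′ ℚ.* s′))
      ≡⟨ solve 4 (λ a b s t → a :* b :* (s :* t) := a :* s :* (b :* t)) refl A B (1ℚ ℚ.- s) (1ℚ ℚ.- s′ ℚ.* s′) ⟩
    A ℚ.* (1ℚ ℚ.- s) ℚ.* (B ℚ.* (1ℚ ℚ.- s′ ℚ.* s′)) ∎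
    where
    open ≡-Reasoning
    A = ∏1- (λ i → K ÷ (P ℕ.∸ i)) k
    B = ∏1- (λ i → K ÷ (P ℕ.∸ (K ℕ.+ i)) ℚ.* (K ÷ (P ℕ.∸ (K ℕ.+ i)))) k
    s = K ÷ (P ℕ.∸ k)
    s′ = K ÷ (P ℕ.∸ (K ℕ.+ k))
    K+k<P′ : K ℕ.+ k ℕ.< P
    K+k<P′ = subst (ℕ._≤ P) (ℕ.+-suc K k) K+k<P
    0<N : 0 ℕ.< P ℕ.∸ (K ℕ.+ k)
    0<N = ℕ.m<n⇒0<n∸m K+k<P′
    K+N≡P-k : K ℕ.+ (P ℕ.∸ (K ℕ.+ k)) ≡ P ℕ.∸ k
    K+N≡P-k = trans (cong (λ t → K ℕ.+ (P ℕ.∸ t)) (ℕ.+-comm K k))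
      (trans (cong (K ℕ.+_) (sym (ℕ.∸-+-assoc P k K)))
        (ℕ.m+[n∸m]≡n (ℕ.m+n≤o⇒m≤o∸n K (ℕ.<⇒≤ K+k<P′))))

-- The triangle probability of the random key graph

2ℚ 3ℚ 4ℚ 8ℚ 16ℚ 32ℚ 64ℚ : ℚ
2ℚ = + 2 ℚ./ 1
3ℚ = + 3 ℚ./ 1
4ℚ = + 4 ℚ./ 1
8ℚ = + 8 ℚ./ 1
16ℚ = + 16 ℚ./ 1
32ℚ = + 32 ℚ./ 1
64ℚ = + 64 ℚ./ 1

0≤ℚ : ∀ c .{{_ : ℚ.NonNegative c}} → 0ℚ ℚ.≤ c
0≤ℚ c = ℚ.nonNegative⁻¹ c

ι-mono-< : ∀ {m n} → m ℕ.< n → ι m ℚ.< ι n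
ι-mono-< {m} {n} m<n = ℚ.<-≤-trans
  (subst₂ ℚ._<_ (ℚ.+-identityˡ (ι m)) (sym (ι-suc m)) (ℚ.+-monoˡ-< (ι m) (ℚ.positive⁻¹ 1ℚ)))
  (ι-mono-≤ m<n)

ι-cancel-≤ : ∀ {m n} → ι m ℚ.≤ ι n → m ℕ.≤ n
ι-cancel-≤ {m} {n} ιm≤ιn with m ℕ.≤? n
... | yes m≤n = m≤n
... | no  m≰n = contradiction (ℚ.≤-<-trans ιm≤ιn (ι-mono-< (ℕ.≰⇒> m≰n))) (ℚ.<-irrefl refl)

-- Both bounds come from x/(1+x) ≤ v ≤ x/(1-x) and z/(1+x) ≤ u ≤ z/(1-2x)²,
-- in which b v³ ≈ b x³ = z ≈ u.
module _ {x v u b z : ℚ}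
  (0≤x : 0ℚ ℚ.≤ x) (8x≤1 : 8ℚ ℚ.* x ℚ.≤ 1ℚ)
  (0≤v : 0ℚ ℚ.≤ v) (v≤1 : v ℚ.≤ 1ℚ) (0≤u : 0ℚ ℚ.≤ u) (0≤b : 0ℚ ℚ.≤ b)
  (bx³≡z : b ℚ.* x ³ ≡ z)
  where
  private
    0≤1-8x : 0ℚ ℚ.≤ 1ℚ ℚ.- 8ℚ ℚ.* x
    0≤1-8x = 0≤-gap 8x≤1
    0<1-2x : 0ℚ ℚ.< 1ℚ ℚ.- 2ℚ ℚ.* x
    0<1-2x = ℚ.*-cancelˡ-<-nonNeg 4ℚ (ℚ.<-≤-trans (ℚ.positive⁻¹ 3ℚ) (≤-by-gap 0≤1-8x
      (solve 1 (λ x → con 4ℚ :* (con 1ℚ :- con 2ℚ :* x) := con 3ℚ :+ (con 1ℚ :- con 8ℚ :* x)) refl x)))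
    0<1-x : 0ℚ ℚ.< 1ℚ ℚ.- x
    0<1-x = ℚ.<-≤-trans 0<1-2x (≤-by-gap 0≤x
      (solve 1 (λ x → con 1ℚ :- x := (con 1ℚ :- con 2ℚ :* x) :+ x) refl x))
    0<1+x : 0ℚ ℚ.< 1ℚ ℚ.+ x
    0<1+x = ℚ.+-mono-<-≤ (ℚ.positive⁻¹ 1ℚ) 0≤x
    0≤q : 0ℚ ℚ.≤ 1ℚ ℚ.- v
    0≤q = 0≤-gap v≤1
    0≤bv³ : 0ℚ ℚ.≤ b ℚ.* v ³
    0≤bv³ = 0≤-* 0≤b (0≤³ 0≤v)

  excess-upper : x ℚ.≤ v ℚ.* (1ℚ ℚ.+ x) →
    u ℚ.* ((1ℚ ℚ.- 2ℚ ℚ.* x) ℚ.* (1ℚ ℚ.- 2ℚ ℚ.* x)) ℚ.≤ z →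
    (1ℚ ℚ.- v) ³ ℚ.* u ℚ.≤ b ℚ.* v ³ ℚ.* (1ℚ ℚ.+ 16ℚ ℚ.* x)
  excess-upper x≤v[1+x] u≤ = ℚ.≤-trans q³u≤u (≤-cancelʳ (*-pos _ _ 0<1-2x 0<1-2x) (begin
    u ℚ.* ((1ℚ ℚ.- 2ℚ ℚ.* x) ℚ.* (1ℚ ℚ.- 2ℚ ℚ.* x))
      ≤⟨ u≤ ⟩
    z
      ≡⟨ sym bx³≡z ⟩
    b ℚ.* x ³
      ≤⟨ *-monoˡ b 0≤b (³-mono 0≤x x≤v[1+x]) ⟩
    b ℚ.* (v ℚ.* (1ℚ ℚ.+ x)) ³
      -- The constant 16 is large enough for `(1+x)³ ≤ (1+16x)(1-2x)²` on `8x ≤ 1`; the difference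
      -- is `9x(1 - 7x + 7x²)`.
      ≤⟨ ≤-by-gap (0≤-* (0≤-* 0≤bv³ (0≤-* (0≤ℚ (+ 9 ℚ./ 1)) 0≤x))
           (0≤-+ 0≤1-8x (0≤-+ 0≤x (0≤-* (0≤ℚ (+ 7 ℚ./ 1)) (0≤-* 0≤x 0≤x)))))
         (solve 3 (λ b v x → b :* (v :* v :* v) :* (con 1ℚ :+ con 16ℚ :* x) :* ((con 1ℚ :- con 2ℚ :* x) :* (con 1ℚ :- con 2ℚ :* x))
           := b :* ((v :* (con 1ℚ :+ x)) :* (v :* (con 1ℚ :+ x)) :* (v :* (con 1ℚ :+ x)))
              :+ b :* (v :* v :* v) :* (con (+ 9 ℚ./ 1) :* x)
                 :* ((con 1ℚ :- con 8ℚ :* x) :+ (x :+ con (+ 7 ℚ./ 1) :* (x :* x)))) refl b v x) ⟩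
    b ℚ.* v ³ ℚ.* (1ℚ ℚ.+ 16ℚ ℚ.* x) ℚ.* ((1ℚ ℚ.- 2ℚ ℚ.* x) ℚ.* (1ℚ ℚ.- 2ℚ ℚ.* x)) ∎))
    where
    open ℚ.≤-Reasoning
    q≤1 : 1ℚ ℚ.- v ℚ.≤ 1ℚ
    q≤1 = ≤-by-gap 0≤v (solve 1 (λ v → con 1ℚ := (con 1ℚ :- v) :+ v) refl v)
    q³u≤u : (1ℚ ℚ.- v) ³ ℚ.* u ℚ.≤ u
    q³u≤u = subst ((1ℚ ℚ.- v) ³ ℚ.* u ℚ.≤_) (ℚ.*-identityˡ u) (*-monoʳ u 0≤u (³-mono 0≤q q≤1))

  -- The factor `(1-v)³`, bounded by 1 in the upper estimate, now needs a lower bound: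
  -- `(1-v)(1-x) = 1 - x - v(1-x) ≥ 1 - 2x`. Multiplying by `(1+x)(1-x)³` clears all quotients, and
  -- `(1-16x)(1+x) ≤ (1-2x)³` absorbs the loss.
  excess-lower : v ℚ.* (1ℚ ℚ.- x) ℚ.≤ x → z ℚ.≤ u ℚ.* (1ℚ ℚ.+ x) →
    b ℚ.* v ³ ℚ.* (1ℚ ℚ.- 16ℚ ℚ.* x) ℚ.≤ (1ℚ ℚ.- v) ³ ℚ.* u
  excess-lower v[1-x]≤x z≤u[1+x] = ≤-cancelʳ 0<1+x (≤-cancelʳ (0<³ 0<1-x) (begin
    b ℚ.* v ³ ℚ.* (1ℚ ℚ.- 16ℚ ℚ.* x) ℚ.* (1ℚ ℚ.+ x) ℚ.* (1ℚ ℚ.- x) ³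
      ≤⟨ *-monoʳ ((1ℚ ℚ.- x) ³) (0≤³ (ℚ.<⇒≤ 0<1-x)) cubic ⟩
    b ℚ.* v ³ ℚ.* (1ℚ ℚ.- 2ℚ ℚ.* x) ³ ℚ.* (1ℚ ℚ.- x) ³
      ≡⟨ solve 4 (λ b v s t → b :* (v :* v :* v) :* s :* (t :* t :* t)
           := s :* (b :* ((v :* t) :* (v :* t) :* (v :* t)))) refl b v ((1ℚ ℚ.- 2ℚ ℚ.* x) ³) (1ℚ ℚ.- x) ⟩
    (1ℚ ℚ.- 2ℚ ℚ.* x) ³ ℚ.* (b ℚ.* (v ℚ.* (1ℚ ℚ.- x)) ³)
      ≤⟨ *-mono (0≤³ (ℚ.<⇒≤ 0<1-2x)) (0≤-* 0≤b (0≤³ 0≤v[1-x]))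
           (³-mono (ℚ.<⇒≤ 0<1-2x) 1-2x≤q[1-x]) bv³[1-x]³≤u[1+x] ⟩
    ((1ℚ ℚ.- v) ℚ.* (1ℚ ℚ.- x)) ³ ℚ.* (u ℚ.* (1ℚ ℚ.+ x))
      ≡⟨ solve 4 (λ q t u s → (q :* t) :* (q :* t) :* (q :* t) :* (u :* s) := q :* q :* q :* u :* s :* (t :* t :* t)) refl
           (1ℚ ℚ.- v) (1ℚ ℚ.- x) u (1ℚ ℚ.+ x) ⟩
    (1ℚ ℚ.- v) ³ ℚ.* u ℚ.* (1ℚ ℚ.+ x) ℚ.* (1ℚ ℚ.- x) ³ ∎))
    where
    open ℚ.≤-Reasoning
    cubic : b ℚ.* v ³ ℚ.* (1ℚ ℚ.- 16ℚ ℚ.* x) ℚ.* (1ℚ ℚ.+ x) ℚ.≤ b ℚ.* v ³ ℚ.* (1ℚ ℚ.- 2ℚ ℚ.* x) ³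
    cubic = ≤-by-gap
      (0≤-* 0≤bv³ (0≤-* 0≤x (0≤-+ (0≤ℚ (+ 9 ℚ./ 1)) (0≤-+ (0≤-* (0≤ℚ (+ 27 ℚ./ 1)) 0≤x) (0≤-* 0≤x 0≤1-8x)))))
      (solve 2 (λ c x → c :* ((con 1ℚ :- con 2ℚ :* x) :* (con 1ℚ :- con 2ℚ :* x) :* (con 1ℚ :- con 2ℚ :* x))
         := c :* (con 1ℚ :- con 16ℚ :* x) :* (con 1ℚ :+ x)
            :+ c :* (x :* (con (+ 9 ℚ./ 1) :+ (con (+ 27 ℚ./ 1) :* x :+ x :* (con 1ℚ :- con 8ℚ :* x))))) refl
         (b ℚ.* v ³) x)
    0≤v[1-x] : 0ℚ ℚ.≤ v ℚ.* (1ℚ ℚ.- x)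
    0≤v[1-x] = 0≤-* 0≤v (ℚ.<⇒≤ 0<1-x)
    1-2x≤q[1-x] : 1ℚ ℚ.- 2ℚ ℚ.* x ℚ.≤ (1ℚ ℚ.- v) ℚ.* (1ℚ ℚ.- x)
    1-2x≤q[1-x] = ≤-by-gap (0≤-gap v[1-x]≤x)
      (solve 2 (λ v x → (con 1ℚ :- v) :* (con 1ℚ :- x) := (con 1ℚ :- con 2ℚ :* x) :+ (x :- v :* (con 1ℚ :- x))) refl v x)
    bv³[1-x]³≤u[1+x] : b ℚ.* (v ℚ.* (1ℚ ℚ.- x)) ³ ℚ.≤ u ℚ.* (1ℚ ℚ.+ x)
    bv³[1-x]³≤u[1+x] = ℚ.≤-trans (*-monoˡ b 0≤b (³-mono 0≤v[1-x] v[1-x]≤x))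
      (subst (ℚ._≤ u ℚ.* (1ℚ ℚ.+ x)) (sym bx³≡z) z≤u[1+x])

-- The probability that none of three disjointness events occurs. They are pairwise independent,
-- hence the terms in `q * q`, but not jointly: all three together have probability `q * r`.
triangleProbability : ℚ → ℚ → ℚ
triangleProbability q r =
  1ℚ ℚ.- (q ℚ.+ q ℚ.+ q) ℚ.+ (q ℚ.* q ℚ.+ q ℚ.* q ℚ.+ q ℚ.* q) ℚ.- q ℚ.* r

∏1-cong : ∀ {s t : ℕ → ℚ} k → (∀ i → s i ≡ t i) → ∏1- s k ≡ ∏1- t k
∏1-cong zero    s≡t = refl
∏1-cong (suc k) s≡t = cong₂ (λ a b → a ℚ.* (1ℚ ℚ.- b)) (∏1-cong k s≡t) (s≡t k)

-- Below a = K/P, x = K²/P, z = K³/P², b = P/K³, v = 1 - q and u = 1 - r/q².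
module _ {K P : ℕ} (0<K : 0 ℕ.< K) (2K≤P : K ℕ.+ K ℕ.≤ P) where
  private
    0<P : 0 ℕ.< P
    0<P = ℕ.≤-trans 0<K (ℕ.≤-trans (ℕ.m≤m+n K K) 2K≤P)

    0<ιP : 0ℚ ℚ.< ι P
    0<ιP = 0<ι P {{ℕ.>-nonZero 0<P}}

    0<K³ : 0 ℕ.< K ℕ.^ 3
    0<K³ = ℕ.m^n>0 K {{ℕ.>-nonZero 0<K}} 3

    a x z b q₁ v : ℚ
    a = K ÷ P
    x = ι K ℚ.* a
    z = x ℚ.* a
    b = P ÷ (K ℕ.^ 3)
    q₁ = ∏1- (λ i → K ÷ (P ℕ.∸ i)) K
    v = 1ℚ ℚ.- q₁

    0≤a : 0ℚ ℚ.≤ a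
    0≤a = 0≤÷ K 0<P

    0≤x : 0ℚ ℚ.≤ x
    0≤x = 0≤-* (0≤ι K) 0≤a

    0≤b : 0ℚ ℚ.≤ b
    0≤b = 0≤÷ P 0<K³

    a≤x : a ℚ.≤ x
    a≤x = subst (ℚ._≤ x) (ℚ.*-identityˡ a) (*-monoʳ a 0≤a (subst (ℚ._≤ ι K) ι-1 (ι-mono-≤ 0<K)))

    aP≡K : a ℚ.* ι P ≡ ι K
    aP≡K = ÷-* K 0<P

    bx³≡z : b ℚ.* x ³ ≡ z
    bx³≡z = *-cancelʳ-≡ (*-pos _ _ 0<ιP 0<ιP) (begin
      b ℚ.* x ³ ℚ.* (ι P ℚ.* ι P)
        ≡⟨ solve 4 (λ b k a p → b :* ((k :* a) :* (k :* a) :* (k :* a)) :* (p :* p)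
             := b :* (k :* (k :* k)) :* ((a :* p) :* (a :* p) :* a)) refl b (ι K) a (ι P) ⟩
      b ℚ.* (ι K ℚ.* (ι K ℚ.* ι K)) ℚ.* ((a ℚ.* ι P) ℚ.* (a ℚ.* ι P) ℚ.* a)
        ≡⟨ cong (λ t → b ℚ.* t ℚ.* ((a ℚ.* ι P) ℚ.* (a ℚ.* ι P) ℚ.* a)) K³ ⟨
      b ℚ.* ι (K ℕ.^ 3) ℚ.* ((a ℚ.* ι P) ℚ.* (a ℚ.* ι P) ℚ.* a)
        ≡⟨ cong₂ ℚ._*_ (÷-* P 0<K³) (cong (λ t → t ℚ.* (a ℚ.* ι P) ℚ.* a) aP≡K) ⟩
      ι P ℚ.* (ι K ℚ.* (a ℚ.* ι P) ℚ.* a)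
        ≡⟨ solve 3 (λ k a p → p :* (k :* (a :* p) :* a) := k :* a :* a :* (p :* p)) refl (ι K) a (ι P) ⟩
      z ℚ.* (ι P ℚ.* ι P) ∎)
      where
      open ≡-Reasoning
      K³ : ι (K ℕ.^ 3) ≡ ι K ℚ.* (ι K ℚ.* ι K)
      K³ = trans (ι-* K (K ℕ.* (K ℕ.* 1))) (cong (ι K ℚ.*_)
        (trans (ι-* K (K ℕ.* 1)) (cong (λ t → ι K ℚ.* ι t) (ℕ.*-identityʳ K))))

    -- With `t = c/P` this says `K/(P-c) = a/(1-t)`. It is applied to `c = K` and `c = 2K`, the
    -- smallest denominators in the two products.
    ÷-rescale : ∀ c t → c ℕ.< P → t ℚ.* ι P ≡ ι c → K ÷ (P ℕ.∸ c) ℚ.* (1ℚ ℚ.- t) ≡ a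
    ÷-rescale c t c<P tP≡c = *-cancelʳ-≡ 0<ιP (begin
      y ℚ.* (1ℚ ℚ.- t) ℚ.* ι P
        ≡⟨ solve 3 (λ y t p → y :* (con 1ℚ :- t) :* p := y :* (p :- t :* p)) refl y t (ι P) ⟩
      y ℚ.* (ι P ℚ.- t ℚ.* ι P)
        ≡⟨ cong (λ s → y ℚ.* (ι P ℚ.- s)) tP≡c ⟩
      y ℚ.* (ι P ℚ.- ι c)
        ≡⟨ cong (y ℚ.*_) (sym (ι-∸ (ℕ.<⇒≤ c<P))) ⟩
      y ℚ.* ι (P ℕ.∸ c)
        ≡⟨ trans (÷-* K (ℕ.m<n⇒0<n∸m c<P)) (sym aP≡K) ⟩
      a ℚ.* ι P ∎)
      where
      open ≡-Reasoning
      y = K ÷ (P ℕ.∸ c)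

    room : ∀ {i} → i ℕ.≤ K → K ℕ.≤ P ℕ.∸ i
    room {i} i≤K = ℕ.m+n≤o⇒m≤o∸n K (ℕ.≤-trans (ℕ.+-monoʳ-≤ K i≤K) 2K≤P)

    factor-≤1 : ∀ {i} → i ℕ.≤ K → K ÷ (P ℕ.∸ i) ℚ.≤ 1ℚ
    factor-≤1 i≤K = ÷≤1 K (ℕ.≤-trans 0<K (room i≤K)) (room i≤K)

    0≤factor : ∀ {i} → i ℕ.≤ K → 0ℚ ℚ.≤ K ÷ (P ℕ.∸ i)
    0≤factor i≤K = 0≤÷ K (ℕ.≤-trans 0<K (room i≤K))

    K<P : K ℕ.< P
    K<P = ℕ.≤-trans (ℕ.+-monoˡ-≤ K 0<K) 2K≤P

    0≤q : 0ℚ ℚ.≤ q₁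
    0≤q = ∏1-≥0 _ K (λ i i<K → factor-≤1 (ℕ.<⇒≤ i<K))

    0≤v : 0ℚ ℚ.≤ v
    0≤v = 0≤-gap (∏1-≤1 _ K (λ i i<K → 0≤factor (ℕ.<⇒≤ i<K) , factor-≤1 (ℕ.<⇒≤ i<K)))

    v≤1 : v ℚ.≤ 1ℚ
    v≤1 = ≤-by-gap 0≤q (solve 1 (λ q → con 1ℚ := (con 1ℚ :- q) :+ q) refl q₁)

    x≤v[1+x] : x ℚ.≤ v ℚ.* (1ℚ ℚ.+ x)
    x≤v[1+x] = ≤-by-gap
      (0≤-gap (∏1-*[1+k*y]≤1 _ K 0≤a (λ i i<K →
        ÷-anti K (ℕ.≤-trans 0<K (room (ℕ.<⇒≤ i<K))) (ℕ.m∸n≤m P i) , factor-≤1 (ℕ.<⇒≤ i<K))))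
      (solve 2 (λ q x → (con 1ℚ :- q) :* (con 1ℚ :+ x) := x :+ (con 1ℚ :- q :* (con 1ℚ :+ x))) refl q₁ x)

    0<v : 0ℚ ℚ.< v
    0<v = ℚ.*-cancelʳ-<-nonNeg (1ℚ ℚ.+ x) {{ℚ.nonNegative (0≤-+ 0≤1 0≤x)}}
      (subst (ℚ._< v ℚ.* (1ℚ ℚ.+ x)) (sym (ℚ.*-zeroˡ (1ℚ ℚ.+ x))) (ℚ.<-≤-trans 0<x x≤v[1+x]))
      where
      0<ιK : 0ℚ ℚ.< ι K
      0<ιK = 0<ι K {{ℕ.>-nonZero 0<K}}
      0<x : 0ℚ ℚ.< x
      0<x = *-pos (ι K) a 0<ιK (*-pos (ι K) (recip (ι P)) 0<ιK (0<recip 0<ιP))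

    v≤Ky : v ℚ.≤ ι K ℚ.* (K ÷ (P ℕ.∸ K))
    v≤Ky = ≤-by-gap
      (0≤-gap (∏1-≥1-k*Y _ K {K ÷ (P ℕ.∸ K)} (λ i i<K → 0≤factor (ℕ.<⇒≤ i<K) ,
        ÷-anti K (ℕ.≤-trans 0<K (room ℕ.≤-refl)) (ℕ.∸-monoʳ-≤ P (ℕ.<⇒≤ i<K)) , factor-≤1 (ℕ.<⇒≤ i<K))))
      (solve 2 (λ q y → y := (con 1ℚ :- q) :+ (q :+ y :- con 1ℚ)) refl q₁ (ι K ℚ.* (K ÷ (P ℕ.∸ K))))

    a≤1 : a ℚ.≤ 1ℚ
    a≤1 = ÷≤1 K 0<P (ℕ.<⇒≤ K<P)

    -- The union bound gives `v ≤ x/(1-a)`. As `K ≥ 1` implies `a ≤ x`, weakening `1 - a` to `1 - x`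
    -- leaves `x` as the only small parameter.
    v[1-x]≤x : v ℚ.* (1ℚ ℚ.- x) ℚ.≤ x
    v[1-x]≤x = begin
      v ℚ.* (1ℚ ℚ.- x)
        ≤⟨ *-monoˡ v 0≤v (≤-by-gap (0≤-gap a≤x) (solve 2 (λ a x → con 1ℚ :- a := (con 1ℚ :- x) :+ (x :- a)) refl a x)) ⟩
      v ℚ.* (1ℚ ℚ.- a)
        ≤⟨ *-monoʳ (1ℚ ℚ.- a) (0≤-gap a≤1) v≤Ky ⟩
      ι K ℚ.* (K ÷ (P ℕ.∸ K)) ℚ.* (1ℚ ℚ.- a)
        ≡⟨ ℚ.*-assoc (ι K) (K ÷ (P ℕ.∸ K)) (1ℚ ℚ.- a) ⟩
      ι K ℚ.* (K ÷ (P ℕ.∸ K) ℚ.* (1ℚ ℚ.- a))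
        ≡⟨ cong (ι K ℚ.*_) (÷-rescale K a K<P aP≡K) ⟩
      x ∎
      where open ℚ.≤-Reasoning

  module _ (δ q : ℚ) (64δ≤1 : 64ℚ ℚ.* δ ℚ.≤ 1ℚ)
    (hq : q ℚ.* binom P K ≡ binom (P ℕ.∸ K) K) (1-q≤δ : 1ℚ ℚ.- q ℚ.≤ δ) where
    private
      0<binom : 0ℚ ℚ.< binom P K
      0<binom = subst (0ℚ ℚ.<_) (sym (binom≡ιC P K)) (0<ι (P C K) {{C-nonZero (ℕ.<⇒≤ K<P)}})

      q₁≡q : q₁ ≡ q
      q₁≡q = *-cancelʳ-≡ 0<binom (trans (∏-binom K K (ℕ.<⇒≤ K<P) (ℕ.<⇒≤ K<P)) (sym hq))

      v≤δ : v ℚ.≤ δ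
      v≤δ = subst (λ t → 1ℚ ℚ.- t ℚ.≤ δ) (sym q₁≡q) 1-q≤δ

      0≤δ : 0ℚ ℚ.≤ δ
      0≤δ = ℚ.≤-trans 0≤v v≤δ

      0≤1-64δ : 0ℚ ℚ.≤ 1ℚ ℚ.- 64ℚ ℚ.* δ
      0≤1-64δ = 0≤-gap 64δ≤1

      0<1-δ : 0ℚ ℚ.< 1ℚ ℚ.- δ
      0<1-δ = ℚ.*-cancelˡ-<-nonNeg 64ℚ (ℚ.<-≤-trans (ℚ.positive⁻¹ (+ 63 ℚ./ 1)) (≤-by-gap 0≤1-64δ
        (solve 1 (λ d → con 64ℚ :* (con 1ℚ :- d) := con (+ 63 ℚ./ 1) :+ (con 1ℚ :- con 64ℚ :* d)) refl δ)))

      -- From `x ≤ v(1+x) ≤ δ(1+x)` follows `x(1-δ) ≤ δ`, and `δ ≤ 2δ(1-δ)` because `δ ≤ 1/2`.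
      x≤2δ : x ℚ.≤ 2ℚ ℚ.* δ
      x≤2δ = ≤-cancelʳ 0<1-δ (≤-by-gap
        (0≤-+ (0≤-gap x≤v[1+x]) (0≤-+ (0≤-* (0≤-gap v≤δ) (0≤-+ 0≤1 0≤x))
          (0≤-* 0≤δ (0≤-+ 0≤1-64δ (0≤-* (0≤ℚ (+ 62 ℚ./ 1)) 0≤δ)))))
        (solve 3 (λ x v d → con 2ℚ :* d :* (con 1ℚ :- d) := x :* (con 1ℚ :- d)
          :+ ((v :* (con 1ℚ :+ x) :- x) :+ ((d :- v) :* (con 1ℚ :+ x)
          :+ d :* ((con 1ℚ :- con 64ℚ :* d) :+ con (+ 62 ℚ./ 1) :* d)))) refl x v δ))

      32x≤1 : 32ℚ ℚ.* x ℚ.≤ 1ℚ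
      32x≤1 = ≤-by-gap (0≤-+ 0≤1-64δ (0≤-* (0≤ℚ 32ℚ) (0≤-gap x≤2δ)))
        (solve 2 (λ x d → con 1ℚ := con 32ℚ :* x :+ ((con 1ℚ :- con 64ℚ :* d) :+ con 32ℚ :* (con 2ℚ :* d :- x))) refl x δ)

      8x≤1 : 8ℚ ℚ.* x ℚ.≤ 1ℚ
      8x≤1 = ≤-by-gap (0≤-+ (0≤-gap 32x≤1) (0≤-* (0≤ℚ (+ 24 ℚ./ 1)) 0≤x))
        (solve 1 (λ x → con 1ℚ := con 8ℚ :* x :+ ((con 1ℚ :- con 32ℚ :* x) :+ con (+ 24 ℚ./ 1) :* x)) refl x)

      3a≤1 : 3ℚ ℚ.* a ℚ.≤ 1ℚ
      3a≤1 = ≤-by-gap (0≤-+ (0≤-gap 8x≤1) (0≤-+ (0≤-* (0≤ℚ 3ℚ) (0≤-gap a≤x)) (0≤-* (0≤ℚ (+ 5 ℚ./ 1)) 0≤x)))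
        (solve 2 (λ a x → con 1ℚ := con 3ℚ :* a :+ ((con 1ℚ :- con 8ℚ :* x)
          :+ (con 3ℚ :* (x :- a) :+ con (+ 5 ℚ./ 1) :* x))) refl a x)

      -- Smallness of `x` forces this through `a ≤ x`. It keeps each denominator `P - K - i` with
      -- `i ≤ K` at least `K`, so that every `y i` is at most 1.
      3K≤P : K ℕ.+ K ℕ.+ K ℕ.≤ P
      3K≤P = ι-cancel-≤ (begin
        ι (K ℕ.+ K ℕ.+ K)
          ≡⟨ trans (ι-+ (K ℕ.+ K) K) (cong (ℚ._+ ι K) (ι-+ K K)) ⟩
        ι K ℚ.+ ι K ℚ.+ ι K
          ≡⟨ trans (cong (λ t → t ℚ.+ t ℚ.+ t) (sym aP≡K))
               (solve 2 (λ a p → a :* p :+ a :* p :+ a :* p := con 3ℚ :* a :* p) refl a (ι P)) ⟩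
        3ℚ ℚ.* a ℚ.* ι P
          ≤⟨ *-monoʳ (ι P) (0≤ι P) 3a≤1 ⟩
        1ℚ ℚ.* ι P
          ≡⟨ ℚ.*-identityˡ (ι P) ⟩
        ι P ∎)
        where open ℚ.≤-Reasoning

      y : ℕ → ℚ
      y i = K ÷ (P ℕ.∸ (K ℕ.+ i))

      w u Y : ℚ
      w = ∏1- (λ i → y i ℚ.* y i) K
      u = 1ℚ ℚ.- w
      -- Index `K` is one past the last factor; it still bounds all of them and makes the
      -- denominator exactly `P - 2K`.
      Y = y K

      room′ : ∀ {i} → i ℕ.≤ K → K ℕ.≤ P ℕ.∸ (K ℕ.+ i)
      room′ {i} i≤K = ℕ.m+n≤o⇒m≤o∸n K (ℕ.≤-trans (ℕ.+-monoʳ-≤ K (ℕ.+-monoʳ-≤ K i≤K))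
        (subst (ℕ._≤ P) (ℕ.+-assoc K K K) 3K≤P))

      0≤y : ∀ {i} → i ℕ.≤ K → 0ℚ ℚ.≤ y i
      0≤y i≤K = 0≤÷ K (ℕ.≤-trans 0<K (room′ i≤K))

      y²≤1 : ∀ {i} → i ℕ.≤ K → y i ℚ.* y i ℚ.≤ 1ℚ
      y²≤1 i≤K = *-mono (0≤y i≤K) (0≤y i≤K)
        (÷≤1 K (ℕ.≤-trans 0<K (room′ i≤K)) (room′ i≤K))
        (÷≤1 K (ℕ.≤-trans 0<K (room′ i≤K)) (room′ i≤K))

      a≤y : ∀ {i} → i ℕ.≤ K → a ℚ.≤ y i
      a≤y {i} i≤K = ÷-anti K (ℕ.≤-trans 0<K (room′ i≤K)) (ℕ.m∸n≤m P (K ℕ.+ i))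

      y≤Y : ∀ {i} → i ℕ.≤ K → y i ℚ.≤ Y
      y≤Y i≤K = ÷-anti K (ℕ.≤-trans 0<K (room′ ℕ.≤-refl)) (ℕ.∸-monoʳ-≤ P (ℕ.+-monoʳ-≤ K i≤K))

      0≤u : 0ℚ ℚ.≤ u
      0≤u = 0≤-gap (∏1-≤1 _ K (λ i i<K → let i≤K = ℕ.<⇒≤ i<K in 0≤-* (0≤y i≤K) (0≤y i≤K) , y²≤1 i≤K))

      u≤KY² : u ℚ.≤ ι K ℚ.* (Y ℚ.* Y)
      u≤KY² = ≤-by-gap
        (0≤-gap (∏1-≥1-k*Y _ K {Y ℚ.* Y} (λ i i<K → let i≤K = ℕ.<⇒≤ i<K in
          0≤-* (0≤y i≤K) (0≤y i≤K) , *-mono (0≤y i≤K) (0≤y i≤K) (y≤Y i≤K) (y≤Y i≤K) , y²≤1 i≤K)))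
        (solve 2 (λ w y → y := (con 1ℚ :- w) :+ (w :+ y :- con 1ℚ)) refl w (ι K ℚ.* (Y ℚ.* Y)))

      z≤u[1+z] : z ℚ.≤ u ℚ.* (1ℚ ℚ.+ z)
      z≤u[1+z] = ≤-by-gap
        (0≤-gap (∏1-*[1+k*y]≤1 (λ i → y i ℚ.* y i) K {a ℚ.* a} (0≤-* 0≤a 0≤a) (λ i i<K → let i≤K = ℕ.<⇒≤ i<K in
          *-mono 0≤a 0≤a (a≤y i≤K) (a≤y i≤K) , y²≤1 i≤K)))
        (solve 3 (λ w k a → (con 1ℚ :- w) :* (con 1ℚ :+ k :* a :* a)
          := k :* a :* a :+ (con 1ℚ :- w :* (con 1ℚ :+ k :* (a :* a)))) refl w (ι K) a)

      z≤u[1+x] : z ℚ.≤ u ℚ.* (1ℚ ℚ.+ x)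
      z≤u[1+x] = ℚ.≤-trans z≤u[1+z] (*-monoˡ u 0≤u (ℚ.+-monoʳ-≤ 1ℚ
        (subst (z ℚ.≤_) (ℚ.*-identityʳ x) (*-monoˡ x 0≤x a≤1))))

      Y[1-2a]≡a : Y ℚ.* (1ℚ ℚ.- 2ℚ ℚ.* a) ≡ a
      Y[1-2a]≡a = ÷-rescale (K ℕ.+ K) (2ℚ ℚ.* a) (ℕ.<-≤-trans (ℕ.m<m+n (K ℕ.+ K) 0<K) 3K≤P)
        (trans (solve 2 (λ a p → con 2ℚ :* a :* p := a :* p :+ a :* p) refl a (ι P))
          (trans (cong₂ ℚ._+_ aP≡K aP≡K) (sym (ι-+ K K))))

      1-2x≤1-2a : 1ℚ ℚ.- 2ℚ ℚ.* x ℚ.≤ 1ℚ ℚ.- 2ℚ ℚ.* a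
      1-2x≤1-2a = ≤-by-gap (0≤-* (0≤ℚ 2ℚ) (0≤-gap a≤x))
        (solve 2 (λ a x → con 1ℚ :- con 2ℚ :* a := con 1ℚ :- con 2ℚ :* x :+ con 2ℚ :* (x :- a)) refl a x)

      0≤1-2x : 0ℚ ℚ.≤ 1ℚ ℚ.- 2ℚ ℚ.* x
      0≤1-2x = subst (0ℚ ℚ.≤_)
        (solve 1 (λ x → con 1ℚ :- con 8ℚ :* x :+ con (+ 6 ℚ./ 1) :* x := con 1ℚ :- con 2ℚ :* x) refl x)
        (0≤-+ (0≤-gap 8x≤1) (0≤-* (0≤ℚ (+ 6 ℚ./ 1)) 0≤x))

      -- Because `Y(1-2a) = a`, the union bound `K Y²` becomes `K a² = z` after multiplication by
      -- `(1-2a)²`.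
      u[1-2x]²≤z : u ℚ.* ((1ℚ ℚ.- 2ℚ ℚ.* x) ℚ.* (1ℚ ℚ.- 2ℚ ℚ.* x)) ℚ.≤ z
      u[1-2x]²≤z = begin
        u ℚ.* ((1ℚ ℚ.- 2ℚ ℚ.* x) ℚ.* (1ℚ ℚ.- 2ℚ ℚ.* x))
          ≤⟨ *-mono 0≤u (0≤-* 0≤1-2x 0≤1-2x) u≤KY² (*-mono 0≤1-2x 0≤1-2x 1-2x≤1-2a 1-2x≤1-2a) ⟩
        ι K ℚ.* (Y ℚ.* Y) ℚ.* ((1ℚ ℚ.- 2ℚ ℚ.* a) ℚ.* (1ℚ ℚ.- 2ℚ ℚ.* a))
          ≡⟨ solve 3 (λ k y t → k :* (y :* y) :* (t :* t) := k :* (y :* t) :* (y :* t)) refl (ι K) Y (1ℚ ℚ.- 2ℚ ℚ.* a) ⟩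
        ι K ℚ.* (Y ℚ.* (1ℚ ℚ.- 2ℚ ℚ.* a)) ℚ.* (Y ℚ.* (1ℚ ℚ.- 2ℚ ℚ.* a))
          ≡⟨ cong (λ t → ι K ℚ.* t ℚ.* t) Y[1-2a]≡a ⟩
        z ∎
        where open ℚ.≤-Reasoning

      ρ : ℚ
      ρ = ∏1- y K

      ρ≡qw : ρ ≡ q₁ ℚ.* w
      ρ≡qw = ∏-shift K K 2K≤P

      -- Two applications of `∏-binom`: one removes the keys of the first ring from `P`, the other
      -- those of a second ring from `P - K`.
      hr : ρ ℚ.* q₁ ℚ.* binom P K ≡ binom (P ℕ.∸ (K ℕ.+ K)) K
      hr = begin
        ρ ℚ.* q₁ ℚ.* binom P K
          ≡⟨ trans (ℚ.*-assoc ρ q₁ (binom P K)) (cong (ρ ℚ.*_) (∏-binom K K K≤P K≤P)) ⟩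
        ρ ℚ.* binom (P ℕ.∸ K) K
          ≡⟨ cong (ℚ._* binom (P ℕ.∸ K) K) (∏1-cong K (λ i → cong (K ÷_) (sym (ℕ.∸-+-assoc P K i)))) ⟩
        ∏1- (λ i → K ÷ (P ℕ.∸ K ℕ.∸ i)) K ℚ.* binom (P ℕ.∸ K) K
          ≡⟨ ∏-binom K K (room ℕ.≤-refl) (room ℕ.≤-refl) ⟩
        binom (P ℕ.∸ K ℕ.∸ K) K
          ≡⟨ cong (λ t → binom t K) (ℕ.∸-+-assoc P K K) ⟩
        binom (P ℕ.∸ (K ℕ.+ K)) K ∎
        where
        open ≡-Reasoning
        K≤P : K ℕ.≤ P
        K≤P = ℕ.<⇒≤ K<P

      β D : ℚ
      β = triangleProbability q₁ (ρ ℚ.* q₁)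
      D = v ³ ℚ.* (1ℚ ℚ.+ b)

      -- Substituting `r = q²w` and completing the cube turns `1 - 3q + 3q² - q³w` into
      -- `(1-q)³ + q³(1-w)`, two nonnegative terms.
      β≡ : β ≡ v ³ ℚ.+ (1ℚ ℚ.- v) ³ ℚ.* u
      β≡ = trans (cong (λ t → triangleProbability q₁ (t ℚ.* q₁)) ρ≡qw)
        (solve 2 (λ q w → con 1ℚ :- (q :+ q :+ q) :+ (q :* q :+ q :* q :+ q :* q) :- q :* (q :* w :* q)
          := (con 1ℚ :- q) :* (con 1ℚ :- q) :* (con 1ℚ :- q)
             :+ (con 1ℚ :- (con 1ℚ :- q)) :* (con 1ℚ :- (con 1ℚ :- q)) :* (con 1ℚ :- (con 1ℚ :- q)) :* (con 1ℚ :- w)) refl q₁ w)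

      0≤bv³ : 0ℚ ℚ.≤ b ℚ.* v ³
      0≤bv³ = 0≤-* 0≤b (0≤³ 0≤v)

      -- The term `v³` is exact, so only the excess carries an error, and `16x ≤ 32δ`.
      upper : β ℚ.≤ D ℚ.* (1ℚ ℚ.+ 32ℚ ℚ.* δ)
      upper = subst (ℚ._≤ D ℚ.* (1ℚ ℚ.+ 32ℚ ℚ.* δ)) (sym β≡) (≤-by-gap
        (0≤-+ (0≤-gap (excess-upper 0≤x 8x≤1 0≤v v≤1 0≤u 0≤b bx³≡z x≤v[1+x] u[1-2x]²≤z))
          (0≤-+ (0≤-* 0≤bv³ (0≤-* (0≤ℚ 16ℚ) (0≤-gap x≤2δ))) (0≤-* (0≤³ 0≤v) (0≤-* (0≤ℚ 32ℚ) 0≤δ))))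
        (solve 5 (λ V b d x s → V :* (con 1ℚ :+ b) :* (con 1ℚ :+ con 32ℚ :* d) := V :+ s
          :+ ((b :* V :* (con 1ℚ :+ con 16ℚ :* x) :- s)
          :+ (b :* V :* (con 16ℚ :* (con 2ℚ :* d :- x)) :+ V :* (con 32ℚ :* d)))) refl
          (v ³) b δ x ((1ℚ ℚ.- v) ³ ℚ.* u)))

      lower : D ℚ.* (1ℚ ℚ.- 32ℚ ℚ.* δ) ℚ.≤ β
      lower = subst (D ℚ.* (1ℚ ℚ.- 32ℚ ℚ.* δ) ℚ.≤_) (sym β≡) (≤-by-gap
        (0≤-+ (0≤-gap (excess-lower 0≤x 8x≤1 0≤v v≤1 0≤u 0≤b bx³≡z v[1-x]≤x z≤u[1+x]))
          (0≤-+ (0≤-* 0≤bv³ (0≤-* (0≤ℚ 16ℚ) (0≤-gap x≤2δ))) (0≤-* (0≤³ 0≤v) (0≤-* (0≤ℚ 32ℚ) 0≤δ))))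
        (solve 5 (λ V b d x s → V :+ s := V :* (con 1ℚ :+ b) :* (con 1ℚ :- con 32ℚ :* d)
          :+ ((s :- b :* V :* (con 1ℚ :- con 16ℚ :* x))
          :+ (b :* V :* (con 16ℚ :* (con 2ℚ :* d :- x)) :+ V :* (con 32ℚ :* d)))) refl
          (v ³) b δ x ((1ℚ ℚ.- v) ³ ℚ.* u)))

    -- The witness `r` is returned with its binomial relation, because the expected triangle count
    -- of the key graph is computed from that same relation.
    triangleProbability-≈ : 0ℚ ℚ.< 1ℚ ℚ.- q × (Σ[ r ∈ ℚ ] r ℚ.* binom P K ≡ binom (P ℕ.∸ (K ℕ.+ K)) K ×
      (1ℚ ℚ.- q) ³ ℚ.* (1ℚ ℚ.+ P ÷ (K ℕ.^ 3)) ℚ.* (1ℚ ℚ.- 32ℚ ℚ.* δ) ℚ.≤ triangleProbability q r ×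
      triangleProbability q r ℚ.≤ (1ℚ ℚ.- q) ³ ℚ.* (1ℚ ℚ.+ P ÷ (K ℕ.^ 3)) ℚ.* (1ℚ ℚ.+ 32ℚ ℚ.* δ))
    triangleProbability-≈ = subst (λ t → 0ℚ ℚ.< 1ℚ ℚ.- t × (Σ[ r ∈ ℚ ] r ℚ.* binom P K ≡ binom (P ℕ.∸ (K ℕ.+ K)) K ×
      (1ℚ ℚ.- t) ³ ℚ.* (1ℚ ℚ.+ P ÷ (K ℕ.^ 3)) ℚ.* (1ℚ ℚ.- 32ℚ ℚ.* δ) ℚ.≤ triangleProbability t r ×
      triangleProbability t r ℚ.≤ (1ℚ ℚ.- t) ³ ℚ.* (1ℚ ℚ.+ P ÷ (K ℕ.^ 3)) ℚ.* (1ℚ ℚ.+ 32ℚ ℚ.* δ)))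
      q₁≡q (0<v , ρ ℚ.* q₁ , hr , lower , upper)

-- Expected triangle counts of both random graphs

module _ (m : ℕ) (p : ℝ) where
  private
    pₘ : ℚ
    pₘ = approx p m

    head : Bool → ℚ
    head b = 𝟙 (does (b Bool.≟ true))

  bernoulli-prob : IsProbability m (bernoulli p)
  bernoulli-prob = solve 1 (λ p → p :* con 1ℚ :+ ((con 1ℚ :- p) :* con 1ℚ :+ con 0ℚ) := con 1ℚ) refl pₘ

  E-bernoulli : E m (bernoulli p) head ≡ pₘ
  E-bernoulli = solve 1 (λ p → p :* con 1ℚ :+ ((con 1ℚ :- p) :* con 0ℚ :+ con 0ℚ) := p) refl pₘ

  coins-prob : ∀ n → IsProbability m (coins n p)
  coins-prob zero    = refl
  coins-prob (suc n) = IsProbability-joint m _∷_ (iid n (bernoulli p)) (coins n p)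
    (iid-prob m (bernoulli p) bernoulli-prob n) (coins-prob n)

  private
    row : ∀ n → Dist (Vec Bool n)
    row n = iid n (bernoulli p)

    row-prob : ∀ n → IsProbability m (row n)
    row-prob = iid-prob m (bernoulli p) bernoulli-prob

  E-edge : ∀ {n} {i j : Fin n} → i Fin.< j → E m (coins n p) (λ t → 𝟙 (does (edge? t i j))) ≡ pₘ
  E-edge {suc n} {Fin.zero} {Fin.suc j} _ = begin
    E m (coins (suc n) p) (λ t → 𝟙 (does (edge? t Fin.zero (Fin.suc j))))
      ≡⟨ E-joint m _∷_ (row n) (coins n p) (λ t → 𝟙 (does (edge? t Fin.zero (Fin.suc j)))) ⟩
    E m (row n) (λ v → E m (coins n p) (λ _ → head (lookup v j)))
      ≡⟨ E-cong m (row n) (λ v → E-const m (coins n p) (coins-prob n) (head (lookup v j))) ⟩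
    E m (row n) (λ v → head (lookup v j))
      ≡⟨ E-iid₁ m (bernoulli p) bernoulli-prob j head ⟩
    E m (bernoulli p) head
      ≡⟨ E-bernoulli ⟩
    pₘ ∎
    where open ≡-Reasoning
  E-edge {suc n} {Fin.suc i} {Fin.suc j} (s≤s i<j) = begin
    E m (coins (suc n) p) (λ t → 𝟙 (does (edge? t (Fin.suc i) (Fin.suc j))))
      ≡⟨ E-joint m _∷_ (row n) (coins n p) (λ t → 𝟙 (does (edge? t (Fin.suc i) (Fin.suc j)))) ⟩
    E m (row n) (λ _ → E m (coins n p) (λ t → 𝟙 (does (edge? t i j))))
      ≡⟨ E-cong m (row n) (λ _ → E-edge i<j) ⟩
    E m (row n) (λ _ → pₘ)
      ≡⟨ E-const m (row n) (row-prob n) pₘ ⟩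
    pₘ ∎
    where open ≡-Reasoning

  -- If `i` is the first vertex, its two edges are coins of the first row while the edge `j k`
  -- belongs to the independent remainder. `factor` pulls that edge out, and the two row coins are
  -- independent by `E-iid₂`.
  E-coin-triangle : ∀ {n} (i j k : Fin n) → i Fin.< j → j Fin.< k →
    E m (coins n p) (λ t → 𝟙 (isTriangle (coinGraph t) i j k)) ≡ pₘ ℚ.* pₘ ℚ.* pₘ
  E-coin-triangle {suc n} Fin.zero (Fin.suc j) (Fin.suc k) _ (s≤s j<k) = begin
    E m (coins (suc n) p) (λ t → 𝟙 (isTriangle (coinGraph t) Fin.zero (Fin.suc j) (Fin.suc k)))
      ≡⟨ E-joint m _∷_ (row n) (coins n p) _ ⟩
    E m (row n) (λ v → E m (coins n p) (λ t → 𝟙 (a v ∧ (does (edge? t j k) ∧ c v))))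
      ≡⟨ E-cong m (row n) (λ v → trans
           (E-cong m (coins n p) (λ t → factor (a v) (does (edge? t j k)) (c v)))
           (trans (E-*ʳ m (coins n p) _ (𝟙 (a v) ℚ.* 𝟙 (c v)))
             (cong (ℚ._* (𝟙 (a v) ℚ.* 𝟙 (c v))) (E-edge j<k)))) ⟩
    E m (row n) (λ v → pₘ ℚ.* (𝟙 (a v) ℚ.* 𝟙 (c v)))
      ≡⟨ E-*ˡ m (row n) pₘ _ ⟩
    pₘ ℚ.* E m (row n) (λ v → head (lookup v j) ℚ.* head (lookup v k))
      ≡⟨ cong (pₘ ℚ.*_) (E-iid₂ m (bernoulli p) bernoulli-prob j<k (λ x y → head x ℚ.* head y)) ⟩
    pₘ ℚ.* E m (bernoulli p) (λ x → E m (bernoulli p) (λ y → head x ℚ.* head y))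
      ≡⟨ cong (pₘ ℚ.*_) (E-cong m (bernoulli p) (λ x →
           trans (E-*ˡ m (bernoulli p) (head x) head) (cong (head x ℚ.*_) E-bernoulli))) ⟩
    pₘ ℚ.* E m (bernoulli p) (λ x → head x ℚ.* pₘ)
      ≡⟨ cong (pₘ ℚ.*_) (trans (E-*ʳ m (bernoulli p) head pₘ) (cong (ℚ._* pₘ) E-bernoulli)) ⟩
    pₘ ℚ.* (pₘ ℚ.* pₘ)
      ≡⟨ ℚ.*-assoc pₘ pₘ pₘ ⟨
    pₘ ℚ.* pₘ ℚ.* pₘ ∎
    where
    open ≡-Reasoning
    a c : Vec Bool n → Bool
    a v = does (lookup v j Bool.≟ true)
    c v = does (lookup v k Bool.≟ true)
    factor : ∀ x y z → 𝟙 (x ∧ (y ∧ z)) ≡ 𝟙 y ℚ.* (𝟙 x ℚ.* 𝟙 z)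
    factor x y z = trans (𝟙-∧ x (y ∧ z)) (trans (cong (𝟙 x ℚ.*_) (𝟙-∧ y z))
      (solve 3 (λ x y z → x :* (y :* z) := y :* (x :* z)) refl (𝟙 x) (𝟙 y) (𝟙 z)))
  E-coin-triangle {suc n} (Fin.suc i) (Fin.suc j) (Fin.suc k) (s≤s i<j) (s≤s j<k) =
    trans (E-joint m _∷_ (row n) (coins n p) _)
      (trans (E-cong m (row n) (λ _ → E-coin-triangle i j k i<j j<k))
        (E-const m (row n) (row-prob n) (pₘ ℚ.* pₘ ℚ.* pₘ)))

  approx-𝔼T-ER : ∀ n → approx (𝔼T-ER n p) m ≡ ι (#triples n) ℚ.* (pₘ ℚ.* pₘ ℚ.* pₘ)
  approx-𝔼T-ER n = E-triangles m (coins n p) coinGraph (pₘ ℚ.* pₘ ℚ.* pₘ) E-coin-triangle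

-- Counting key rings disjoint from a given set

𝟙-disjoint : ∀ {P} → Subset P → Subset P → ℚ
𝟙-disjoint []            []            = 1ℚ
𝟙-disjoint (inside  ∷ A) (inside  ∷ B) = 0ℚ
𝟙-disjoint (inside  ∷ A) (outside ∷ B) = 𝟙-disjoint A B
𝟙-disjoint (outside ∷ A) (_       ∷ B) = 𝟙-disjoint A B

-- This ties the bitwise indicator, which suits structural induction, to the `Nonempty` in the
-- adjacency of the key graph.
𝟙-disjoint-dichotomy : ∀ {P} (A B : Subset P) →
  (𝟙-disjoint A B ≡ 0ℚ × Nonempty (A ∩ B)) ⊎ (𝟙-disjoint A B ≡ 1ℚ × ¬ Nonempty (A ∩ B))
𝟙-disjoint-dichotomy []            []            = inj₂ (refl , λ ())
𝟙-disjoint-dichotomy (inside  ∷ A) (inside  ∷ B) = inj₁ (refl , (Fin.zero , here))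
𝟙-disjoint-dichotomy (inside  ∷ A) (outside ∷ B) with 𝟙-disjoint-dichotomy A B
... | inj₁ (e , (i , i∈)) = inj₁ (e , (Fin.suc i , there i∈))
... | inj₂ (e , empty)    = inj₂ (e , λ { (Fin.suc i , there i∈) → empty (i , i∈) })
𝟙-disjoint-dichotomy (outside ∷ A) (_       ∷ B) with 𝟙-disjoint-dichotomy A B
... | inj₁ (e , (i , i∈)) = inj₁ (e , (Fin.suc i , there i∈))
... | inj₂ (e , empty)    = inj₂ (e , λ { (Fin.suc i , there i∈) → empty (i , i∈) })

𝟙-nonempty? : ∀ {P} (A B : Subset P) → 𝟙 (does (nonempty? (A ∩ B))) ≡ 1ℚ ℚ.- 𝟙-disjoint A B
𝟙-nonempty? A B with 𝟙-disjoint-dichotomy A B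
... | inj₁ (e , ne) rewrite e | dec-true  (nonempty? (A ∩ B)) ne = refl
... | inj₂ (e , ¬ne) rewrite e | dec-false (nonempty? (A ∩ B)) ¬ne = refl

𝟙-disjoint-comm : ∀ {P} (A B : Subset P) → 𝟙-disjoint A B ≡ 𝟙-disjoint B A
𝟙-disjoint-comm []            []            = refl
𝟙-disjoint-comm (inside  ∷ A) (inside  ∷ B) = refl
𝟙-disjoint-comm (inside  ∷ A) (outside ∷ B) = 𝟙-disjoint-comm A B
𝟙-disjoint-comm (outside ∷ A) (inside  ∷ B) = 𝟙-disjoint-comm A B
𝟙-disjoint-comm (outside ∷ A) (outside ∷ B) = 𝟙-disjoint-comm A B

-- It reduces two simultaneous disjointness conditions on one ring to a single one, which can be
-- counted.
𝟙-disjoint-∪ : ∀ {P} (A B C : Subset P) → 𝟙-disjoint B C ℚ.* 𝟙-disjoint A C ≡ 𝟙-disjoint (A ∪ B) C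
𝟙-disjoint-∪ []            []            []            = refl
𝟙-disjoint-∪ (inside  ∷ A) (b       ∷ B) (inside  ∷ C) = ℚ.*-zeroʳ (𝟙-disjoint (b ∷ B) (inside ∷ C))
𝟙-disjoint-∪ (inside  ∷ A) (inside  ∷ B) (outside ∷ C) = 𝟙-disjoint-∪ A B C
𝟙-disjoint-∪ (inside  ∷ A) (outside ∷ B) (outside ∷ C) = 𝟙-disjoint-∪ A B C
𝟙-disjoint-∪ (outside ∷ A) (inside  ∷ B) (inside  ∷ C) = ℚ.*-zeroˡ (𝟙-disjoint A C)
𝟙-disjoint-∪ (outside ∷ A) (inside  ∷ B) (outside ∷ C) = 𝟙-disjoint-∪ A B C
𝟙-disjoint-∪ (outside ∷ A) (outside ∷ B) (c       ∷ C) = 𝟙-disjoint-∪ A B C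

∣∪∣-disjoint : ∀ {P} (A B : Subset P) → 𝟙-disjoint A B ≡ 0ℚ ⊎ ∣ A ∪ B ∣ ≡ ∣ A ∣ ℕ.+ ∣ B ∣
∣∪∣-disjoint []            []            = inj₂ refl
∣∪∣-disjoint (inside  ∷ A) (inside  ∷ B) = inj₁ refl
∣∪∣-disjoint (inside  ∷ A) (outside ∷ B) with ∣∪∣-disjoint A B
... | inj₁ e = inj₁ e
... | inj₂ e = inj₂ (cong suc e)
∣∪∣-disjoint (outside ∷ A) (inside  ∷ B) with ∣∪∣-disjoint A B
... | inj₁ e = inj₁ e
... | inj₂ e = inj₂ (trans (cong suc e) (sym (ℕ.+-suc ∣ A ∣ ∣ B ∣)))
∣∪∣-disjoint (outside ∷ A) (outside ∷ B) = ∣∪∣-disjoint A B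

-- Induction on the first key. A key of `A` must stay outside, so one half of the list contributes
-- nothing; a key off `A` is free, and the two halves add up by Pascal's rule.
count-disjoint : ∀ {P} K (A : Subset P) →
  ∑ (λ C → 𝟙 (does (∣ C ∣ ℕ.≟ K)) ℚ.* 𝟙-disjoint A C) (allSubsets P) ≡ binom ∣ ∁ A ∣ K
count-disjoint {P = suc P} K (a ∷ A) = trans
  (∑-++ term (map (outside ∷_) (allSubsets P)) (map (inside ∷_) (allSubsets P)))
  (trans (cong₂ ℚ._+_ (∑-map term (outside ∷_) (allSubsets P)) (∑-map term (inside ∷_) (allSubsets P)))
    (split a K))
  where
  term : Subset (suc P) → ℚ
  term C = 𝟙 (does (∣ C ∣ ℕ.≟ K)) ℚ.* 𝟙-disjoint (a ∷ A) C
  none : ∀ {f : Subset P → ℚ} → (∀ C → f C ≡ 0ℚ) → ∑ f (allSubsets P) ≡ 0ℚ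
  none f≡0 = trans (∑-cong (All.universal f≡0 (allSubsets P))) (∑-zero (allSubsets P))
  split : ∀ a K →
    ∑ (λ C → 𝟙 (does (∣ outside ∷ C ∣ ℕ.≟ K)) ℚ.* 𝟙-disjoint (a ∷ A) (outside ∷ C)) (allSubsets P) ℚ.+
    ∑ (λ C → 𝟙 (does (∣ inside ∷ C ∣ ℕ.≟ K)) ℚ.* 𝟙-disjoint (a ∷ A) (inside ∷ C)) (allSubsets P)
      ≡ binom ∣ ∁ (a ∷ A) ∣ K
  split inside K = trans
    (cong₂ ℚ._+_ (count-disjoint K A) (none (λ C → ℚ.*-zeroʳ (𝟙 (does (suc ∣ C ∣ ℕ.≟ K))))))
    (ℚ.+-identityʳ _)
  split outside zero = trans
    (cong₂ ℚ._+_ (count-disjoint zero A) (none (λ C → ℚ.*-zeroˡ (𝟙-disjoint A C))))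
    (trans (ℚ.+-identityʳ _) (trans (binom-0 ∣ ∁ A ∣) (sym (binom-0 (suc ∣ ∁ A ∣)))))
  split outside (suc K) = trans
    (cong₂ ℚ._+_ (count-disjoint (suc K) A) (count-disjoint K A))
    (trans (ℚ.+-comm (binom ∣ ∁ A ∣ (suc K)) (binom ∣ ∁ A ∣ K)) (sym (binom-pascal ∣ ∁ A ∣ K)))
count-disjoint {P = zero} zero    [] = sym (binom-0 0)
count-disjoint {P = zero} (suc K) [] = sym (binom-empty K)

∑-disjoint : ∀ {P} K (A : Subset P) → ∑ (𝟙-disjoint A) (subsetsOfSize K P) ≡ binom ∣ ∁ A ∣ K
∑-disjoint {P} K A = trans (∑-filter (λ C → ∣ C ∣ ℕ.≟ K) (𝟙-disjoint A) (allSubsets P)) (count-disjoint K A)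

𝟙-disjoint-∅ : ∀ {P} (C : Subset P) → 𝟙-disjoint ∅ C ≡ 1ℚ
𝟙-disjoint-∅ []      = refl
𝟙-disjoint-∅ (_ ∷ C) = 𝟙-disjoint-∅ C

-- Every ring is disjoint from the empty set, so this is the case `A = ∅` of `∑-disjoint`.
ι-length-subsetsOfSize : ∀ K P → ι (length (subsetsOfSize K P)) ≡ binom P K
ι-length-subsetsOfSize K P = begin
  ι (length (subsetsOfSize K P))
    ≡⟨ ι-length (subsetsOfSize K P) ⟩
  ∑ (λ _ → 1ℚ) (subsetsOfSize K P)
    ≡⟨ ∑-cong (All.universal (λ C → sym (𝟙-disjoint-∅ C)) (subsetsOfSize K P)) ⟩
  ∑ (𝟙-disjoint ∅) (subsetsOfSize K P)
    ≡⟨ ∑-disjoint K (∅ {n = P}) ⟩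
  binom ∣ ∁ {n = P} ∅ ∣ K
    ≡⟨ cong (λ k → binom k K) (trans (∣∁p∣≡n∸∣p∣ (∅ {n = P})) (cong (P ℕ.∸_) (∣⊥∣≡0 P))) ⟩
  binom P K ∎
  where open ≡-Reasoning

E-uniform : {A : Set} (m : ℕ) (xs : List A) .{{_ : ℕ.NonZero (length xs)}} (f : A → ℚ) →
  E m (uniform xs) f ℚ.* ι (length xs) ≡ ∑ f xs
E-uniform m xs f = begin
  E m (uniform xs) f ℚ.* ι (length xs)
    ≡⟨ cong (ℚ._* ι (length xs)) (∑-map (λ (a , w) → approx w m ℚ.* f a) (λ a → a , ofℚ 1/N) xs) ⟩
  ∑ (λ a → 1/N ℚ.* f a) xs ℚ.* ι (length xs)
    ≡⟨ cong (ℚ._* ι (length xs)) (∑-cong (All.universal (λ a → ℚ.*-comm 1/N (f a)) xs)) ⟩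
  ∑ (λ a → f a ℚ.* 1/N) xs ℚ.* ι (length xs)
    ≡⟨ cong (ℚ._* ι (length xs)) (∑-*ʳ f 1/N xs) ⟩
  ∑ f xs ℚ.* 1/N ℚ.* ι (length xs)
    ≡⟨ trans (ℚ.*-assoc (∑ f xs) 1/N (ι (length xs))) (cong (∑ f xs ℚ.*_) (trans (/*ι 1 (length xs)) ι-1)) ⟩
  ∑ f xs ℚ.* 1ℚ
    ≡⟨ ℚ.*-identityʳ (∑ f xs) ⟩
  ∑ f xs ∎
  where
  open ≡-Reasoning
  1/N : ℚ
  1/N = + 1 ℚ./ length xs

-- Unlike `E-cong` this asks for equality on the support only; through it the ring size `K` enters
-- the expectations.
E-uniform-cong : {A : Set} (m : ℕ) (xs : List A) .{{_ : ℕ.NonZero (length xs)}} {f g : A → ℚ} →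
  All (λ a → f a ≡ g a) xs → E m (uniform xs) f ≡ E m (uniform xs) g
E-uniform-cong m xs {f} {g} es = trans (∑-map (λ (a , w) → approx w m ℚ.* f a) _ xs)
  (trans (∑-cong (All.map (cong (+ 1 ℚ./ length xs ℚ.*_)) es))
    (sym (∑-map (λ (a , w) → approx w m ℚ.* g a) _ xs)))

-- Inclusion-exclusion for three independent key rings

module _ (m : ℕ) {K P : ℕ} (K≤P : K ℕ.≤ P)
         (q₁ r₁ : ℚ) (hq : q₁ ℚ.* binom P K ≡ binom (P ℕ.∸ K) K)
         (hr : r₁ ℚ.* binom P K ≡ binom (P ℕ.∸ (K ℕ.+ K)) K) where
  private
    rings : List (Subset P)
    rings = subsetsOfSize K P

    instance
      rings-nonZero : ℕ.NonZero (length rings)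
      rings-nonZero = subsetsOfSize-nonZero K≤P

    D : Dist (Subset P)
    D = uniform rings {{subsetsOfSize-nonZero K≤P}}

    size : All (λ S → ∣ S ∣ ≡ K) rings
    size = all-filter (λ S → ∣ S ∣ ℕ.≟ K) (allSubsets P)

    0<N : 0ℚ ℚ.< binom P K
    0<N = subst (0ℚ ℚ.<_) (ι-length-subsetsOfSize K P) (0<ι (length rings))

    E*N : ∀ f → E m D f ℚ.* binom P K ≡ ∑ f rings
    E*N f = trans (cong (E m D f ℚ.*_) (sym (ι-length-subsetsOfSize K P))) (E-uniform m rings f)

    prob : IsProbability m D
    prob = *-cancelʳ-≡ 0<N (trans (E*N (λ _ → 1ℚ)) (trans (sym (ι-length rings))
      (trans (ι-length-subsetsOfSize K P) (sym (ℚ.*-identityˡ (binom P K))))))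

    d : Subset P → Subset P → ℚ
    d = 𝟙-disjoint

    E-d : ∀ A → E m D (d A) ℚ.* binom P K ≡ binom (P ℕ.∸ ∣ A ∣) K
    E-d A = trans (E*N (d A)) (trans (∑-disjoint K A) (cong (λ k → binom k K) (∣∁p∣≡n∸∣p∣ A)))

    E-disjoint : ∀ A → ∣ A ∣ ≡ K → E m D (d A) ≡ q₁
    E-disjoint A ∣A∣≡K = *-cancelʳ-≡ 0<N
      (trans (E-d A) (trans (cong (λ k → binom (P ℕ.∸ k) K) ∣A∣≡K) (sym hq)))

    -- For overlapping rings the inner expectation varies with the size of `A ∪ B`; the factor
    -- `d A B` removes that case, and otherwise the union has `K + K` keys.
    E-disjoint₂ : ∀ A B → ∣ A ∣ ≡ K → ∣ B ∣ ≡ K →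
      d A B ℚ.* E m D (λ C → d B C ℚ.* d A C) ≡ d A B ℚ.* r₁
    E-disjoint₂ A B ∣A∣≡K ∣B∣≡K = go (∣∪∣-disjoint A B)
      where
      open ≡-Reasoning
      J′ : ℚ
      J′ = E m D (λ C → d B C ℚ.* d A C)
      go : d A B ≡ 0ℚ ⊎ ∣ A ∪ B ∣ ≡ ∣ A ∣ ℕ.+ ∣ B ∣ → d A B ℚ.* J′ ≡ d A B ℚ.* r₁
      go (inj₁ e) = trans (cong (ℚ._* J′) e)
        (trans (ℚ.*-zeroˡ J′) (sym (trans (cong (ℚ._* r₁) e) (ℚ.*-zeroˡ r₁))))
      go (inj₂ e) = cong (d A B ℚ.*_) (*-cancelʳ-≡ 0<N (begin
        J′ ℚ.* binom P K
          ≡⟨ cong (ℚ._* binom P K) (E-cong m D (𝟙-disjoint-∪ A B)) ⟩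
        E m D (d (A ∪ B)) ℚ.* binom P K
          ≡⟨ E-d (A ∪ B) ⟩
        binom (P ℕ.∸ ∣ A ∪ B ∣) K
          ≡⟨ cong (λ k → binom (P ℕ.∸ k) K) (trans e (cong₂ ℕ._+_ ∣A∣≡K ∣B∣≡K)) ⟩
        binom (P ℕ.∸ (K ℕ.+ K)) K
          ≡⟨ hr ⟨
        r₁ ℚ.* binom P K ∎))

    -- Inclusion–exclusion: given A, each single disjointness event has
    -- probability q, any two have q², and all three have q r.
    β : ℚ
    β = triangleProbability q₁ r₁

    meet : Subset P → Subset P → ℚ
    meet A B = 1ℚ ℚ.- d A B

    -- The last expectation depends on how `A` and `B` overlap, so it is left standing and evaluated
    -- only after averaging over `B`.
    E-triangle-C : ∀ A B → ∣ A ∣ ≡ K → ∣ B ∣ ≡ K →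
      E m D (λ C → meet A B ℚ.* (meet B C ℚ.* meet A C)) ≡
      (1ℚ ℚ.- d A B) ℚ.* (1ℚ ℚ.- q₁ ℚ.- q₁) ℚ.- d A B ℚ.* r₁ ℚ.+ E m D (λ C → d B C ℚ.* d A C)
    E-triangle-C A B ∣A∣≡K ∣B∣≡K = begin
      E m D (λ C → meet A B ℚ.* (meet B C ℚ.* meet A C))
        ≡⟨ E-*ˡ m D (meet A B) _ ⟩
      meet A B ℚ.* E m D (λ C → meet B C ℚ.* meet A C)
        -- Minus signs become factors `- 1`, so that linearity of `E` applies term by term.
        ≡⟨ cong (meet A B ℚ.*_) (trans (E-cong m D (λ C →
             solve 2 (λ x y → (con 1ℚ :- x) :* (con 1ℚ :- y)
               := con 1ℚ :+ (x :* con (ℚ.- 1ℚ) :+ (y :* con (ℚ.- 1ℚ) :+ x :* y))) refl (d B C) (d A C)))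
             (trans (E-+ m D (λ _ → 1ℚ) _) (cong₂ ℚ._+_ prob
               (trans (E-+ m D (λ C → d B C ℚ.* ℚ.- 1ℚ) _) (cong₂ ℚ._+_
                 (trans (E-*ʳ m D (d B) (ℚ.- 1ℚ)) (cong (ℚ._* ℚ.- 1ℚ) (E-disjoint B ∣B∣≡K)))
                 (trans (E-+ m D (λ C → d A C ℚ.* ℚ.- 1ℚ) _) (cong (ℚ._+ J)
                   (trans (E-*ʳ m D (d A) (ℚ.- 1ℚ)) (cong (ℚ._* ℚ.- 1ℚ) (E-disjoint A ∣A∣≡K)))))))))) ⟩
      meet A B ℚ.* (1ℚ ℚ.+ (q₁ ℚ.* ℚ.- 1ℚ ℚ.+ (q₁ ℚ.* ℚ.- 1ℚ ℚ.+ J)))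
        ≡⟨ solve 3 (λ x q j → (con 1ℚ :- x) :* (con 1ℚ :+ (q :* con (ℚ.- 1ℚ) :+ (q :* con (ℚ.- 1ℚ) :+ j)))
             := (con 1ℚ :- x) :* (con 1ℚ :- q :- q) :- x :* j :+ j) refl (d A B) q₁ J ⟩
      (1ℚ ℚ.- d A B) ℚ.* (1ℚ ℚ.- q₁ ℚ.- q₁) ℚ.- d A B ℚ.* J ℚ.+ J
        ≡⟨ cong (λ t → (1ℚ ℚ.- d A B) ℚ.* (1ℚ ℚ.- q₁ ℚ.- q₁) ℚ.- t ℚ.+ J) (E-disjoint₂ A B ∣A∣≡K ∣B∣≡K) ⟩
      (1ℚ ℚ.- d A B) ℚ.* (1ℚ ℚ.- q₁ ℚ.- q₁) ℚ.- d A B ℚ.* r₁ ℚ.+ J ∎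
      where
      open ≡-Reasoning
      J : ℚ
      J = E m D (λ C → d B C ℚ.* d A C)

    -- Exchanging the expectations fixes `C` first. The average over `B` is then q for every ring
    -- `C`, so it comes out as a constant.
    E-two-disjoint : ∀ A → ∣ A ∣ ≡ K → E m D (λ B → E m D (λ C → d B C ℚ.* d A C)) ≡ q₁ ℚ.* q₁
    E-two-disjoint A ∣A∣≡K = begin
      E m D (λ B → E m D (λ C → d B C ℚ.* d A C))
        ≡⟨ E-swap m D D (λ B C → d B C ℚ.* d A C) ⟩
      E m D (λ C → E m D (λ B → d B C ℚ.* d A C))
        ≡⟨ E-cong m D (λ C → trans (E-*ʳ m D (λ B → d B C) (d A C))
             (cong (ℚ._* d A C) (E-cong m D (λ B → 𝟙-disjoint-comm B C)))) ⟩
      E m D (λ C → E m D (d C) ℚ.* d A C)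
        ≡⟨ E-uniform-cong m rings (All.map (λ {S} ∣S∣≡K → cong (ℚ._* d A S) (E-disjoint S ∣S∣≡K)) size) ⟩
      E m D (λ C → q₁ ℚ.* d A C)
        ≡⟨ trans (E-*ˡ m D q₁ (d A)) (cong (q₁ ℚ.*_) (E-disjoint A ∣A∣≡K)) ⟩
      q₁ ℚ.* q₁ ∎
      where open ≡-Reasoning

    E-triangle-BC : ∀ A → ∣ A ∣ ≡ K →
      E m D (λ B → E m D (λ C → meet A B ℚ.* (meet B C ℚ.* meet A C))) ≡ β
    E-triangle-BC A ∣A∣≡K = begin
      E m D (λ B → E m D (λ C → meet A B ℚ.* (meet B C ℚ.* meet A C)))
        ≡⟨ E-uniform-cong m rings (All.map (λ {B} ∣B∣≡K → trans (E-triangle-C A B ∣A∣≡K ∣B∣≡K)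
             (solve 4 (λ x q r j → (con 1ℚ :- x) :* (con 1ℚ :- q :- q) :- x :* r :+ j
               := (con 1ℚ :- q :- q) :+ (x :* (q :+ q :- con 1ℚ :- r) :+ j)) refl
               (d A B) q₁ r₁ (J B))) size) ⟩
      E m D (λ B → (1ℚ ℚ.- q₁ ℚ.- q₁) ℚ.+ (d A B ℚ.* s ℚ.+ J B))
        ≡⟨ trans (E-+ m D (λ _ → 1ℚ ℚ.- q₁ ℚ.- q₁) _) (cong₂ ℚ._+_ (E-const m D prob (1ℚ ℚ.- q₁ ℚ.- q₁))
             (trans (E-+ m D (λ B → d A B ℚ.* s) J) (cong₂ ℚ._+_
               (trans (E-*ʳ m D (d A) s) (cong (ℚ._* s) (E-disjoint A ∣A∣≡K)))
               (E-two-disjoint A ∣A∣≡K)))) ⟩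
      (1ℚ ℚ.- q₁ ℚ.- q₁) ℚ.+ (q₁ ℚ.* s ℚ.+ q₁ ℚ.* q₁)
        ≡⟨ solve 2 (λ q r → (con 1ℚ :- q :- q) :+ (q :* (q :+ q :- con 1ℚ :- r) :+ q :* q)
             := con 1ℚ :- (q :+ q :+ q) :+ (q :* q :+ q :* q :+ q :* q) :- q :* r) refl q₁ r₁ ⟩
      β ∎
      where
      open ≡-Reasoning
      s : ℚ
      s = q₁ ℚ.+ q₁ ℚ.- 1ℚ ℚ.- r₁
      J : Subset P → ℚ
      J B = E m D (λ C → d B C ℚ.* d A C)

    adj : ∀ {n} → Vec (Subset P) n → Fin n → Fin n → Bool
    adj rs i j = does (SimpleGraph.adj? (keyGraph rs) i j)

    𝟙-adj : ∀ {n} {i j : Fin n} (rs : Vec (Subset P) n) → i Fin.< j →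
      𝟙 (adj rs i j) ≡ meet (lookup rs i) (lookup rs j)
    𝟙-adj {i = i} {j} rs i<j = trans
      (cong (λ b → 𝟙 (b ∧ does (nonempty? (lookup rs i ∩ lookup rs j))))
        (dec-true (¬? (i Fin.≟ j)) (Fin.<⇒≢ i<j)))
      (𝟙-nonempty? (lookup rs i) (lookup rs j))

    E-key-triangle : ∀ {n} (i j k : Fin n) → i Fin.< j → j Fin.< k →
      E m (iid n D) (λ rs → 𝟙 (isTriangle (keyGraph rs) i j k)) ≡ β
    E-key-triangle {n} i j k i<j j<k = begin
      E m (iid n D) (λ rs → 𝟙 (isTriangle (keyGraph rs) i j k))
        ≡⟨ E-cong m (iid n D) (λ rs → trans (𝟙-∧ (adj rs i j) (adj rs j k ∧ adj rs i k))
             (cong₂ ℚ._*_ (𝟙-adj rs i<j) (trans (𝟙-∧ (adj rs j k) (adj rs i k))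
               (cong₂ ℚ._*_ (𝟙-adj rs j<k) (𝟙-adj rs (Fin.<-trans i<j j<k)))))) ⟩
      E m (iid n D) (λ rs → T (lookup rs i) (lookup rs j) (lookup rs k))
        ≡⟨ E-iid₃ m D prob i<j j<k T ⟩
      E m D (λ A → E m D (λ B → E m D (T A B)))
        ≡⟨ E-uniform-cong m rings (All.map (λ {A} → E-triangle-BC A) size) ⟩
      E m D (λ _ → β)
        ≡⟨ E-const m D prob β ⟩
      β ∎
      where
      open ≡-Reasoning
      T : Subset P → Subset P → Subset P → ℚ
      T A B C = meet A B ℚ.* (meet B C ℚ.* meet A C)

  approx-𝔼T-key : ∀ n → approx (𝔼T-key n K P K≤P) m ≡ ι (#triples n) ℚ.*
    triangleProbability q₁ r₁
  approx-𝔼T-key n = E-triangles m (iid n D) keyGraph β E-key-triangle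

-- The limit

p≤∣p∣ : ∀ a → a ℚ.≤ ℚ.∣ a ∣
p≤∣p∣ a with ℚ.≤-total 0ℚ a
... | inj₁ 0≤a = ℚ.≤-reflexive (sym (ℚ.0≤p⇒∣p∣≡p 0≤a))
... | inj₂ a≤0 = ℚ.≤-trans a≤0 (ℚ.0≤∣p∣ a)

-p≤∣p∣ : ∀ a → ℚ.- a ℚ.≤ ℚ.∣ a ∣
-p≤∣p∣ a = subst (ℚ.- a ℚ.≤_) (ℚ.∣-p∣≡∣p∣ a) (p≤∣p∣ (ℚ.- a))

∣p∣≤ : ∀ {a c} → a ℚ.≤ c → ℚ.- a ℚ.≤ c → ℚ.∣ a ∣ ℚ.≤ c
∣p∣≤ {a} {c} a≤c -a≤c with ℚ.∣p∣≡p∨∣p∣≡-p a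
... | inj₁ e = subst (ℚ._≤ c) (sym e) a≤c
... | inj₂ e = subst (ℚ._≤ c) (sym e) -a≤c

<ᵣ-ofℚ : ∀ {δ} → 0ℚ ℚ.< δ → 0ᵣ <ᵣ ofℚ δ
<ᵣ-ofℚ {δ} 0<δ = δ , 0<δ , 0 , λ _ _ → ℚ.≤-reflexive (ℚ.+-identityˡ δ)

+gap⇒≤ : ∀ {a e c} → 0ℚ ℚ.< e → a ℚ.+ e ℚ.≤ c → a ℚ.≤ c
+gap⇒≤ {a} {e} 0<e a+e≤c = ℚ.≤-trans (≤-by-gap {c = e} (ℚ.<⇒≤ 0<e) refl) a+e≤c

-- The choice is `δ = min(1, η)/64`: one bound is the standing smallness assumption, the other
-- controls the final relative error `64δ`.
small : ∀ η → 0ℚ ℚ.< η → Σ[ δ ∈ ℚ ] 0ℚ ℚ.< δ × 64ℚ ℚ.* δ ℚ.≤ 1ℚ × 64ℚ ℚ.* δ ℚ.≤ η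
small η 0<η with ℚ.≤-total 1ℚ η
... | inj₁ 1≤η = let (δ , 0<δ , δ64≡1) = ratio 1ℚ 64ℚ (ℚ.positive⁻¹ 1ℚ) (ℚ.positive⁻¹ 64ℚ)
                     64δ≤1 = ℚ.≤-reflexive (trans (ℚ.*-comm 64ℚ δ) δ64≡1)
                 in δ , 0<δ , 64δ≤1 , ℚ.≤-trans 64δ≤1 1≤η
... | inj₂ η≤1 = let (δ , 0<δ , δ64≡η) = ratio η 64ℚ 0<η (ℚ.positive⁻¹ 64ℚ)
                     64δ≤η = ℚ.≤-reflexive (trans (ℚ.*-comm 64ℚ δ) δ64≡η)
                 in δ , 0<δ , ℚ.≤-trans 64δ≤η η≤1 , 64δ≤η

-- Positivity excludes the branch in which `q` is 0 by convention; this is how the limit of `q`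
-- yields `2K ≤ P` for large n.
q-binom : ∀ K P → 0ℚ ℚ.< q K P → K ℕ.+ K ℕ.≤ P × q K P ℚ.* binom P K ≡ binom (P ℕ.∸ K) K
q-binom K P 0<q with 2 ℕ.* K ℕ.≤? P
... | no  _    = contradiction 0<q (ℚ.<-irrefl refl)
... | yes 2K≤P = subst (λ t → K ℕ.+ t ℕ.≤ P) (ℕ.+-identityʳ K) 2K≤P ,
  /*binom (P ℕ.∸ K) P K {{C-nonZero (ℕ.≤-trans (ℕ.m≤m+n K (1 ℕ.* K)) 2K≤P)}}

0<1-δ : ∀ {δ} → 0ℚ ℚ.≤ δ → 64ℚ ℚ.* δ ℚ.≤ 1ℚ → 0ℚ ℚ.< 1ℚ ℚ.- δ
0<1-δ {δ} 0≤δ 64δ≤1 = ℚ.*-cancelˡ-<-nonNeg 64ℚ (ℚ.<-≤-trans (ℚ.positive⁻¹ (+ 63 ℚ./ 1))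
  (≤-by-gap (0≤-gap 64δ≤1)
    (solve 1 (λ d → con 64ℚ :* (con 1ℚ :- d) := con (+ 63 ℚ./ 1) :+ (con 1ℚ :- con 64ℚ :* d)) refl δ)))

-- From β ≈ v³(1+b) and p ≈ v to β ≈ p³(1+b).
module _ {v b p β δ : ℚ} (0≤v : 0ℚ ℚ.≤ v) (0≤b : 0ℚ ℚ.≤ b) (0≤δ : 0ℚ ℚ.≤ δ) (64δ≤1 : 64ℚ ℚ.* δ ℚ.≤ 1ℚ)
  (v[1-δ]≤p : v ℚ.* (1ℚ ℚ.- δ) ℚ.≤ p) (p≤v[1+δ] : p ℚ.≤ v ℚ.* (1ℚ ℚ.+ δ))
  where
  private
    0≤1-64δ : 0ℚ ℚ.≤ 1ℚ ℚ.- 64ℚ ℚ.* δ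
    0≤1-64δ = 0≤-gap 64δ≤1
    0≤1+b : 0ℚ ℚ.≤ 1ℚ ℚ.+ b
    0≤1+b = 0≤-+ 0≤1 0≤b
    0≤v[1-δ] : 0ℚ ℚ.≤ v ℚ.* (1ℚ ℚ.- δ)
    0≤v[1-δ] = 0≤-* 0≤v (ℚ.<⇒≤ (0<1-δ 0≤δ 64δ≤1))
    F : ℚ
    F = p ³ ℚ.* (1ℚ ℚ.+ b)

  -- The step from 32 to 64 pays for cubing the relative error of `p`: `1+32δ ≤ (1+64δ)(1-δ)³` here,
  -- and `(1+δ)³(1-64δ) ≤ 1-32δ` for the lower bound.
  transfer-upper : β ℚ.≤ v ³ ℚ.* (1ℚ ℚ.+ b) ℚ.* (1ℚ ℚ.+ 32ℚ ℚ.* δ) → β ℚ.≤ F ℚ.* (1ℚ ℚ.+ 64ℚ ℚ.* δ)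
  transfer-upper β≤ = ≤-cancelʳ (0<³ (0<1-δ 0≤δ 64δ≤1)) (begin
    β ℚ.* (1ℚ ℚ.- δ) ³
      ≤⟨ *-monoʳ ((1ℚ ℚ.- δ) ³) (0≤³ (ℚ.<⇒≤ (0<1-δ 0≤δ 64δ≤1))) β≤ ⟩
    v ³ ℚ.* (1ℚ ℚ.+ b) ℚ.* (1ℚ ℚ.+ 32ℚ ℚ.* δ) ℚ.* (1ℚ ℚ.- δ) ³
      ≡⟨ solve 4 (λ v b s t → v :* v :* v :* b :* s :* (t :* t :* t)
           := (v :* t) :* (v :* t) :* (v :* t) :* (b :* s)) refl v (1ℚ ℚ.+ b) (1ℚ ℚ.+ 32ℚ ℚ.* δ) (1ℚ ℚ.- δ) ⟩
    (v ℚ.* (1ℚ ℚ.- δ)) ³ ℚ.* ((1ℚ ℚ.+ b) ℚ.* (1ℚ ℚ.+ 32ℚ ℚ.* δ))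
      ≤⟨ *-monoʳ ((1ℚ ℚ.+ b) ℚ.* (1ℚ ℚ.+ 32ℚ ℚ.* δ))
           (0≤-* 0≤1+b (0≤-+ 0≤1 (0≤-* (0≤ℚ 32ℚ) 0≤δ))) (³-mono 0≤v[1-δ] v[1-δ]≤p) ⟩
    p ³ ℚ.* ((1ℚ ℚ.+ b) ℚ.* (1ℚ ℚ.+ 32ℚ ℚ.* δ))
      ≤⟨ ≤-by-gap (0≤-* (0≤-* (0≤³ (ℚ.≤-trans 0≤v[1-δ] v[1-δ]≤p)) 0≤1+b) (0≤-* 0≤δ
           (0≤-+ (0≤-* (0≤ℚ 3ℚ) 0≤1-64δ) (0≤-+ (0≤ℚ (+ 26 ℚ./ 1)) (0≤-+ (0≤-* (0≤ℚ 3ℚ) 0≤δ)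
             (0≤-+ (0≤-* (0≤ℚ (+ 190 ℚ./ 1)) (0≤-* 0≤δ 0≤δ)) (0≤-* (0≤-* 0≤δ 0≤δ) 0≤1-64δ)))))))
         (solve 3 (λ P b d → P :* b :* (con 1ℚ :+ con 64ℚ :* d) :* ((con 1ℚ :- d) :* (con 1ℚ :- d) :* (con 1ℚ :- d))
           := P :* (b :* (con 1ℚ :+ con 32ℚ :* d))
             :+ P :* b :* (d :* (con 3ℚ :* (con 1ℚ :- con 64ℚ :* d) :+ (con (+ 26 ℚ./ 1) :+ (con 3ℚ :* d
             :+ (con (+ 190 ℚ./ 1) :* (d :* d) :+ d :* d :* (con 1ℚ :- con 64ℚ :* d))))))) refl (p ³) (1ℚ ℚ.+ b) δ) ⟩
    F ℚ.* (1ℚ ℚ.+ 64ℚ ℚ.* δ) ℚ.* (1ℚ ℚ.- δ) ³ ∎)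
    where open ℚ.≤-Reasoning

  transfer-lower : v ³ ℚ.* (1ℚ ℚ.+ b) ℚ.* (1ℚ ℚ.- 32ℚ ℚ.* δ) ℚ.≤ β → F ℚ.* (1ℚ ℚ.- 64ℚ ℚ.* δ) ℚ.≤ β
  transfer-lower ≤β = begin
    F ℚ.* (1ℚ ℚ.- 64ℚ ℚ.* δ)
      ≡⟨ ℚ.*-assoc (p ³) (1ℚ ℚ.+ b) (1ℚ ℚ.- 64ℚ ℚ.* δ) ⟩
    p ³ ℚ.* ((1ℚ ℚ.+ b) ℚ.* (1ℚ ℚ.- 64ℚ ℚ.* δ))
      ≤⟨ *-monoʳ _ (0≤-* 0≤1+b 0≤1-64δ) (³-mono (ℚ.≤-trans 0≤v[1-δ] v[1-δ]≤p) p≤v[1+δ]) ⟩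
    (v ℚ.* (1ℚ ℚ.+ δ)) ³ ℚ.* ((1ℚ ℚ.+ b) ℚ.* (1ℚ ℚ.- 64ℚ ℚ.* δ))
      ≤⟨ ≤-by-gap (0≤-* (0≤-* (0≤³ 0≤v) 0≤1+b) (0≤-* 0≤δ (0≤-+ (0≤ℚ (+ 29 ℚ./ 1))
           (0≤-+ (0≤-* (0≤ℚ (+ 189 ℚ./ 1)) 0≤δ) (0≤-+ (0≤-* (0≤ℚ (+ 191 ℚ./ 1)) (0≤-* 0≤δ 0≤δ))
             (0≤-* (0≤ℚ 64ℚ) (0≤³ 0≤δ)))))))
         (solve 3 (λ v b d → v :* v :* v :* b :* (con 1ℚ :- con 32ℚ :* d)
           := (v :* (con 1ℚ :+ d)) :* (v :* (con 1ℚ :+ d)) :* (v :* (con 1ℚ :+ d)) :* (b :* (con 1ℚ :- con 64ℚ :* d))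
             :+ v :* v :* v :* b :* (d :* (con (+ 29 ℚ./ 1) :+ (con (+ 189 ℚ./ 1) :* d
             :+ (con (+ 191 ℚ./ 1) :* (d :* d) :+ con 64ℚ :* (d :* d :* d)))))) refl v (1ℚ ℚ.+ b) δ) ⟩
    v ³ ℚ.* (1ℚ ℚ.+ b) ℚ.* (1ℚ ℚ.- 32ℚ ℚ.* δ)
      ≤⟨ ≤β ⟩
    β ∎
    where open ℚ.≤-Reasoning

relative-bounds : ∀ {p v δ} → 0ℚ ℚ.< v → ℚ.∣ p ℚ.* recip v ℚ.- 1ℚ ∣ ℚ.≤ δ →
  v ℚ.* (1ℚ ℚ.- δ) ℚ.≤ p × p ℚ.≤ v ℚ.* (1ℚ ℚ.+ δ)
relative-bounds {p} {v} {δ} 0<v close =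
  ≤-by-gap (0≤-* 0≤v (0≤-gap (ℚ.≤-trans (-p≤∣p∣ _) close)))
    (trans (sym undo) (solve 3 (λ s v d → s :* v := v :* (con 1ℚ :- d) :+ v :* (d :- (:- (s :- con 1ℚ)))) refl (p ℚ.* recip v) v δ)) ,
  ≤-by-gap (0≤-* 0≤v (0≤-gap (ℚ.≤-trans (p≤∣p∣ _) close)))
    (trans (solve 3 (λ s v d → v :* (con 1ℚ :+ d) := s :* v :+ v :* (d :- (s :- con 1ℚ))) refl (p ℚ.* recip v) v δ)
      (cong (ℚ._+ v ℚ.* (δ ℚ.- (p ℚ.* recip v ℚ.- 1ℚ))) undo))
  where
  0≤v : 0ℚ ℚ.≤ v
  0≤v = ℚ.<⇒≤ 0<v
  undo : p ℚ.* recip v ℚ.* v ≡ p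
  undo = trans (ℚ.*-assoc p (recip v) v)
    (trans (cong (p ℚ.*_) (recip-inverse v (0<⇒≢0 0<v))) (ℚ.*-identityʳ p))

-- The quotient equals `β/(GH)`, the number of triples `T` cancelling; both one-sided bounds are
-- checked after multiplication by `GH`.
ratio-close : ∀ {T β G H δ} → 0ℚ ℚ.< T → 0ℚ ℚ.< G → 0ℚ ℚ.< H →
  G ℚ.* H ℚ.* (1ℚ ℚ.- δ) ℚ.≤ β → β ℚ.≤ G ℚ.* H ℚ.* (1ℚ ℚ.+ δ) →
  ℚ.∣ T ℚ.* β ℚ.* recip (T ℚ.* G) ℚ.* recip H ℚ.- 1ℚ ∣ ℚ.≤ δ
ratio-close {T} {β} {G} {H} {δ} 0<T 0<G 0<H ≤β β≤ = ∣p∣≤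
  (≤-cancelʳ 0<GH (≤-by-gap (0≤-gap β≤)
    (trans (solve 3 (λ g d b → d :* g := b :- g :+ (g :* (con 1ℚ :+ d) :- b)) refl (G ℚ.* H) δ β)
      (cong (ℚ._+ (G ℚ.* H ℚ.* (1ℚ ℚ.+ δ) ℚ.- β)) (sym R-1)))))
  (≤-cancelʳ 0<GH (≤-by-gap (0≤-gap ≤β)
    (trans (solve 3 (λ g d b → d :* g := :- (b :- g) :+ (b :- g :* (con 1ℚ :- d))) refl (G ℚ.* H) δ β)
      (cong (ℚ._+ (β ℚ.- G ℚ.* H ℚ.* (1ℚ ℚ.- δ))) (trans (cong ℚ.-_ (sym R-1)) (ℚ.neg-distribˡ-* (R ℚ.- 1ℚ) (G ℚ.* H)))))))
  where
  R : ℚ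
  R = T ℚ.* β ℚ.* recip (T ℚ.* G) ℚ.* recip H
  0<GH : 0ℚ ℚ.< G ℚ.* H
  0<GH = *-pos G H 0<G 0<H
  0<TG : 0ℚ ℚ.< T ℚ.* G
  0<TG = *-pos T G 0<T 0<G
  R*GH : R ℚ.* (G ℚ.* H) ≡ β
  R*GH = begin
    R ℚ.* (G ℚ.* H)
      ≡⟨ solve 6 (λ t b g h r s → t :* b :* r :* s :* (g :* h) := b :* (r :* (t :* g)) :* (s :* h)) refl
           T β G H (recip (T ℚ.* G)) (recip H) ⟩
    β ℚ.* (recip (T ℚ.* G) ℚ.* (T ℚ.* G)) ℚ.* (recip H ℚ.* H)
      ≡⟨ cong₂ (λ s t → β ℚ.* s ℚ.* t) (recip-inverse (T ℚ.* G) (0<⇒≢0 0<TG)) (recip-inverse H (0<⇒≢0 0<H)) ⟩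
    β ℚ.* 1ℚ ℚ.* 1ℚ
      ≡⟨ trans (ℚ.*-identityʳ (β ℚ.* 1ℚ)) (ℚ.*-identityʳ β) ⟩
    β ∎
    where open ≡-Reasoning
  R-1 : (R ℚ.- 1ℚ) ℚ.* (G ℚ.* H) ≡ β ℚ.- G ℚ.* H
  R-1 = trans (solve 2 (λ r g → (r :- con 1ℚ) :* g := r :* g :- g) refl R (G ℚ.* H))
    (cong (ℚ._- G ℚ.* H) R*GH)

-- The ratio at fixed `n` and fixed approximant

module _ {K P n : ℕ} (0<K : 0 ℕ.< K) (2K≤P : K ℕ.+ K ≤ P) (K≤P : K ≤ P) (3≤n : 3 ≤ n)
  (δ q : ℚ) (0≤δ : 0ℚ ℚ.≤ δ) (64δ≤1 : 64ℚ ℚ.* δ ℚ.≤ 1ℚ)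
  (hq : q ℚ.* binom P K ≡ binom (P ℕ.∸ K) K) (1-q≤δ : 1ℚ ℚ.- q ℚ.≤ δ)
  where
  private
    v b T p⁻ : ℚ
    v = 1ℚ ℚ.- q
    b = P ÷ (K ℕ.^ 3)
    T = ι (#triples n)
    p⁻ = v ℚ.* (1ℚ ℚ.- δ)

    0<T : 0ℚ ℚ.< T
    0<T = 0<ι (#triples n) {{#triples-nonZero 3≤n}}

    0≤b : 0ℚ ℚ.≤ b
    0≤b = 0≤÷ P (ℕ.m^n>0 K {{ℕ.>-nonZero 0<K}} 3)

    0<1+b : 0ℚ ℚ.< 1ℚ ℚ.+ b
    0<1+b = ℚ.+-mono-<-≤ (ℚ.positive⁻¹ 1ℚ) 0≤b

    0<v : 0ℚ ℚ.< v
    0<v = proj₁ (triangleProbability-≈ 0<K 2K≤P δ q 64δ≤1 hq 1-q≤δ)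

    0≤v : 0ℚ ℚ.≤ v
    0≤v = ℚ.<⇒≤ 0<v

    0<p⁻ : 0ℚ ℚ.< p⁻
    0<p⁻ = *-pos v (1ℚ ℚ.- δ) 0<v (0<1-δ 0≤δ 64δ≤1)

  -- A positive bound that does not mention `m`: apartness of a real from 0 needs one gap for all
  -- late approximants.
  0<𝔼T-ER-bound : 0ℚ ℚ.< T ℚ.* p⁻ ³
  0<𝔼T-ER-bound = *-pos T (p⁻ ³) 0<T (0<³ 0<p⁻)

  module _ (p : ℝ) (m : ℕ) (p-close : ℚ.∣ approx p m ℚ.* recip (1ℚ ℚ.- q) ℚ.- 1ℚ ∣ ℚ.≤ δ) where
    private
      pₘ : ℚ
      pₘ = approx p m

      v[1-δ]≤p : p⁻ ℚ.≤ pₘ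
      v[1-δ]≤p = proj₁ (relative-bounds 0<v p-close)

      p≤v[1+δ] : pₘ ℚ.≤ v ℚ.* (1ℚ ℚ.+ δ)
      p≤v[1+δ] = proj₂ (relative-bounds 0<v p-close)

    𝔼T-ER-≥ : 0ℚ ℚ.+ T ℚ.* p⁻ ³ ℚ.≤ approx (𝔼T-ER n p) m
    𝔼T-ER-≥ = subst₂ ℚ._≤_ (sym (ℚ.+-identityˡ (T ℚ.* p⁻ ³))) (sym (approx-𝔼T-ER m p n))
      (*-monoˡ T (ℚ.<⇒≤ 0<T) (³-mono (ℚ.<⇒≤ 0<p⁻) v[1-δ]≤p))

    𝔼T-ratio-≈ : ℚ.∣ approx (𝔼T-key n K P K≤P) m ℚ.* recip (approx (𝔼T-ER n p) m)
      ℚ.* recip (1ℚ ℚ.+ b) ℚ.- 1ℚ ∣ ℚ.≤ 64ℚ ℚ.* δ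
    𝔼T-ratio-≈ = bound (proj₂ (triangleProbability-≈ 0<K 2K≤P δ q 64δ≤1 hq 1-q≤δ))
      where
      bound : (Σ[ r ∈ ℚ ] r ℚ.* binom P K ≡ binom (P ℕ.∸ (K ℕ.+ K)) K ×
        v ³ ℚ.* (1ℚ ℚ.+ b) ℚ.* (1ℚ ℚ.- 32ℚ ℚ.* δ) ℚ.≤ triangleProbability q r ×
        triangleProbability q r ℚ.≤ v ³ ℚ.* (1ℚ ℚ.+ b) ℚ.* (1ℚ ℚ.+ 32ℚ ℚ.* δ)) →
        ℚ.∣ approx (𝔼T-key n K P K≤P) m ℚ.* recip (approx (𝔼T-ER n p) m)
          ℚ.* recip (1ℚ ℚ.+ b) ℚ.- 1ℚ ∣ ℚ.≤ 64ℚ ℚ.* δ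
      bound (r , hr , lower , upper) = subst (ℚ._≤ 64ℚ ℚ.* δ)
        (sym (cong₂ (λ s t → ℚ.∣ s ℚ.* recip t ℚ.* recip (1ℚ ℚ.+ b) ℚ.- 1ℚ ∣)
          (approx-𝔼T-key m K≤P q r hq hr n) (approx-𝔼T-ER m p n)))
        (ratio-close {T} {triangleProbability q r} {pₘ ³} {1ℚ ℚ.+ b} {64ℚ ℚ.* δ} 0<T (0<³ (ℚ.<-≤-trans 0<p⁻ v[1-δ]≤p)) 0<1+b
          (transfer-lower {v} {b} {pₘ} {triangleProbability q r} {δ} 0≤v 0≤b 0≤δ 64δ≤1 v[1-δ]≤p p≤v[1+δ] lower)
          (transfer-upper {v} {b} {pₘ} {triangleProbability q r} {δ} 0≤v 0≤b 0≤δ 64δ≤1 v[1-δ]≤p p≤v[1+δ] upper))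

mainTheorem3 : (θ : Scaling) → total (qSeq θ) ⟶ 1ᵣ →
    (p : ℕ → ℝ) → (∀ n → 1 ≤ n → 0ᵣ ≤ᵣ p n × p n ≤ᵣ 1ᵣ) →
    total p ∼ total (λ n → 1ᵣ -ᵣ qSeq θ n) →
    𝔼T-keySeq θ ⊘ 𝔼T-ERSeq p ∼ 1+P/K³ θ
mainTheorem3 θ q⟶1 p _ p∼1-q ε (e , 0<e , Mε , 0+e≤ε) =
  -- Approximants of `ε` are eventually at least `e`. One half of `e` bounds the error, the other is
  -- the gap that witnesses the strict inequality of reals.
  let (η , 0<η , η+η≡e) = half e 0<e
      (δ , 0<δ , 64δ≤1 , 64δ≤η) = small η 0<η
      (N₁ , h₁) = q⟶1 (ofℚ δ) (<ᵣ-ofℚ 0<δ)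
      (N₂ , h₂) = p∼1-q (ofℚ δ) (<ᵣ-ofℚ 0<δ)
  -- At least three vertices are needed for the denominator to be apart from 0.
  in (N₁ ℕ.⊔ N₂) ℕ.⊔ 3 , λ n N≤n →
  let N₁⊔N₂≤n = ℕ.m⊔n≤o⇒m≤o (N₁ ℕ.⊔ N₂) 3 N≤n
      3≤n     = ℕ.m⊔n≤o⇒n≤o (N₁ ℕ.⊔ N₂) 3 N≤n
      (_ , e₁ , 0<e₁ , M₁ , q-close) = h₁ n (ℕ.m⊔n≤o⇒m≤o N₁ N₂ N₁⊔N₂≤n)
      (_ , e₂ , 0<e₂ , M₂ , p-close) = h₂ n (ℕ.m⊔n≤o⇒n≤o N₁ N₂ N₁⊔N₂≤n)
  in atN η 0<η η+η≡e δ 0<δ 64δ≤1 64δ≤η n 3≤n (+gap⇒≤ 0<e₁ (q-close M₁ ℕ.≤-refl))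
       M₂ (λ m M₂≤m → +gap⇒≤ 0<e₂ (p-close m M₂≤m))
  where
  open Scaling θ
  module _ (η : ℚ) (0<η : 0ℚ ℚ.< η) (η+η≡e : η ℚ.+ η ≡ e)
    (δ : ℚ) (0<δ : 0ℚ ℚ.< δ) (64δ≤1 : 64ℚ ℚ.* δ ℚ.≤ 1ℚ) (64δ≤η : 64ℚ ℚ.* δ ℚ.≤ η)
    (n : ℕ) (3≤n : 3 ≤ n) (q-close : ℚ.∣ q (K n) (P n) ℚ.- 1ℚ ∣ ℚ.≤ δ)
    (M₂ : ℕ) (p-close : ∀ m → M₂ ≤ m → ℚ.∣ approx (p n) m ℚ.* recip (1ℚ ℚ.- q (K n) (P n)) ℚ.- 1ℚ ∣ ℚ.≤ δ)
    where
    private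
      Kₙ Pₙ : ℕ
      Kₙ = K n
      Pₙ = P n

      qₙ v b : ℚ
      qₙ = q Kₙ Pₙ
      v = 1ℚ ℚ.- qₙ
      b = Pₙ ÷ (Kₙ ℕ.^ 3)

      0<K : 0 ℕ.< Kₙ
      0<K = K-pos n (ℕ.≤-trans (s≤s z≤n) 3≤n)

      0<K³ : 0 ℕ.< Kₙ ℕ.^ 3
      0<K³ = ℕ.m^n>0 Kₙ {{ℕ.>-nonZero 0<K}} 3

      Kₙ≤Pₙ : Kₙ ≤ Pₙ
      Kₙ≤Pₙ = K≤P n (ℕ.≤-trans (s≤s (s≤s z≤n)) 3≤n)

      0≤δ : 0ℚ ℚ.≤ δ
      0≤δ = ℚ.<⇒≤ 0<δ

      v≤δ : v ℚ.≤ δ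
      v≤δ = ℚ.≤-trans (subst (ℚ._≤ ℚ.∣ qₙ ℚ.- 1ℚ ∣)
        (solve 1 (λ q → :- (q :- con 1ℚ) := con 1ℚ :- q) refl qₙ) (-p≤∣p∣ (qₙ ℚ.- 1ℚ))) q-close

      0<q : 0ℚ ℚ.< qₙ
      0<q = ℚ.<-≤-trans (0<1-δ 0≤δ 64δ≤1) (≤-by-gap (0≤-gap v≤δ)
        (solve 2 (λ q d → q := con 1ℚ :- d :+ (d :- (con 1ℚ :- q))) refl qₙ δ))

      2K≤P : Kₙ ℕ.+ Kₙ ≤ Pₙ
      2K≤P = proj₁ (q-binom Kₙ Pₙ 0<q)

      hq : qₙ ℚ.* binom Pₙ Kₙ ≡ binom (Pₙ ℕ.∸ Kₙ) Kₙ
      hq = proj₂ (q-binom Kₙ Pₙ 0<q)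

      1+b≡ : 1ℚ ℚ.+ b ≡ 1ℚ ℚ.+ + Pₙ ℚ./ 1 ℚ.* recip (+ (Kₙ ℕ.^ 3) ℚ./ 1)
      1+b≡ = cong₂ (λ s t → 1ℚ ℚ.+ s ℚ.* recip t) (sym (ofℕ-ι Pₙ)) (sym (ofℕ-ι (Kₙ ℕ.^ 3)))

      K³#0 : ofℕ (Kₙ ℕ.^ 3) #ᵣ 0ᵣ
      K³#0 = inj₂ (ι (Kₙ ℕ.^ 3) , 0<ι (Kₙ ℕ.^ 3) {{ℕ.>-nonZero 0<K³}} , 0 ,
        λ _ _ → ℚ.≤-reflexive (trans (ℚ.+-identityˡ (ι (Kₙ ℕ.^ 3))) (sym (ofℕ-ι (Kₙ ℕ.^ 3)))))

      1+P/K³#0 : at (1+P/K³ θ) n (tt , tt , tt , K³#0) #ᵣ 0ᵣ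
      1+P/K³#0 = inj₂ (1ℚ , ℚ.positive⁻¹ 1ℚ , 0 , λ _ _ →
        subst (0ℚ ℚ.+ 1ℚ ℚ.≤_) 1+b≡ (≤-by-gap (0≤÷ Pₙ 0<K³) refl))

      𝔼T-ER#0 : 𝔼T-ER n (p n) #ᵣ 0ᵣ
      𝔼T-ER#0 = inj₂ (_ , 0<𝔼T-ER-bound 0<K 2K≤P Kₙ≤Pₙ 3≤n δ qₙ 0≤δ 64δ≤1 hq v≤δ , M₂ , λ m M₂≤m →
        𝔼T-ER-≥ 0<K 2K≤P Kₙ≤Pₙ 3≤n δ qₙ 0≤δ 64δ≤1 hq v≤δ (p n) m (p-close m M₂≤m))

    atN : Σ[ d ∈ Defined ((𝔼T-keySeq θ ⊘ 𝔼T-ERSeq p) ⊘ 1+P/K³ θ) n ]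
      ∣ at ((𝔼T-keySeq θ ⊘ 𝔼T-ERSeq p) ⊘ 1+P/K³ θ) n d -ᵣ 1ᵣ ∣ᵣ <ᵣ ε
    atN = ((Kₙ≤Pₙ , tt , 𝔼T-ER#0) , (tt , tt , tt , K³#0) , 1+P/K³#0) ,
      η , 0<η , M₂ ℕ.⊔ Mε , λ m M≤m → ℚ.≤-trans
        (ℚ.+-monoˡ-≤ η (ℚ.≤-trans
          (subst (λ t → ℚ.∣ approx (𝔼T-key n Kₙ Pₙ Kₙ≤Pₙ) m ℚ.* recip (approx (𝔼T-ER n (p n)) m)
              ℚ.* recip t ℚ.- 1ℚ ∣ ℚ.≤ 64ℚ ℚ.* δ) 1+b≡
            (𝔼T-ratio-≈ 0<K 2K≤P Kₙ≤Pₙ 3≤n δ qₙ 0≤δ 64δ≤1 hq v≤δ (p n) m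
              (p-close m (ℕ.m⊔n≤o⇒m≤o M₂ Mε M≤m))))
          64δ≤η))
        (subst (ℚ._≤ approx ε m) (trans (ℚ.+-identityˡ e) (sym η+η≡e))
          (0+e≤ε m (ℕ.m⊔n≤o⇒n≤o M₂ Mε M≤m)))
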